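{- Let $m\ge1$. The poset $(\mathcal{W}(B_{2m}),\leqslant)$ is graded, with rank function $\ell_{\mathcal{W}}$, and its rank is $3m^2$.
   Context: For $k\ge1$, $B_k$ is the group of bijections $w$ of $[\pm k]=\{ -k,\dots,-1,1,\dots,k\}$ with $w(-a)=-w(a)$, in window notation $[w(1),\dots,w(k)]$; it is a Coxeter group with generators $(1,-1)$ and $(a,a+1)(-a,-a-1)$, $a\in[k-1]$; length $\ell_B(w)=\mathrm{inv}(w)+\mathrm{neg}(w)+\mathrm{nsp}(w)$ with $\mathrm{inv}(w)=|\{(a,b):1\le a<b\le k,\ w(a)>w(b)\}|$, $\mathrm{neg}(w)=|\{a\in[k]:w(a)<0\}|$, $\mathrm{nsp}(w)=|\{(a,b):1\le a<b\le k,\ w(a)+w(b)<0\}|$; $\leqslant$ is Bruhat order. For $a\in[n]$ let $a^*=a-1$ if $a$ even, $a^*=a+1$ if $a$ odd and $a+1\le n$, $a^*=n$ otherwise; $\mathcal{W}(B_n)=\{v\in B_n: |v^{ -1}(a)-v^{ -1}(a^*)|\le1\ \forall a\in[n-1]\}$ with the induced Bruhat order. Let $\chi(P)=1$ if $P$ holds, $0$ otherwise. Given $\sigma\in B_m$, $T\subseteq[m]$, define $v\in B_{2m}$ by $v(2i-1)=2\sigma(i)-\chi(\sigma(i)>0)$, $v(2i)=2\sigma(i)+\chi(\sigma(i)<0)$ if $i\notin T$, and $v(2i-1)=2\sigma(i)+\chi(\sigma(i)<0)$, $v(2i)=2\sigma(i)-\chi(\sigma(i)>0)$ if $i\in T$;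 this is a bijection $B_m\times\mathcal{P}([m])\to\mathcal{W}(B_{2m})$, and we write $v=(\sigma,T)$ and $\ell_{\mathcal{W}}(v)=\ell_B(v)-\ell_B(\sigma)$. -}

module Defs where

open import Data.Nat as ℕ using (ℕ; zero; suc; _≡ᵇ_)
open import Data.Integer as ℤ using (ℤ; +_; -[1+_]; ∣_∣)
open import Data.Integer.Properties using () renaming (_<?_ to _<ℤ?_)
open import Data.List using (List; []; _∷_; length; map; upTo)
open import Data.List.Relation.Unary.All using (All)
open import Data.List.Relation.Unary.Unique.Propositional using (Unique)
open import Data.Bool using (Bool; true; false; if_then_else_)
open import Data.Product using (Σ; _×_)
open import Data.Sum using (_⊎_)
open import Relation.Binary.PropositionalEquality using (_≡_; _≢_)
open import Relation.Nullary.Decidable using (⌊_⌋)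
open import Relation.Binary.Construct.Closure.ReflexiveTransitive using (Star)

-- An element w of B_n is represented by its window [w(1),...,w(n)] as a list of integers.
Window : Set
Window = List ℤ

countB : {A : Set} → (A → Bool) → List A → ℕ
countB p [] = 0
countB p (x ∷ xs) = (if p x then 1 else 0) ℕ.+ countB p xs

invB : Window → ℕ
invB [] = 0
invB (x ∷ xs) = countB (λ y → ⌊ y <ℤ? x ⌋) xs ℕ.+ invB xs

negB : Window → ℕ
negB = countB (λ y → ⌊ y <ℤ? + 0 ⌋)

nspB : Window → ℕ
nspB [] = 0
nspB (x ∷ xs) = countB (λ y → ⌊ x ℤ.+ y <ℤ? + 0 ⌋) xs ℕ.+ nspB xs

-- Coxeter length in type B
ℓB : Window → ℕ
ℓB w = invB w ℕ.+ negB w ℕ.+ nspB w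

IsB : ℕ → Window → Set
IsB n w = length w ≡ n × All (λ z → z ≢ + 0 × ∣ z ∣ ℕ.≤ n) w × Unique (map ∣_∣ w)

-- 0-indexed lookup with default 0
atℕ : Window → ℕ → ℤ
atℕ [] k = + 0
atℕ (x ∷ xs) zero = x
atℕ (x ∷ xs) (suc k) = atℕ xs k

-- w(a) for a ∈ [±n], extended by w(-a) = -w(a)
ev : Window → ℤ → ℤ
ev w (+ zero) = + 0
ev w (+ suc k) = atℕ w k
ev w -[1+ k ] = ℤ.- atℕ w k

InPM : ℕ → ℤ → Set
InPM n a = a ≢ + 0 × ∣ a ∣ ℕ.≤ n

compose : Window → Window → Window
compose u x = map (ev u) x

-- Coxeter generators of B_n: gen n 0 = (1,-1); gen n a = (a,a+1)(-a,-a-1) for a ∈ [n-1]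
gen : ℕ → ℕ → Window
gen n zero = map (λ k → if k ≡ᵇ 0 then -[1+ 0 ] else + suc k) (upTo n)
gen n (suc b) = map (λ k → if k ≡ᵇ b then + suc (suc b)
                           else if k ≡ᵇ suc b then + suc b
                           else + suc k) (upTo n)

IsGen : ℕ → Window → Set
IsGen n s = Σ ℕ (λ a → a ℕ.< n × s ≡ gen n a)

-- Bruhat covering step (Björner–Brenti Def. 2.1.1): u → w iff u⁻¹w is a reflection,
-- i.e. u⁻¹w = x s x⁻¹ for some x ∈ B_n and generator s (equivalently w∘x = u∘x∘s),
-- and ℓ(u) < ℓ(w).
BruhatStep : ℕ → Window → Window → Set
BruhatStep n u w =
  IsB n u × IsB n w ×
  Σ Window (λ x → Σ Window (λ s →
     IsB n x × IsGen n s × compose w x ≡ compose u (compose x s))) ×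
  ℓB u ℕ.< ℓB w

Bruhat : ℕ → Window → Window → Set
Bruhat n = Star (BruhatStep n)

isEven : ℕ → Bool
isEven zero = true
isEven (suc zero) = false
isEven (suc (suc k)) = isEven k

star : ℕ → ℕ → ℕ
star n a = if isEven a then a ℕ.∸ 1 else (if ⌊ suc a ℕ.≤? n ⌋ then suc a else n)

IsW : ℕ → Window → Set
IsW n v = IsB n v ×
  (∀ (a : ℕ) (b c : ℤ) → 1 ℕ.≤ a → a ℕ.< n → InPM n b → InPM n c →
     ev v b ≡ + a → ev v c ≡ + star n a → ∣ b ℤ.- c ∣ ℕ.≤ 1)

CoverW : ℕ → Window → Window → Set
CoverW n u v = IsW n u × IsW n v × Bruhat n u v × u ≢ v ×
  (∀ w → IsW n w → Bruhat n u w → Bruhat n w v → w ≡ u ⊎ w ≡ v)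

MinimalW : ℕ → Window → Set
MinimalW n u = IsW n u × (∀ w → IsW n w → Bruhat n w u → w ≡ u)

MaximalW : ℕ → Window → Set
MaximalW n u = IsW n u × (∀ w → IsW n w → Bruhat n u w → w ≡ u)

χ : Bool → ℤ
χ true = + 1
χ false = + 0

-- the map (σ, T) ↦ v ∈ 𝒲(B_{2m}); T ⊆ [m] is a list of m booleans (true = i ∈ T)
enc : Window → List Bool → Window
enc (s ∷ σ) (t ∷ T) =
  let p = (+ 2) ℤ.* s ℤ.- χ ⌊ + 0 <ℤ? s ⌋
      q = (+ 2) ℤ.* s ℤ.+ χ ⌊ s <ℤ? + 0 ⌋
  in (if t then q else p) ∷ (if t then p else q) ∷ enc σ T
enc _ _ = []

ℓW : Window → List Bool → ℤ
ℓW σ T = + ℓB (enc σ T) ℤ.- + ℓB σ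

{-# OPTIONS --safe #-}
module Submission where

-- Bruhat order on B_n is comparison, for every suffix of the window and every threshold j, of
-- the number of entries below j.  If x is strictly below y, lowering the last entry in which they
-- differ by a reflection with empty rectangle gives a cover of x still below y; this proves the
-- criterion and provides covers in B_m.
--
-- For 𝒲(B_2m) the criterion says that (σ,T) ≤ (τ,S) iff σ ≤ τ and, for every i ∈ T, one
-- inequality at the centre of the box (i , σ(i)) holds.  Moreover the rank of (σ,T) is
-- 3 (inv + nsp)(σ) + 2 neg(σ) + |T|.  Given (σ,T) < (τ,S), either some i can be added to T, or
-- every cover σ' = σ t ≤ τ moves only positions in T; removing these from T gives an element
-- (σ',T') of the interval, and the rank goes up by 3 − 2 or by 2 − 1.

open import Defs
open import Data.Nat as ℕ using (ℕ; zero; suc; _+_; _*_; _≤_; _<_; z≤n; s≤s)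
open import Data.Nat.Properties as ℕₚ using (+-comm; +-assoc; +-identityʳ; +-suc; +-mono-≤; +-monoʳ-≤; +-monoˡ-≤; +-cancelʳ-≤; ≤-refl; ≤-trans; ≤-reflexive; m≤m+n; m≤n+m)
open import Algebra.Properties.CommutativeSemigroup ℕₚ.+-commutativeSemigroup using (interchange; x∙yz≈y∙xz)
open import Data.Nat.Tactic.RingSolver using (solve-∀)
open import Data.Integer as ℤ using (ℤ; +_; -[1+_]; ∣_∣; -_)
open import Data.Integer.Properties as ℤₚ using (neg-mono-<; neg-cancel-<; neg-mono-≤; neg-involutive) renaming (_<?_ to _<ℤ?_; _≤?_ to _≤ℤ?_; _≟_ to _≟ℤ_)
open import Data.List using (List; []; _∷_; _++_; length; map; upTo; applyUpTo; downFrom)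
import Data.List.Properties as Listₚ
open import Data.List.Relation.Unary.All as All using (All; []; _∷_)
import Data.List.Relation.Unary.All.Properties as Allₚ
open import Data.List.Relation.Unary.Any using (here; there)
open import Data.List.Relation.Unary.AllPairs using ([]; _∷_)
open import Data.List.Relation.Unary.Unique.Propositional using (Unique)
import Data.List.Relation.Unary.Unique.Propositional.Properties as Uniqueₚ
open import Data.List.Membership.Propositional using (_∈_)
open import Data.List.Membership.DecPropositional ℕₚ._≟_ using (_∈?_)
open import Data.List.Membership.Propositional.Properties using (∈-∃++; ∈-++⁻; ∈-map⁻)
open import Data.List.Relation.Binary.Permutation.Propositional using (_↭_; ↭-refl; ↭-sym; ↭-trans; ↭-reflexive; prep; swap; ↭⇒↭ₛ)
import Data.List.Relation.Binary.Permutation.Propositional.Properties as ↭ₚ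
import Data.List.Relation.Binary.Permutation.Setoid.Properties as ↭ₛₚ
open import Data.Bool using (Bool; true; false; if_then_else_)
open import Data.Product using (Σ; ∃; _×_; _,_; proj₁; proj₂)
open import Data.Sum using (_⊎_; inj₁; inj₂; [_,_]′)
open import Data.Empty using (⊥; ⊥-elim)
open import Function using (_∘_; id)
open import Relation.Nullary using (¬_; Dec; yes; no)
open import Relation.Nullary.Decidable using (⌊_⌋; _×-dec_)
open import Relation.Binary.Definitions using (Tri; tri<; tri≈; tri>)
open import Relation.Binary.PropositionalEquality using (_≡_; _≢_; refl; sym; trans; cong; cong₂; subst; subst₂; setoid; module ≡-Reasoning)
open import Relation.Binary.Construct.Closure.ReflexiveTransitive using (ε; _◅_)

-- The weights 3, 2, 1 come from the blocks of two values. A pair of entries of σ counted by inv or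
-- nsp gives four such pairs of v; a negative entry gives one negative sum inside its block and two
-- negative entries; a mark gives one inversion inside its block. Subtracting the length of σ takes
-- back one pair and one negative entry. A cover of σ alone would thus raise the rank by 3 or 2, too
-- much for a grading, so marks have to disappear with it. This works exactly when no mark can be
-- added: a moved entry that was unmarked would leave a slack of one at its box, enough to mark it.
-- The other marks survive because the empty rectangle of the cover is invisible from their boxes.
-- The order is defined by arbitrary reflections, whose effect on length is never computed. Every
-- reflection makes the two windows comparable, and the half of the criterion already proved
-- excludes the wrong direction by length.

+-congʳ : ∀ a {b c} → b ≡ c → a + b ≡ a + c
+-congʳ a = cong (λ t → a + t)

+-congˡ : ∀ c {a b} → a ≡ b → a + c ≡ b + c
+-congˡ c = cong (λ t → t + c)

-- Integer order and its indicator function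

_<ᶻ_ _≤ᶻ_ : ℤ → ℤ → Set
_<ᶻ_ = ℤ._<_
_≤ᶻ_ = ℤ._≤_
infix 4 _<ᶻ_ _≤ᶻ_

ind : {P : Set} → Dec P → ℕ
ind d = if ⌊ d ⌋ then 1 else 0

ind-yes : {P : Set} (d : Dec P) → P → ind d ≡ 1
ind-yes (yes _) _ = refl
ind-yes (no ¬p) p = ⊥-elim (¬p p)

ind-no : {P : Set} (d : Dec P) → ¬ P → ind d ≡ 0
ind-no (yes p) ¬p = ⊥-elim (¬p p)
ind-no (no _) _ = refl

ind-mono : {P Q : Set} (d : Dec P) (e : Dec Q) → (P → Q) → ind d ≤ ind e
ind-mono (yes p) e f = ≤-reflexive (sym (ind-yes e (f p)))
ind-mono (no _) e f = z≤n

lt : ℤ → ℤ → ℕ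
lt a b = ind (a <ℤ? b)

lt-yes : ∀ {a b} → a <ᶻ b → lt a b ≡ 1
lt-yes {a} {b} = ind-yes (a <ℤ? b)

lt-no : ∀ {a b} → b ≤ᶻ a → lt a b ≡ 0
lt-no {a} {b} b≤a = ind-no (a <ℤ? b) (λ a<b → ℤₚ.<⇒≱ a<b b≤a)

lt-mono : ∀ {a b c d} → (a <ᶻ b → c <ᶻ d) → lt a b ≤ lt c d
lt-mono {a} {b} {c} {d} = ind-mono (a <ℤ? b) (c <ℤ? d)

lt-cong : ∀ {a b c d} → (a <ᶻ b → c <ᶻ d) → (c <ᶻ d → a <ᶻ b) → lt a b ≡ lt c d
lt-cong f g = ℕₚ.≤-antisym (lt-mono f) (lt-mono g)

lt-monoˡ : ∀ {a b} j → b ≤ᶻ a → lt a j ≤ lt b j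
lt-monoˡ j b≤a = lt-mono (ℤₚ.≤-<-trans b≤a)

lt≡0⇒≥ : ∀ {a b} → lt a b ≡ 0 → b ≤ᶻ a
lt≡0⇒≥ {a} {b} e with a <ℤ? b
... | no a≮b = ℤₚ.≮⇒≥ a≮b
lt≡0⇒≥ {a} {b} () | yes _

lt≤1 : ∀ a b → lt a b ≤ 1
lt≤1 a b with a <ℤ? b
... | yes _ = ≤-refl
... | no _ = z≤n

-<⇒ : ∀ {a b} → - a <ᶻ b → - b <ᶻ a
-<⇒ {a} {b} p = subst (- b <ᶻ_) (neg-involutive a) (neg-mono-< p)

<-⇒ : ∀ {a b} → a <ᶻ - b → b <ᶻ - a
<-⇒ {a} {b} p = subst (_<ᶻ - a) (neg-involutive b) (neg-mono-< p)

-≤⇒ : ∀ {a b} → - a ≤ᶻ b → - b ≤ᶻ a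
-≤⇒ {a} {b} p = subst (- b ≤ᶻ_) (neg-involutive a) (neg-mono-≤ p)

≤-⇒ : ∀ {a b} → a ≤ᶻ - b → b ≤ᶻ - a
≤-⇒ {a} {b} p = subst (_≤ᶻ - a) (neg-involutive b) (neg-mono-≤ p)

lt-neg : ∀ a b → lt a (- b) ≡ lt b (- a)
lt-neg a b = lt-cong <-⇒ <-⇒

lt-neg-neg : ∀ a b → lt (- a) (- b) ≡ lt b a
lt-neg-neg a b = lt-cong neg-cancel-< neg-mono-<

i<suc[i] : ∀ i → i <ᶻ ℤ.suc i
i<suc[i] i = ℤₚ.suc[i]≤j⇒i<j ℤₚ.≤-refl

<suc⇒≤ : ∀ {i j} → i <ᶻ ℤ.suc j → i ≤ᶻ j
<suc⇒≤ {i} {j} p = subst₂ _≤ᶻ_ (ℤₚ.pred-suc i) (ℤₚ.pred-suc j) (ℤₚ.+-monoʳ-≤ (-[1+ 0 ]) (ℤₚ.i<j⇒suc[i]≤j p))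

≤⇒<suc : ∀ {i j} → i ≤ᶻ j → i <ᶻ ℤ.suc j
≤⇒<suc {i} {j} p = ℤₚ.≤-<-trans p (i<suc[i] j)

-- Threshold counts and the suffix order

cnt : ℤ → List ℤ → ℕ
cnt j = countB (λ y → ⌊ y <ℤ? j ⌋)

cnt-++ : ∀ j xs ys → cnt j (xs ++ ys) ≡ cnt j xs + cnt j ys
cnt-++ j [] ys = refl
cnt-++ j (x ∷ xs) ys = trans (+-congʳ (lt x j) (cnt-++ j xs ys)) (sym (+-assoc (lt x j) (cnt j xs) (cnt j ys)))

cnt-++-congʳ : ∀ j xs {ys zs} → cnt j ys ≡ cnt j zs → cnt j (xs ++ ys) ≡ cnt j (xs ++ zs)
cnt-++-congʳ j [] e = e
cnt-++-congʳ j (x ∷ xs) e = +-congʳ (lt x j) (cnt-++-congʳ j xs e)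

cnt-++-monoʳ : ∀ j xs {ys zs} → cnt j ys ≤ cnt j zs → cnt j (xs ++ ys) ≤ cnt j (xs ++ zs)
cnt-++-monoʳ j [] e = e
cnt-++-monoʳ j (x ∷ xs) e = +-monoʳ-≤ (lt x j) (cnt-++-monoʳ j xs e)

cnt-∷-mid : ∀ j xs y ys → cnt j (xs ++ y ∷ ys) ≡ lt y j + cnt j (xs ++ ys)
cnt-∷-mid j [] y ys = refl
cnt-∷-mid j (x ∷ xs) y ys = trans (+-congʳ (lt x j) (cnt-∷-mid j xs y ys)) (x∙yz≈y∙xz (lt x j) (lt y j) _)

cnt-monoʲ : ∀ {i j} → i ≤ᶻ j → ∀ xs → cnt i xs ≤ cnt j xs
cnt-monoʲ i≤j [] = z≤n
cnt-monoʲ i≤j (x ∷ xs) = +-mono-≤ (lt-mono (λ p → ℤₚ.<-≤-trans p i≤j)) (cnt-monoʲ i≤j xs)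

cnt≤length : ∀ j xs → cnt j xs ≤ length xs
cnt≤length j [] = z≤n
cnt≤length j (x ∷ xs) = +-mono-≤ (lt≤1 x j) (cnt≤length j xs)

neg : List ℤ → List ℤ
neg = map -_

-- x ≼ y compares, for every suffix of the two windows and every threshold j, how many
-- entries are below j; this is the tableau criterion for Bruhat order in type B.
infix 4 _≼_
data _≼_ : List ℤ → List ℤ → Set where
  []  : [] ≼ []
  _∷_ : ∀ {x y xs ys} → (∀ j → cnt j (x ∷ xs) ≤ cnt j (y ∷ ys)) → xs ≼ ys → x ∷ xs ≼ y ∷ ys

≼-refl : ∀ {x} → x ≼ x
≼-refl {[]} = []
≼-refl {x ∷ xs} = (λ _ → ≤-refl) ∷ ≼-refl

≼-trans : ∀ {x y z} → x ≼ y → y ≼ z → x ≼ z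
≼-trans [] [] = []
≼-trans (p ∷ ps) (q ∷ qs) = (λ j → ≤-trans (p j) (q j)) ∷ ≼-trans ps qs

≼⇒cnt≤ : ∀ {x y} → x ≼ y → ∀ j → cnt j x ≤ cnt j y
≼⇒cnt≤ [] j = z≤n
≼⇒cnt≤ (p ∷ _) j = p j

≼-length : ∀ {x y} → x ≼ y → length x ≡ length y
≼-length [] = refl
≼-length (_ ∷ ps) = cong suc (≼-length ps)

≼-drop : ∀ A {X} B {Y} → length A ≡ length B → A ++ X ≼ B ++ Y → X ≼ Y
≼-drop [] [] _ p = p
≼-drop (a ∷ A) (b ∷ B) e (_ ∷ p) = ≼-drop A B (ℕₚ.suc-injective e) p

≼-++⁺ : ∀ A B {X X' Y} → length A ≡ length B → (∀ j → cnt j X' ≡ cnt j X) → A ++ X ≼ B ++ Y → X' ≼ Y → A ++ X' ≼ B ++ Y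
≼-++⁺ [] [] _ _ _ q = q
≼-++⁺ (a ∷ A) (b ∷ B) {X} {X'} e c (p ∷ ps) q =
  (λ j → ≤-trans (≤-reflexive (cnt-++-congʳ j (a ∷ A) (c j))) (p j))
  ∷ ≼-++⁺ A B (ℕₚ.suc-injective e) c ps q

-- Covering reflections

Outside : ℤ → ℤ → ℤ → Set
Outside lo hi a = a <ᶻ lo ⊎ hi <ᶻ a

-- Reflections that, read in the full window on [±n], exchange two entries with no
-- entry strictly inside the rectangle they span: exactly the Bruhat covers.
data Move : List ℤ → List ℤ → Set where
  exchange : ∀ A d B p C → d <ᶻ p → All (Outside d p) B →
             Move (A ++ d ∷ B ++ p ∷ C) (A ++ p ∷ B ++ d ∷ C)
  flip     : ∀ A p C → + 0 <ᶻ p → All (Outside (- p) p) A →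
             Move (A ++ p ∷ C) (A ++ - p ∷ C)
  negswap  : ∀ A d B p C → - d <ᶻ p → (d <ᶻ + 0 × + 0 <ᶻ p) ⊎ (+ 0 <ᶻ d × p <ᶻ + 0) →
             All (Outside (- d) p) A → All (Outside (- p) d) A → All (Outside (- d) p) B →
             Move (A ++ d ∷ B ++ p ∷ C) (A ++ - p ∷ B ++ - d ∷ C)

-- Lowering entries under a fixed upper bound

Avoids : ℤ → ℤ → ℤ → Set
Avoids q p a = ¬ (q ≤ᶻ a × a <ᶻ p)

avoids? : ∀ q p a → Dec (q ≤ᶻ a × a <ᶻ p)
avoids? q p a = (q ≤ℤ? a) ×-dec (a <ℤ? p)

avoids-lt : ∀ {q p a j} → Avoids q p a → q ≤ᶻ j → j ≤ᶻ p → lt a j ≡ lt a q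
avoids-lt av q≤j j≤p = lt-cong
  (λ a<j → ℤₚ.≰⇒> (λ q≤a → av (q≤a , ℤₚ.<-≤-trans a<j j≤p)))
  (λ a<q → ℤₚ.<-≤-trans a<q q≤j)

avoids-cnt : ∀ {q p j} Z → All (Avoids q p) Z → q ≤ᶻ j → j ≤ᶻ p → cnt j Z ≡ cnt q Z
avoids-cnt [] [] _ _ = refl
avoids-cnt (z ∷ Z) (a ∷ as) l u = cong₂ _+_ (avoids-lt a l u) (avoids-cnt Z as l u)

-- When the threshold grows from `q` to `j`, the count over `Z` cannot grow, since no entry lies in
-- [q, p), and `p` is still not counted; on the other side `q` becomes counted. The inequality at
-- `q` therefore gains one at `j`.
avoids-strict : ∀ {q p j} Z Y C → All (Avoids q p) Z → cnt q (Z ++ p ∷ C) ≤ cnt q (Y ++ q ∷ C) →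
  q <ᶻ j → j ≤ᶻ p → cnt j (Z ++ p ∷ C) < cnt j (Y ++ q ∷ C)
avoids-strict {q} {p} {j} Z Y C av h q<j j≤p = begin-strict
  cnt j (Z ++ p ∷ C)        ≡⟨ cnt-∷-mid j Z p C ⟩
  lt p j + cnt j (Z ++ C)   ≡⟨ cong₂ _+_ (lt-no j≤p) (cnt-++ j Z C) ⟩
  cnt j Z + cnt j C         <⟨ ℕₚ.n<1+n _ ⟩
  1 + (cnt j Z + cnt j C)   ≡⟨ cong (λ t → 1 + (t + cnt j C)) (avoids-cnt Z av (ℤₚ.<⇒≤ q<j) j≤p) ⟩
  1 + (cnt q Z + cnt j C)   ≤⟨ +-monoʳ-≤ 1 (+-monoˡ-≤ (cnt j C) ZY) ⟩
  1 + (cnt j Y + cnt j C)   ≡⟨ cong₂ _+_ (lt-yes q<j) (cnt-++ j Y C) ⟨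
  lt q j + cnt j (Y ++ C)   ≡⟨ cnt-∷-mid j Y q C ⟨
  cnt j (Y ++ q ∷ C)        ∎
  where
  open ℕₚ.≤-Reasoning
  q≤p : q ≤ᶻ p
  q≤p = ℤₚ.≤-trans (ℤₚ.<⇒≤ q<j) j≤p
  split : ∀ X r → lt r q ≡ 0 → cnt q (X ++ r ∷ C) ≡ cnt q X + cnt q C
  split X r e = trans (cnt-∷-mid q X r C) (cong₂ _+_ e (cnt-++ q X C))
  ZY : cnt q Z ≤ cnt j Y
  ZY = ≤-trans
    (+-cancelʳ-≤ (cnt q C) (cnt q Z) (cnt q Y) (subst₂ _≤_ (split Z p (lt-no q≤p)) (split Y q (lt-no ℤₚ.≤-refl)) h))
    (cnt-monoʲ (ℤₚ.<⇒≤ q<j) Y)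

-- Replacing `p` by `r` raises the count only at thresholds in (r, p], and only by one; there
-- `avoids-strict` supplies the room.
avoids-lower : ∀ {q p r} Z Y C → All (Avoids q p) Z → (∀ j → cnt j (Z ++ p ∷ C) ≤ cnt j (Y ++ q ∷ C)) →
  q ≤ᶻ r → r <ᶻ p → ∀ j → cnt j (Z ++ r ∷ C) ≤ cnt j (Y ++ q ∷ C)
avoids-lower {q} {p} {r} Z Y C av h q≤r r<p j with r <ℤ? j | j ≤ℤ? p
... | no r≮j | _ = ≤-trans (≤-reflexive (trans (cnt-∷-mid j Z r C) (+-congˡ _ (lt-no (ℤₚ.≮⇒≥ r≮j)))))
                   (≤-trans (m≤n+m _ (lt p j)) (≤-trans (≤-reflexive (sym (cnt-∷-mid j Z p C))) (h j)))
... | yes r<j | no j≰p = ≤-trans (≤-reflexive (trans (cnt-∷-mid j Z r C)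
                   (trans (+-congˡ _ (trans (lt-yes r<j) (sym (lt-yes (ℤₚ.≰⇒> j≰p))))) (sym (cnt-∷-mid j Z p C))))) (h j)
... | yes r<j | yes j≤p = ≤-trans (≤-reflexive (cnt-∷-mid j Z r C))
      (≤-trans (+-monoˡ-≤ (cnt j (Z ++ C)) (lt≤1 r j))
      (≤-trans (s≤s (≤-trans (m≤n+m _ (lt p j)) (≤-reflexive (sym (cnt-∷-mid j Z p C)))))
               (avoids-strict Z Y C av (h q) (ℤₚ.≤-<-trans q≤r r<j) j≤p)))

≼-lower : ∀ {q p r} Z Y C → length Z ≡ length Y → All (Avoids q p) Z → Z ++ p ∷ C ≼ Y ++ q ∷ C →
  q ≤ᶻ r → r <ᶻ p → Z ++ r ∷ C ≼ Y ++ q ∷ C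
≼-lower [] [] C _ av h@(_ ∷ t) q≤r r<p = avoids-lower [] [] C av (≼⇒cnt≤ h) q≤r r<p ∷ t
≼-lower (z ∷ Z) (y ∷ Y) C e av@(_ ∷ av') h@(_ ∷ t) q≤r r<p =
  avoids-lower (z ∷ Z) (y ∷ Y) C av (≼⇒cnt≤ h) q≤r r<p ∷ ≼-lower Z Y C (ℕₚ.suc-injective e) av' t q≤r r<p

cnt-exchange : ∀ d B p C j → cnt j (p ∷ B ++ d ∷ C) ≡ cnt j (d ∷ B ++ p ∷ C)
cnt-exchange d B p C j = trans (+-congʳ (lt p j) (cnt-∷-mid j B d C))
  (trans (x∙yz≈y∙xz (lt p j) (lt d j) (cnt j (B ++ C))) (+-congʳ (lt d j) (sym (cnt-∷-mid j B p C))))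

-- Suffixes that contain both positions are merely rearranged. In the shorter ones the exchange
-- looks like lowering `p` to `d`.
≼-exchange : ∀ {q p d} A B C Y₁ y Y₂ → length A ≡ length Y₁ → length B ≡ length Y₂ → All (Avoids q p) B →
  A ++ d ∷ B ++ p ∷ C ≼ Y₁ ++ y ∷ Y₂ ++ q ∷ C → q ≤ᶻ d → d <ᶻ p →
  A ++ p ∷ B ++ d ∷ C ≼ Y₁ ++ y ∷ Y₂ ++ q ∷ C
≼-exchange {q} {p} {d} A B C Y₁ y Y₂ e₁ e₂ av h q≤d d<p with ≼-drop A Y₁ e₁ h
... | h' ∷ t = ≼-++⁺ A Y₁ e₁ (cnt-exchange d B p C) h
  ((λ j → ≤-trans (≤-reflexive (cnt-exchange d B p C j)) (h' j)) ∷ ≼-lower B Y₂ C e₂ av t q≤d d<p)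

-- Over the integers z ≥ j means - z < 1 - j, so the threshold 1 - j on the negated list counts the
-- complement. Comparisons are thereby reversed by negation.
cnt-neg : ∀ j Q → cnt j Q + cnt (ℤ.suc (- j)) (neg Q) ≡ length Q
cnt-neg j [] = refl
cnt-neg j (z ∷ Q) = trans (interchange (lt z j) (cnt j Q) _ _) (cong₂ _+_ one (cnt-neg j Q))
  where
  one : lt z j + lt (- z) (ℤ.suc (- j)) ≡ 1
  one with z <ℤ? j
  ... | yes p = cong suc (lt-no (ℤₚ.i<j⇒suc[i]≤j (neg-mono-< p)))
  ... | no ¬p = lt-yes (≤⇒<suc (neg-mono-≤ (ℤₚ.≮⇒≥ ¬p)))

cnt-neg-< : ∀ j Q Q' → length Q ≡ length Q' → cnt (ℤ.suc (- j)) (neg Q') < cnt (ℤ.suc (- j)) (neg Q) → cnt j Q < cnt j Q'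
cnt-neg-< j Q Q' e h = ℕₚ.≰⇒> (λ le → ℕₚ.<-irrefl (trans (cnt-neg j Q') (trans (sym e) (sym (cnt-neg j Q))))
  (ℕₚ.+-mono-≤-< le h))

cnt-neg-≤ : ∀ j Q Q' → length Q ≡ length Q' → cnt j Q ≤ cnt j Q' → cnt (ℤ.suc (- j)) (neg Q') ≤ cnt (ℤ.suc (- j)) (neg Q)
cnt-neg-≤ j Q Q' e h = ℕₚ.≮⇒≥ (λ l → ℕₚ.<-irrefl (trans (cnt-neg j Q) (trans e (sym (cnt-neg j Q'))))
  (ℕₚ.+-mono-≤-< h l))

suc-neg-suc-neg : ∀ i → ℤ.suc (- ℤ.suc (- i)) ≡ i
suc-neg-suc-neg i = trans (cong (λ t → + 1 ℤ.+ t) (ℤₚ.neg-distrib-+ (+ 1) (- i)))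
  (trans (sym (ℤₚ.+-assoc (+ 1) (- (+ 1)) (- - i))) (trans (ℤₚ.+-identityˡ _) (neg-involutive i)))

module _ {q p d : ℤ} {B Y₂ : List ℤ} (y : ℤ) (C : List ℤ)
  (q≤-d : q ≤ᶻ - d) (-d<p : - d <ᶻ p) (signs : (d <ᶻ + 0 × + 0 <ᶻ p) ⊎ (+ 0 <ᶻ d × p <ᶻ + 0))
  (av-d : Avoids q p d) (av-B : All (Avoids q p) B) (|B|≡|Y₂| : length B ≡ length Y₂) where

  private
    old new : List ℤ → List ℤ
    old A = A ++ d ∷ B ++ p ∷ C
    new A = A ++ - p ∷ B ++ - d ∷ C

  -- Where `- p` and `d` count alike, only the change from `p` to `- d` is visible, and that is a
  -- lowering.
  cnt-low : ∀ A Y₁ → All (Avoids q p) A → old A ≼ Y₁ ++ y ∷ Y₂ ++ q ∷ C → ∀ j → lt (- p) j ≡ lt d j →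
    cnt j (new A) ≤ cnt j (Y₁ ++ y ∷ Y₂ ++ q ∷ C)
  cnt-low A Y₁ av-A h j e = ≤-trans (≤-reflexive (cnt-++-congʳ j A (+-congˡ _ e)))
    (subst₂ (λ s t → cnt j s ≤ cnt j t) (Listₚ.++-assoc A (d ∷ B) (- d ∷ C)) (Listₚ.++-assoc Y₁ (y ∷ Y₂) (q ∷ C))
      (avoids-lower (A ++ d ∷ B) (Y₁ ++ y ∷ Y₂) C (Allₚ.++⁺ av-A (av-d ∷ av-B))
        (λ i → subst₂ (λ s t → cnt i s ≤ cnt i t) (sym (Listₚ.++-assoc A (d ∷ B) (p ∷ C)))
          (sym (Listₚ.++-assoc Y₁ (y ∷ Y₂) (q ∷ C))) (≼⇒cnt≤ h i))
        q≤-d -d<p j))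

  -- The delicate thresholds are - p < j ≤ d, where the count rises by one and strictness is needed
  -- beforehand. It is imported from the other half of the full window: `avoids-strict` gives it at
  -- 1 - j for `Z ++ p ∷ C`, then `R` turns it into strictness for the negated suffix, and
  -- complementing returns to `j`.
  cnt-negswap : ∀ A Y₁ Z Y → All (Avoids q p) A → All (Avoids q p) Z →
    old A ≼ Y₁ ++ y ∷ Y₂ ++ q ∷ C →
    (∀ k → cnt k (Z ++ p ∷ C) + cnt k (neg (old A)) ≡ cnt k (Y ++ q ∷ C) + cnt k (neg (Y₁ ++ y ∷ Y₂ ++ q ∷ C))) →
    ∀ j → cnt j (new A) ≤ cnt j (Y₁ ++ y ∷ Y₂ ++ q ∷ C)
  cnt-negswap A Y₁ Z Y av-A av-Z h R j with - p <ℤ? j | j ≤ℤ? d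
  ... | yes -p<j | yes j≤d = ≤-trans (≤-reflexive (expand (- p) (- d)))
    (≤-trans (+-mono-≤ (lt≤1 (- p) j) (+-monoˡ-≤ _ (≤-reflexive same)))
    (≤-trans (s≤s (≤-trans (m≤n+m _ (lt d j)) (≤-reflexive (sym (expand d p))))) strict))
    where
    expand : ∀ e f → cnt j (A ++ e ∷ B ++ f ∷ C) ≡ lt e j + (lt f j + cnt j (A ++ B ++ C))
    expand e f = trans (cnt-∷-mid j A e _) (+-congʳ (lt e j) (trans (cong (cnt j) (sym (Listₚ.++-assoc A B _)))
      (trans (cnt-∷-mid j (A ++ B) f C) (+-congʳ (lt f j) (cong (cnt j) (Listₚ.++-assoc A B C))))))
    -- If d < 0 < p, then j ≤ d < 0 lies below both entries; if p < 0 < d, then j > - p > 0 lies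
    -- above both.
    same : lt (- d) j ≡ lt p j
    same = [ (λ (d<0 , 0<p) → trans (lt-no (ℤₚ.≤-trans j≤d (ℤₚ.<⇒≤ (ℤₚ.<-trans d<0 (neg-mono-< d<0)))))
                                    (sym (lt-no (ℤₚ.≤-trans j≤d (ℤₚ.<⇒≤ (ℤₚ.<-trans d<0 0<p))))))
           , (λ (0<d , p<0) → let 0<j = ℤₚ.<-trans (neg-mono-< p<0) -p<j in
                trans (lt-yes (ℤₚ.<-trans (neg-mono-< 0<d) 0<j)) (sym (lt-yes (ℤₚ.<-trans p<0 0<j)))) ]′ signs
    Q' = Y₁ ++ y ∷ Y₂ ++ q ∷ C
    -- The extended suffixes are not compared by `h` directly: the comparison at `q` is the mirror
    -- image under `R` of the one at 1 - q.
    cnt-q : cnt q (Z ++ p ∷ C) ≤ cnt q (Y ++ q ∷ C)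
    cnt-q = ℕₚ.≮⇒≥ (λ l → ℕₚ.<-irrefl (sym (R q)) (ℕₚ.+-mono-<-≤ l
      (subst (λ t → cnt t (neg Q') ≤ cnt t (neg (old A))) (suc-neg-suc-neg q)
        (cnt-neg-≤ (ℤ.suc (- q)) (old A) Q' (≼-length h) (≼⇒cnt≤ h _)))))
    k = ℤ.suc (- j)
    strict-k : cnt k (Z ++ p ∷ C) < cnt k (Y ++ q ∷ C)
    strict-k = avoids-strict Z Y C av-Z cnt-q (≤⇒<suc (ℤₚ.≤-trans q≤-d (neg-mono-≤ j≤d))) (ℤₚ.i<j⇒suc[i]≤j (-<⇒ -p<j))
    strict : cnt j (old A) < cnt j Q'
    strict = cnt-neg-< j (old A) Q' (≼-length h)
      (ℕₚ.≰⇒> (λ l → ℕₚ.<-irrefl (R k) (ℕₚ.+-mono-<-≤ strict-k l)))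
  ... | yes -p<j | no j≰d = cnt-low A Y₁ av-A h j (trans (lt-yes -p<j) (sym (lt-yes (ℤₚ.≰⇒> j≰d))))
  ... | no -p≮j | _ = cnt-low A Y₁ av-A h j (trans (lt-no (ℤₚ.≮⇒≥ -p≮j)) (sym (lt-no (ℤₚ.≤-trans (ℤₚ.≮⇒≥ -p≮j) (ℤₚ.<⇒≤ (-<⇒ {d} -d<p))))))

  -- Z and Y are the parts of the full windows on [±n] to the right of the mirror image of
  -- the current position, so that the hypothesis R is the symmetry w(-a) = -w(a).
  ≼-negswap : ∀ A Y₁ Z Y → length A ≡ length Y₁ → All (Avoids q p) A → All (Avoids q p) (neg A) → All (Avoids q p) Z →
    old A ≼ Y₁ ++ y ∷ Y₂ ++ q ∷ C →
    (∀ k → cnt k (Z ++ p ∷ C) + cnt k (neg (old A)) ≡ cnt k (Y ++ q ∷ C) + cnt k (neg (Y₁ ++ y ∷ Y₂ ++ q ∷ C))) →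
    new A ≼ Y₁ ++ y ∷ Y₂ ++ q ∷ C
  ≼-negswap [] [] Z Y _ av-A _ av-Z h@(_ ∷ t) R =
    cnt-negswap [] [] Z Y av-A av-Z h R ∷ ≼-lower B Y₂ C |B|≡|Y₂| av-B t q≤-d -d<p
  ≼-negswap (a ∷ A) (b ∷ Y₁) Z Y e av-A@(_ ∷ av-A') (av-a ∷ av-negA) av-Z h@(_ ∷ t) R =
    cnt-negswap (a ∷ A) (b ∷ Y₁) Z Y av-A av-Z h R
    ∷ ≼-negswap A Y₁ (- a ∷ Z) (- b ∷ Y) (ℕₚ.suc-injective e) av-A' av-negA (av-a ∷ av-Z) t
        (λ k → trans (rotate (lt (- a) k) _ _) (trans (R k) (sym (rotate (lt (- b) k) _ _))))
    where
    rotate : ∀ a b c → (a + b) + c ≡ b + (a + c)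
    rotate = solve-∀

-- The last difference and searching to its left

lastDifference : ∀ {x y} → x ≼ y → x ≢ y →
  ∃ λ A → ∃ λ p → ∃ λ B → ∃ λ q → ∃ λ C → x ≡ A ++ p ∷ C × y ≡ B ++ q ∷ C × length A ≡ length B × q <ᶻ p
lastDifference [] x≢y = ⊥-elim (x≢y refl)
lastDifference {x ∷ xs} {y ∷ ys} (h ∷ t) x≢y with Listₚ.≡-dec _≟ℤ_ xs ys
-- The tails agree and `y` is not below itself, so the comparison at threshold `y` says that `x` is
-- not below `y` either.
... | yes refl = [] , x , [] , y , xs , refl , refl , refl ,
  ℤₚ.≤∧≢⇒< (lt≡0⇒≥ (ℕₚ.n≤0⇒n≡0 (+-cancelʳ-≤ (cnt y xs) (lt x y) 0
    (≤-trans (h y) (≤-reflexive (+-congˡ (cnt y xs) (lt-no (ℤₚ.≤-refl {y})))))))) (λ e → x≢y (cong (_∷ xs) (sym e)))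
... | no xs≢ys with lastDifference t xs≢ys
... | A , p , B , q , C , refl , refl , e , q<p = x ∷ A , p , y ∷ B , q , C , refl , refl , cong suc e , q<p

module _ {X : Set} {P : X → Set} (P? : ∀ x → Dec (P x)) where

  findFirst : ∀ xs → All (¬_ ∘ P) xs ⊎ (∃ λ A → ∃ λ d → ∃ λ B → xs ≡ A ++ d ∷ B × P d × All (¬_ ∘ P) A)
  findFirst [] = inj₁ []
  findFirst (x ∷ xs) with P? x
  ... | yes px = inj₂ ([] , x , xs , refl , px , [])
  ... | no ¬px with findFirst xs
  ... | inj₁ none = inj₁ (¬px ∷ none)
  ... | inj₂ (A , d , B , refl , pd , none) = inj₂ (x ∷ A , d , B , refl , pd , ¬px ∷ none)

  findLast : ∀ xs → All (¬_ ∘ P) xs ⊎ (∃ λ A → ∃ λ d → ∃ λ B → xs ≡ A ++ d ∷ B × P d × All (¬_ ∘ P) B)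
  findLast [] = inj₁ []
  findLast (x ∷ xs) with findLast xs
  ... | inj₂ (A , d , B , refl , pd , none) = inj₂ (x ∷ A , d , B , refl , pd , none)
  ... | inj₁ none with P? x
  ... | yes px = inj₂ ([] , x , xs , refl , px , none)
  ... | no ¬px = inj₁ (¬px ∷ none)

splitLike : {X Y : Set} (A : List X) {d : X} {B : List X} (L : List Y) → length (A ++ d ∷ B) ≡ length L →
  ∃ λ Y₁ → ∃ λ y → ∃ λ Y₂ → L ≡ Y₁ ++ y ∷ Y₂ × length A ≡ length Y₁ × length B ≡ length Y₂
splitLike [] (y ∷ L) e = [] , y , L , refl , refl , ℕₚ.suc-injective e
splitLike (a ∷ A) (y ∷ L) e with splitLike A L (ℕₚ.suc-injective e)
... | Y₁ , y' , Y₂ , refl , e₁ , e₂ = y ∷ Y₁ , y' , Y₂ , refl , cong suc e₁ , e₂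

avoids⇒outside : ∀ {q p lo a} → q ≤ᶻ lo → a ≢ p → Avoids q p a → Outside lo p a
avoids⇒outside {q} {p} {lo} {a} q≤lo a≢p av with a <ℤ? q
... | yes a<q = inj₁ (ℤₚ.<-≤-trans a<q q≤lo)
... | no a≮q = inj₂ (ℤₚ.≤∧≢⇒< (ℤₚ.≮⇒≥ (λ a<p → av (ℤₚ.≮⇒≥ a≮q , a<p))) (a≢p ∘ sym))

unique-++ : ∀ A {p C} → Unique (map ∣_∣ (A ++ p ∷ C)) → All (λ a → ∣ a ∣ ≢ ∣ p ∣) A
unique-++ [] u = []
unique-++ (a ∷ A) (h ∷ u) = All.head (Allₚ.++⁻ʳ A (Allₚ.map⁻ h)) ∷ unique-++ A u

unique-tail : ∀ A {X} → Unique (map ∣_∣ (A ++ X)) → Unique (map ∣_∣ X)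
unique-tail [] u = u
unique-tail (a ∷ A) (_ ∷ u) = unique-tail A u

∣≢∣⇒≢ : ∀ {a b} → ∣ a ∣ ≢ ∣ b ∣ → a ≢ b
∣≢∣⇒≢ n refl = n refl

∣≢∣⇒-≢ : ∀ {a b} → ∣ a ∣ ≢ ∣ b ∣ → - a ≢ b
∣≢∣⇒-≢ {a} n refl = n (sym (ℤₚ.∣-i∣≡∣i∣ a))

∣≡∣⇒≡± : ∀ i j → ∣ i ∣ ≡ ∣ j ∣ → i ≡ j ⊎ i ≡ - j
∣≡∣⇒≡± (+ _) (+ _) refl = inj₁ refl
∣≡∣⇒≡± (+ _) -[1+ _ ] refl = inj₂ refl
∣≡∣⇒≡± -[1+ _ ] (+ _) refl = inj₂ refl
∣≡∣⇒≡± -[1+ _ ] -[1+ _ ] refl = inj₁ refl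

-- Absolute values of a window

unique-↭ : {xs ys : List ℕ} → xs ↭ ys → Unique xs → Unique ys
unique-↭ p = ↭ₛₚ.Unique-resp-↭ (setoid ℕ) (↭⇒↭ₛ p)

∈-range : ∀ n {x} → 1 ≤ x → x ≤ n → x ∈ map suc (downFrom n)
∈-range zero (s≤s _) ()
∈-range (suc n) {x} 1≤x x≤1+n with x ℕ.≟ suc n
... | yes e = here e
... | no ne = there (∈-range n 1≤x (ℕₚ.≤-pred (ℕₚ.≤∧≢⇒< x≤1+n ne)))

-- Pigeonhole by induction: if the largest value occurs, remove it. Otherwise the tail already
-- exhausts the smaller range, and the head would be a repetition.
unique⇒↭range : ∀ n xs → length xs ≡ n → All (λ z → 1 ≤ z × z ≤ n) xs → Unique xs → xs ↭ map suc (downFrom n)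
unique⇒↭range zero [] _ _ _ = ↭-refl
unique⇒↭range (suc n) xs len bd u with suc n ∈? xs
... | yes i with ∈-∃++ i
... | ys , zs , refl with ↭ₚ.shift (suc n) ys zs
... | sh with unique-↭ sh u | ↭ₚ.All-resp-↭ sh bd
... | n≢ ∷ u' | _ ∷ bd' = ↭-trans sh (prep (suc n) (unique⇒↭range n (ys ++ zs)
  (ℕₚ.suc-injective (trans (sym (↭ₚ.↭-length sh)) len))
  (All.zipWith (λ (ne , 1≤z , z≤) → 1≤z , ℕₚ.≤-pred (ℕₚ.≤∧≢⇒< z≤ (ne ∘ sym))) (n≢ , bd')) u'))
unique⇒↭range (suc n) (x ∷ xs) len bd (x≢ ∷ u) | no i =
  ⊥-elim (All.lookup x≢ (↭ₚ.∈-resp-↭ (↭-sym xs↭) (∈-range n (proj₁ (All.head small)) (proj₂ (All.head small)))) refl)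
  where
  small : All (λ z → 1 ≤ z × z ≤ n) (x ∷ xs)
  small = All.tabulate (λ {z} z∈ → proj₁ (All.lookup bd z∈) ,
    ℕₚ.≤-pred (ℕₚ.≤∧≢⇒< (proj₂ (All.lookup bd z∈)) (λ e → i (subst (_∈ x ∷ xs) e z∈))))
  xs↭ : xs ↭ map suc (downFrom n)
  xs↭ = unique⇒↭range n xs (ℕₚ.suc-injective len) (All.tail small) u

≢0⇒1≤∣∣ : ∀ {z} → z ≢ + 0 → 1 ≤ ∣ z ∣
≢0⇒1≤∣∣ {+ zero} n = ⊥-elim (n refl)
≢0⇒1≤∣∣ {+ suc _} n = s≤s z≤n
≢0⇒1≤∣∣ { -[1+ _ ]} n = s≤s z≤n

IsB⇒↭range : ∀ {n x} → IsB n x → map ∣_∣ x ↭ map suc (downFrom n)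
IsB⇒↭range {n} {x} (len , bd , u) = unique⇒↭range n (map ∣_∣ x) (trans (Listₚ.length-map ∣_∣ x) len)
  (Allₚ.map⁺ (All.map (λ (z≢0 , ub) → ≢0⇒1≤∣∣ z≢0 , ub) bd)) u

IsB-↭ : ∀ {n x y} → IsB n x → IsB n y → map ∣_∣ x ↭ map ∣_∣ y
IsB-↭ bx by = ↭-trans (IsB⇒↭range bx) (↭-sym (IsB⇒↭range by))

IsB-resp-↭ : ∀ {n x y} → map ∣_∣ x ↭ map ∣_∣ y → IsB n x → IsB n y
IsB-resp-↭ {n} {x} {y} p (len , bd , u) =
  trans (sym (Listₚ.length-map ∣_∣ y)) (trans (sym (↭ₚ.↭-length p)) (trans (Listₚ.length-map ∣_∣ x) len)) ,
  All.map (λ (1≤z , ub) → (λ { refl → ℕₚ.1+n≰n 1≤z }) , ub)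
    (Allₚ.map⁻ {f = ∣_∣} (↭ₚ.All-resp-↭ {P = λ z → 1 ≤ z × z ≤ n} p (Allₚ.map⁺ (All.map (λ (z≢0 , ub) → ≢0⇒1≤∣∣ z≢0 , ub) bd)))) ,
  unique-↭ p u

cnt-↭ : ∀ k {xs ys} → xs ↭ ys → cnt k xs ≡ cnt k ys
cnt-↭ k _↭_.refl = refl
cnt-↭ k (prep x p) = +-congʳ (lt x k) (cnt-↭ k p)
cnt-↭ k (swap x y p) = trans (x∙yz≈y∙xz (lt x k) (lt y k) _) (+-congʳ (lt y k) (+-congʳ (lt x k) (cnt-↭ k p)))
cnt-↭ k (_↭_.trans p q) = trans (cnt-↭ k p) (cnt-↭ k q)

cnt+cnt-neg-∣∣ : ∀ k x → cnt k x + cnt k (neg x) ≡ cnt k (map +_ (map ∣_∣ x)) + cnt k (neg (map +_ (map ∣_∣ x)))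
cnt+cnt-neg-∣∣ k [] = refl
cnt+cnt-neg-∣∣ k (z ∷ x) = trans (interchange (lt z k) _ (lt (- z) k) _)
  (trans (cong₂ _+_ (fold z) (cnt+cnt-neg-∣∣ k x)) (sym (interchange (lt (+ ∣ z ∣) k) _ (lt (- + ∣ z ∣) k) _)))
  where
  fold : ∀ z → lt z k + lt (- z) k ≡ lt (+ ∣ z ∣) k + lt (- + ∣ z ∣) k
  fold (+ _) = refl
  fold -[1+ n ] = +-comm (lt -[1+ n ] k) (lt (+ suc n) k)

-- A window together with its negative is a multiset that depends only on the absolute values. This
-- provides the symmetry that `≼-negswap` asks for.
cnt+cnt-neg-↭ : ∀ k {x y} → map ∣_∣ x ↭ map ∣_∣ y → cnt k x + cnt k (neg x) ≡ cnt k y + cnt k (neg y)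
cnt+cnt-neg-↭ k {x} {y} p = trans (cnt+cnt-neg-∣∣ k x)
  (trans (cong₂ _+_ (cnt-↭ k (↭ₚ.map⁺ +_ p)) (cnt-↭ k (↭ₚ.map⁺ -_ (↭ₚ.map⁺ +_ p)))) (sym (cnt+cnt-neg-∣∣ k y)))

-- A cover that stays below a given upper bound

-i<i⇒0<i : ∀ {i} → - i <ᶻ i → + 0 <ᶻ i
-i<i⇒0<i {+ zero} p = ⊥-elim (ℤₚ.<-irrefl refl p)
-i<i⇒0<i {+ suc n} _ = ℤ.+<+ (s≤s z≤n)
-i<i⇒0<i { -[1+ n ]} ()

0<i⇒-i<i : ∀ {i} → + 0 <ᶻ i → - i <ᶻ i
0<i⇒-i<i 0<i = ℤₚ.<-trans (neg-mono-< 0<i) 0<i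

-- The entry p at the last place where x and y differ is lowered towards its value q in y,
-- by exchanging it with the nearest entry of [q , p) to its left in the full window on [±n].
≼⇒Move : ∀ {n x y} → IsB n x → IsB n y → x ≼ y → x ≢ y → ∃ λ x' → Move x x' × x' ≼ y
≼⇒Move {n} bx by h x≢y with lastDifference h x≢y
... | A , p , B , q , C , refl , refl , e , q<p with findLast (avoids? q p) A
... | inj₂ (A₁ , d , A₂ , refl , (q≤d , d<p) , none) with splitLike A₁ B e
... | Y₁ , y , Y₂ , refl , e₁ , e₂
  rewrite Listₚ.++-assoc A₁ (d ∷ A₂) (p ∷ C) | Listₚ.++-assoc Y₁ (y ∷ Y₂) (q ∷ C) =
  _ , exchange A₁ d A₂ p C d<p (All.zipWith (λ (av , ne) → avoids⇒outside q≤d (∣≢∣⇒≢ ne) av) (none , ≢p)) ,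
  ≼-exchange A₁ A₂ C Y₁ y Y₂ e₁ e₂ none h q≤d d<p
  where
  ≢p : All (λ a → ∣ a ∣ ≢ ∣ p ∣) A₂
  ≢p = unique-++ A₂ (unique-tail (d ∷ []) (unique-tail A₁ (proj₂ (proj₂ bx))))
≼⇒Move {n} bx by h x≢y | A , p , B , q , C , refl , refl , e , q<p | inj₁ none with (+ 0 <ℤ? p) ×-dec (q ≤ℤ? - p)
-- Since q ≤ - p, an entry of `A` below `q` is also below `- p`, and every other entry of `A` is
-- above `p`; the rectangle of the flip is empty.
... | yes (0<p , q≤-p) = _ , flip A p C 0<p
    (All.zipWith (λ (av , ne) → avoids⇒outside q≤-p (∣≢∣⇒≢ ne) av) (none , unique-++ A (proj₂ (proj₂ bx)))) ,
  ≼-lower A B C e none h q≤-p (0<i⇒-i<i 0<p)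
... | no ¬flip with findFirst (λ a → avoids? q p (- a)) A
-- Some move must exist: ∣ q ∣ occurs among the absolute values of `x`. In `A` it contradicts `none`
-- or `none'`, at `p` it means q = p or a possible flip, and in `C` it repeats an absolute value of
-- `y`.
... | inj₁ none' = ⊥-elim (absent (∈-map⁻ ∣_∣ (↭ₚ.∈-resp-↭ (IsB-↭ by bx) (q∈ B))))
  where
  q∈ : ∀ B → ∣ q ∣ ∈ map ∣_∣ (B ++ q ∷ C)
  q∈ [] = here refl
  q∈ (_ ∷ B) = there (q∈ B)
  absent : (∃ λ z → z ∈ A ++ p ∷ C × ∣ q ∣ ≡ ∣ z ∣) → ⊥
  absent (z , z∈ , ∣q∣≡∣z∣) with ∈-++⁻ A z∈ | ∣≡∣⇒≡± q z ∣q∣≡∣z∣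
  ... | inj₁ z∈A | inj₁ refl = All.lookup none z∈A (ℤₚ.≤-refl , q<p)
  ... | inj₁ z∈A | inj₂ refl = All.lookup none' z∈A (ℤₚ.≤-refl , q<p)
  ... | inj₂ (here refl) | inj₁ refl = ℤₚ.<-irrefl refl q<p
  ... | inj₂ (here refl) | inj₂ refl = ¬flip (-i<i⇒0<i q<p , ℤₚ.≤-refl)
  ... | inj₂ (there z∈C) | _ with unique-tail B (proj₂ (proj₂ by))
  ... | u ∷ _ = All.lookup (Allₚ.map⁻ u) z∈C ∣q∣≡∣z∣
... | inj₂ (A₁ , d , A₂ , refl , (q≤-d , -d<p) , none') with splitLike A₁ B e
... | Y₁ , y , Y₂ , refl , e₁ , e₂
  rewrite Listₚ.++-assoc A₁ (d ∷ A₂) (p ∷ C) | Listₚ.++-assoc Y₁ (y ∷ Y₂) (q ∷ C) =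
  _ , negswap A₁ d A₂ p C -d<p (signs (ℤₚ.<-cmp d (+ 0)) (ℤₚ.<-cmp p (+ 0)))
      (All.zipWith (λ (av , ne) → avoids⇒outside q≤-d (∣≢∣⇒≢ ne) av) (avA₁ , ≢p₁))
      (All.zipWith (λ (av , ne) → reflect (avoids⇒outside q≤-d (∣≢∣⇒-≢ ne) av)) (none' , ≢p₁))
      (All.zipWith (λ (av , ne) → avoids⇒outside q≤-d (∣≢∣⇒≢ ne) av) (avA₂ , ≢p₂)) ,
  -- At position 1 the part to the right of the mirror position -1 is the whole window, so `Z` and
  -- `Y` start as everything before `p` and `q`.
  ≼-negswap y C q≤-d -d<p (signs (ℤₚ.<-cmp d (+ 0)) (ℤₚ.<-cmp p (+ 0))) avd avA₂ e₂ A₁ Y₁ (A₁ ++ d ∷ A₂) (Y₁ ++ y ∷ Y₂)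
    e₁ avA₁ (Allₚ.map⁺ none') none h symmetric
  where
  avA₁ = Allₚ.++⁻ˡ A₁ none
  avd : Avoids q p d
  avd = All.head (Allₚ.++⁻ʳ A₁ none)
  avA₂ = All.tail (Allₚ.++⁻ʳ A₁ none)
  p≢0 d≢0 : _
  d≢0 = proj₁ (All.head (Allₚ.++⁻ʳ A₁ (proj₁ (proj₂ bx))))
  p≢0 = proj₁ (All.head (Allₚ.++⁻ʳ A₂ (All.tail (Allₚ.++⁻ʳ A₁ (proj₁ (proj₂ bx))))))
  ≢p₂ : All (λ a → ∣ a ∣ ≢ ∣ p ∣) A₂
  ≢p₂ = unique-++ A₂ (unique-tail (d ∷ []) (unique-tail A₁ (proj₂ (proj₂ bx))))
  ≢p₁ : All (λ a → ∣ a ∣ ≢ ∣ p ∣) A₁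
  ≢p₁ = Allₚ.++⁻ˡ A₁ (unique-++ (A₁ ++ d ∷ A₂) (subst (λ t → Unique (map ∣_∣ t)) (sym (Listₚ.++-assoc A₁ (d ∷ A₂) (p ∷ C))) (proj₂ (proj₂ bx))))
  reflect : ∀ {a} → Outside (- d) p (- a) → Outside (- p) d a
  reflect (inj₁ l) = inj₂ (neg-cancel-< l)
  reflect (inj₂ l) = inj₁ (<-⇒ l)
  -- Two negative entries contradict - d < p. For two positive ones, d < p would put `d` in [q, p),
  -- while p ≤ d gives q ≤ - d ≤ - p, and the flip, tested earlier, would have applied.
  signs : Tri (d <ᶻ + 0) (d ≡ + 0) (+ 0 <ᶻ d) → Tri (p <ᶻ + 0) (p ≡ + 0) (+ 0 <ᶻ p) → (d <ᶻ + 0 × + 0 <ᶻ p) ⊎ (+ 0 <ᶻ d × p <ᶻ + 0)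
  signs (tri≈ _ e _) _ = ⊥-elim (d≢0 e)
  signs _ (tri≈ _ e _) = ⊥-elim (p≢0 e)
  signs (tri< a _ _) (tri< b _ _) = ⊥-elim (ℤₚ.<-asym (ℤₚ.<-trans (neg-mono-< a) -d<p) b)
  signs (tri< a _ _) (tri> _ _ b) = inj₁ (a , b)
  signs (tri> _ _ a) (tri< b _ _) = inj₂ (a , b)
  signs (tri> _ _ a) (tri> _ _ b) = ⊥-elim (¬flip (b , ℤₚ.≤-trans q≤-d (neg-mono-≤ (ℤₚ.≮⇒≥
    (λ d<p → avd (ℤₚ.≤-trans q≤-d (ℤₚ.<⇒≤ (0<i⇒-i<i a)) , d<p))))))
  symmetric : ∀ k → cnt k ((A₁ ++ d ∷ A₂) ++ p ∷ C) + cnt k (neg (A₁ ++ d ∷ A₂ ++ p ∷ C))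
                  ≡ cnt k ((Y₁ ++ y ∷ Y₂) ++ q ∷ C) + cnt k (neg (Y₁ ++ y ∷ Y₂ ++ q ∷ C))
  symmetric k rewrite Listₚ.++-assoc A₁ (d ∷ A₂) (p ∷ C) | Listₚ.++-assoc Y₁ (y ∷ Y₂) (q ∷ C) =
    cnt+cnt-neg-↭ k {A₁ ++ d ∷ A₂ ++ p ∷ C} {Y₁ ++ y ∷ Y₂ ++ q ∷ C} (IsB-↭ bx by)

-- Length under covering reflections

-- inv + nsp, using that x + y < 0 means y < - x.
pairs : List ℤ → ℕ
pairs [] = 0
pairs (x ∷ xs) = cnt x xs + cnt (- x) xs + pairs xs

invB+nspB≡pairs : ∀ w → invB w + nspB w ≡ pairs w
invB+nspB≡pairs [] = refl
invB+nspB≡pairs (x ∷ xs) = trans (interchange (cnt x xs) (invB xs) _ (nspB xs))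
  (cong₂ _+_ (+-congʳ (cnt x xs) (nsp≡cnt xs)) (invB+nspB≡pairs xs))
  where
  y<-x : ∀ y → x ℤ.+ y <ᶻ + 0 → y <ᶻ - x
  y<-x y p = subst₂ _<ᶻ_ (trans (sym (ℤₚ.+-assoc (- x) x y)) (trans (cong (ℤ._+ y) (ℤₚ.+-inverseˡ x)) (ℤₚ.+-identityˡ y)))
    (ℤₚ.+-identityʳ (- x)) (ℤₚ.+-monoʳ-< (- x) p)
  x+y<0 : ∀ y → y <ᶻ - x → x ℤ.+ y <ᶻ + 0
  x+y<0 y p = subst (x ℤ.+ y <ᶻ_) (ℤₚ.+-inverseʳ x) (ℤₚ.+-monoʳ-< x p)
  nsp≡cnt : ∀ ys → countB (λ y → ⌊ x ℤ.+ y <ℤ? + 0 ⌋) ys ≡ cnt (- x) ys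
  nsp≡cnt [] = refl
  nsp≡cnt (y ∷ ys) = cong₂ _+_ (lt-cong {x ℤ.+ y} {+ 0} {y} { - x} (y<-x y) (x+y<0 y)) (nsp≡cnt ys)

ℓB≡ : ∀ w → ℓB w ≡ pairs w + negB w
ℓB≡ w = trans (rot (invB w) (negB w) (nspB w)) (+-congˡ (negB w) (invB+nspB≡pairs w))
  where rot : ∀ a b c → a + b + c ≡ a + c + b
        rot = solve-∀

cnt± : ℤ → List ℤ → ℕ
cnt± a X = cnt a X + cnt (- a) X

pairs-++ : ∀ k A {X X'} → All (λ a → cnt± a X' ≡ cnt± a X) A → pairs X' ≡ k + pairs X → pairs (A ++ X') ≡ k + pairs (A ++ X)
pairs-++ k [] _ e = e
pairs-++ k (a ∷ A) {X} {X'} (h ∷ hs) e = trans (cong₂ _+_ head (pairs-++ k A hs e)) (x∙yz≈y∙xz (cnt± a (A ++ X)) k _)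
  where
  expand : ∀ X → cnt± a (A ++ X) ≡ cnt± a A + cnt± a X
  expand X = trans (cong₂ _+_ (cnt-++ a A X) (cnt-++ (- a) A X)) (interchange (cnt a A) (cnt a X) (cnt (- a) A) (cnt (- a) X))
  head : cnt± a (A ++ X') ≡ cnt± a (A ++ X)
  head = trans (expand X') (trans (+-congʳ (cnt± a A) h) (sym (expand X)))

-- The contribution to `pairs` of an entry `b` standing between `d` and `p`, from its pairs with
-- these two.
cross : ℤ → ℤ → ℤ → ℕ
cross d p b = (lt b d + lt b (- d)) + (lt p b + lt p (- b))

-- Peeling an entry off `B` costs its `cross` value and a term free of `d` and `p`. Equal crosses
-- thus reduce the claim to adjacent entries.
pairs-two : ∀ d p d' p' B C → All (λ b → cross d' p' b ≡ cross d p b) B →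
  pairs (d' ∷ p' ∷ C) ≡ suc (pairs (d ∷ p ∷ C)) →
  pairs (d' ∷ B ++ p' ∷ C) ≡ suc (pairs (d ∷ B ++ p ∷ C))
pairs-two d p d' p' [] C _ e = e
pairs-two d p d' p' (b ∷ B) C (h ∷ hs) e = begin
  pairs (d' ∷ b ∷ B ++ p' ∷ C) ≡⟨ expand d' p' ⟩
  (cross d' p' b + cnt± b (B ++ C)) + pairs (d' ∷ B ++ p' ∷ C)
    ≡⟨ cong₂ _+_ (+-congˡ (cnt± b (B ++ C)) h) (pairs-two d p d' p' B C hs e) ⟩
  (cross d p b + cnt± b (B ++ C)) + suc (pairs (d ∷ B ++ p ∷ C)) ≡⟨ +-suc (cross d p b + cnt± b (B ++ C)) _ ⟩
  suc ((cross d p b + cnt± b (B ++ C)) + pairs (d ∷ B ++ p ∷ C)) ≡⟨ cong suc (expand d p) ⟨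
  suc (pairs (d ∷ b ∷ B ++ p ∷ C)) ∎
  where
  open ≡-Reasoning
  regroup : ∀ x y X Y z w u v P → (x + X + (y + Y)) + ((z + u) + (w + v) + P) ≡ ((x + y) + (z + w) + (u + v)) + (X + Y + P)
  regroup = solve-∀
  expand : ∀ d p → pairs (d ∷ b ∷ B ++ p ∷ C) ≡ (cross d p b + cnt± b (B ++ C)) + pairs (d ∷ B ++ p ∷ C)
  expand d p = trans (+-congʳ (cnt± d (b ∷ B ++ p ∷ C)) (+-congˡ (pairs (B ++ p ∷ C)) (cong₂ _+_ (cnt-∷-mid b B p C) (cnt-∷-mid (- b) B p C))))
    (regroup (lt b d) (lt b (- d)) (cnt d (B ++ p ∷ C)) (cnt (- d) (B ++ p ∷ C)) (lt p b) (lt p (- b)) (cnt b (B ++ C)) (cnt (- b) (B ++ C)) (pairs (B ++ p ∷ C)))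

pairs-∷∷ : ∀ a b C → pairs (a ∷ b ∷ C) ≡ lt b a + (lt b (- a) + ((cnt± a C + cnt± b C) + pairs C))
pairs-∷∷ a b C = regroup (lt b a) (lt b (- a)) (cnt a C) (cnt (- a) C) (cnt± b C) (pairs C)
  where regroup : ∀ x y X Y Z P → (x + X + (y + Y)) + (Z + P) ≡ x + (y + (X + Y + Z + P))
        regroup = solve-∀

outside-ltˡ : ∀ {lo hi a} → lo <ᶻ hi → Outside lo hi a → lt a lo ≡ lt a hi
outside-ltˡ lo<hi (inj₁ a<lo) = trans (lt-yes a<lo) (sym (lt-yes (ℤₚ.<-trans a<lo lo<hi)))
outside-ltˡ lo<hi (inj₂ hi<a) = trans (lt-no (ℤₚ.<⇒≤ (ℤₚ.<-trans lo<hi hi<a))) (sym (lt-no (ℤₚ.<⇒≤ hi<a)))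

outside-ltʳ : ∀ {lo hi a} → lo <ᶻ hi → Outside lo hi a → lt lo a ≡ lt hi a
outside-ltʳ lo<hi (inj₁ a<lo) = trans (lt-no (ℤₚ.<⇒≤ a<lo)) (sym (lt-no (ℤₚ.<⇒≤ (ℤₚ.<-trans a<lo lo<hi))))
outside-ltʳ lo<hi (inj₂ hi<a) = trans (lt-yes (ℤₚ.<-trans lo<hi hi<a)) (sym (lt-yes hi<a))

cnt±-neg : ∀ a X → cnt± (- a) X ≡ cnt± a X
cnt±-neg a X = trans (+-congʳ (cnt (- a) X) (cong (λ t → cnt t X) (neg-involutive a))) (+-comm (cnt (- a) X) (cnt a X))

-- Only the inversion formed by `p` and `d` is new: entries in between lie on the same side of both
-- values, and the conditions on sums are symmetric.
pairs-exchange : ∀ A d B p C → d <ᶻ p → All (Outside d p) B →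
  pairs (A ++ p ∷ B ++ d ∷ C) ≡ suc (pairs (A ++ d ∷ B ++ p ∷ C))
pairs-exchange A d B p C d<p out = pairs-++ 1 A
  (All.universal (λ a → cong₂ _+_ (cnt-exchange d B p C a) (cnt-exchange d B p C (- a))) A)
  (pairs-two d p p d B C (All.map middle out) base)
  where
  perm₄ : ∀ a b c d → (a + b) + (c + d) ≡ (a + d) + (c + b)
  perm₄ = solve-∀
  middle : ∀ {b} → Outside d p b → cross p d b ≡ cross d p b
  middle {b} o = trans (cong₂ _+_ (cong₂ _+_ (sym (outside-ltˡ d<p o)) (lt-neg b p)) (cong₂ _+_ (outside-ltʳ d<p o) (lt-neg d b)))
    (perm₄ (lt b d) (lt p (- b)) (lt p b) (lt b (- d)))
  base : pairs (p ∷ d ∷ C) ≡ suc (pairs (d ∷ p ∷ C))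
  base = trans (pairs-∷∷ p d C) (trans (cong₂ _+_ (lt-yes d<p) (cong₂ _+_ (lt-neg d p) (+-congˡ (pairs C) (+-comm (cnt± p C) (cnt± d C)))))
    (cong suc (sym (trans (pairs-∷∷ d p C) (+-congˡ _ (lt-no (ℤₚ.<⇒≤ d<p)))))))

-- The new pair is a sum: d + p > 0 becomes negative. Entries of `A` compare with both changes, from
-- `d` to `- p` and from `p` to `- d`, hence two conditions on them. For entries of `B` the four
-- comparisons are permuted once `p` and `- d` look alike, so one condition suffices.
pairs-negswap : ∀ A d B p C → - d <ᶻ p → All (Outside (- d) p) A → All (Outside (- p) d) A → All (Outside (- d) p) B →
  pairs (A ++ - p ∷ B ++ - d ∷ C) ≡ suc (pairs (A ++ d ∷ B ++ p ∷ C))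
pairs-negswap A d B p C -d<p outA outA' outB = pairs-++ 1 A (All.zipWith (λ (o , o') → before o o') (outA , outA'))
  (pairs-two d p (- p) (- d) B C (All.map middle outB) base)
  where
  -p<d = -<⇒ {d} -d<p
  lt--p : ∀ b → lt b (- - p) ≡ lt b p
  lt--p b = cong (lt b) (neg-involutive p)
  two : ∀ a e f → cnt a (e ∷ B ++ f ∷ C) ≡ lt e a + (lt f a + cnt a (B ++ C))
  two a e f = +-congʳ (lt e a) (cnt-∷-mid a B f C)
  before : ∀ {a} → Outside (- d) p a → Outside (- p) d a → cnt± a (- p ∷ B ++ - d ∷ C) ≡ cnt± a (d ∷ B ++ p ∷ C)
  before {a} o o' = trans (cong₂ _+_ (two a (- p) (- d)) (two (- a) (- p) (- d)))
    (trans (cong₂ _+_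
      (cong₂ _+_ (outside-ltʳ -p<d o') (+-congˡ (cnt a (B ++ C)) (outside-ltʳ -d<p o)))
      (cong₂ _+_ (trans (lt-neg-neg p a) (trans (sym (outside-ltˡ -d<p o)) (lt-neg a d)))
        (+-congˡ (cnt (- a) (B ++ C)) (trans (lt-neg-neg d a) (trans (sym (outside-ltˡ -p<d o')) (lt-neg a p))))))
      (sym (cong₂ _+_ (two a d p) (two (- a) d p))))
  perm₄ : ∀ a b c d → (a + b) + (c + d) ≡ (d + b) + (c + a)
  perm₄ = solve-∀
  middle : ∀ {b} → Outside (- d) p b → cross (- p) (- d) b ≡ cross d p b
  middle {b} o = trans (cong₂ _+_ (cong₂ _+_ (lt-neg b p) (trans (lt--p b) (sym (outside-ltˡ -d<p o)))) (cong₂ _+_ (outside-ltʳ -d<p o) (lt-neg-neg d b)))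
    (perm₄ (lt p (- b)) (lt b (- d)) (lt p b) (lt b d))
  base : pairs (- p ∷ - d ∷ C) ≡ suc (pairs (d ∷ p ∷ C))
  base = trans (pairs-∷∷ (- p) (- d) C)
    (trans (cong₂ _+_ (lt-neg-neg d p) (cong₂ _+_ (trans (lt--p (- d)) (lt-yes -d<p))
      (+-congˡ (pairs C) (trans (cong₂ _+_ (cnt±-neg p C) (cnt±-neg d C)) (+-comm (cnt± p C) (cnt± d C))))))
    (trans (+-suc (lt p d) _)
    (cong suc (sym (trans (pairs-∷∷ d p C) (+-congʳ (lt p d) (+-congˡ _ (lt-no (ℤₚ.<⇒≤ -d<p)))))))))

-- Entries to the right are compared with both `p` and `- p` in any case, and those to the left do
-- not separate the two values.
pairs-flip : ∀ A p C → + 0 <ᶻ p → All (Outside (- p) p) A → pairs (A ++ - p ∷ C) ≡ pairs (A ++ p ∷ C)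
pairs-flip A p C 0<p out = pairs-++ 0 A (All.map before out) (+-congˡ (pairs C) (cnt±-neg p C))
  where
  -p<p = 0<i⇒-i<i 0<p
  before : ∀ {a} → Outside (- p) p a → cnt± a (- p ∷ C) ≡ cnt± a (p ∷ C)
  before {a} o = cong₂ _+_ (+-congˡ (cnt a C) (outside-ltʳ -p<p o))
    (+-congˡ (cnt (- a) C) (trans (lt-neg-neg p a) (trans (sym (outside-ltˡ -p<p o)) (lt-neg a p))))

negB-flip : ∀ A p C → + 0 <ᶻ p → negB (A ++ - p ∷ C) ≡ suc (negB (A ++ p ∷ C))
negB-flip A p C 0<p = trans (cnt-∷-mid (+ 0) A (- p) C) (trans (+-congˡ _ (lt-yes (neg-mono-< 0<p)))
  (cong suc (sym (trans (cnt-∷-mid (+ 0) A p C) (+-congˡ _ (lt-no (ℤₚ.<⇒≤ 0<p)))))))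

negB-exchange : ∀ A d B p C → negB (A ++ p ∷ B ++ d ∷ C) ≡ negB (A ++ d ∷ B ++ p ∷ C)
negB-exchange A d B p C = cnt-++-congʳ (+ 0) A (cnt-exchange d B p C (+ 0))

-- Because the signs are opposite, `- p` inherits the sign of `d` and `- d` that of `p`.
negB-negswap : ∀ A d B p C → (d <ᶻ + 0 × + 0 <ᶻ p) ⊎ (+ 0 <ᶻ d × p <ᶻ + 0) →
  negB (A ++ - p ∷ B ++ - d ∷ C) ≡ negB (A ++ d ∷ B ++ p ∷ C)
negB-negswap A d B p C s = cnt-++-congʳ (+ 0) A (trans (+-congʳ (lt (- p) (+ 0)) (cnt-∷-mid (+ 0) B (- d) C))
  (trans (cong₂ _+_ (first s) (+-congˡ (cnt (+ 0) (B ++ C)) (second s))) (+-congʳ (lt d (+ 0)) (sym (cnt-∷-mid (+ 0) B p C)))))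
  where
  first : (d <ᶻ + 0 × + 0 <ᶻ p) ⊎ (+ 0 <ᶻ d × p <ᶻ + 0) → lt (- p) (+ 0) ≡ lt d (+ 0)
  first (inj₁ (d<0 , 0<p)) = trans (lt-yes (neg-mono-< 0<p)) (sym (lt-yes d<0))
  first (inj₂ (0<d , p<0)) = trans (lt-no (ℤₚ.<⇒≤ (neg-mono-< p<0))) (sym (lt-no (ℤₚ.<⇒≤ 0<d)))
  second : (d <ᶻ + 0 × + 0 <ᶻ p) ⊎ (+ 0 <ᶻ d × p <ᶻ + 0) → lt (- d) (+ 0) ≡ lt p (+ 0)
  second (inj₁ (d<0 , 0<p)) = trans (lt-no (ℤₚ.<⇒≤ (neg-mono-< d<0))) (sym (lt-no (ℤₚ.<⇒≤ 0<p)))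
  second (inj₂ (0<d , p<0)) = trans (lt-yes (neg-mono-< 0<d)) (sym (lt-yes p<0))

ℓB-Move : ∀ {x x'} → Move x x' → ℓB x' ≡ suc (ℓB x)
ℓB-Move (exchange A d B p C d<p out) = trans (ℓB≡ (A ++ p ∷ B ++ d ∷ C)) (trans
  (cong₂ _+_ (pairs-exchange A d B p C d<p out) (negB-exchange A d B p C)) (cong suc (sym (ℓB≡ (A ++ d ∷ B ++ p ∷ C)))))
ℓB-Move (flip A p C 0<p out) = trans (ℓB≡ (A ++ - p ∷ C)) (trans
  (cong₂ _+_ (pairs-flip A p C 0<p out) (negB-flip A p C 0<p)) (trans (+-suc _ _) (cong suc (sym (ℓB≡ (A ++ p ∷ C))))))
ℓB-Move (negswap A d B p C -d<p s o o' o'') = trans (ℓB≡ (A ++ - p ∷ B ++ - d ∷ C)) (trans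
  (cong₂ _+_ (pairs-negswap A d B p C -d<p o o' o'') (negB-negswap A d B p C s)) (cong suc (sym (ℓB≡ (A ++ d ∷ B ++ p ∷ C)))))

pairs≤ : ∀ w → pairs w ≤ 2 * (length w * length w)
pairs≤ [] = z≤n
pairs≤ (x ∷ xs) = ≤-trans (+-mono-≤ (+-mono-≤ (cnt≤length x xs) (cnt≤length (- x) xs)) (pairs≤ xs))
  (≤-trans (m≤m+n _ (2 * (length xs + 1))) (≤-reflexive (square (length xs))))
  where square : ∀ n → (n + n + 2 * (n * n)) + 2 * (n + 1) ≡ 2 * ((1 + n) * (1 + n))
        square = solve-∀

ℓB≤ : ∀ w → ℓB w ≤ 2 * (length w * length w) + length w
ℓB≤ w = ≤-trans (≤-reflexive (ℓB≡ w)) (+-mono-≤ (pairs≤ w) (cnt≤length (+ 0) w))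

-- Covering reflections as conjugates of generators

applyUpTo-atℕ : ∀ u → applyUpTo (atℕ u) (length u) ≡ u
applyUpTo-atℕ [] = refl
applyUpTo-atℕ (x ∷ u) = cong (x ∷_) (applyUpTo-atℕ u)

positions : ℕ → List ℤ
positions = applyUpTo (λ k → + suc k)

map-ev-positions : ∀ u → map (ev u) (positions (length u)) ≡ u
map-ev-positions u = trans (Listₚ.map-applyUpTo (λ k → + suc k) (ev u) (length u)) (applyUpTo-atℕ u)

IsB-positions : ∀ n → IsB n (positions n)
IsB-positions n = Listₚ.length-applyUpTo _ n , Allₚ.applyUpTo⁺₁ _ n (λ k<n → (λ ()) , k<n) ,
  subst Unique (sym (Listₚ.map-applyUpTo (λ k → + suc k) ∣_∣ n))
    (Uniqueₚ.applyUpTo⁺₁ suc n (λ i<j _ e → ℕₚ.<⇒≢ i<j (ℕₚ.suc-injective e)))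

compose-gen₀ : ∀ a rest → compose (a ∷ rest) (gen (suc (length rest)) 0) ≡ - a ∷ rest
compose-gen₀ a rest = cong (- a ∷_) (trans
  (cong (map (ev (a ∷ rest))) (Listₚ.map-applyUpTo suc _ (length rest)))
  (trans (Listₚ.map-applyUpTo _ (ev (a ∷ rest)) (length rest)) (applyUpTo-atℕ rest)))

compose-gen₁ : ∀ a b rest → compose (a ∷ b ∷ rest) (gen (2 + length rest) 1) ≡ b ∷ a ∷ rest
compose-gen₁ a b rest = cong (λ t → b ∷ a ∷ t) (trans
  (cong (map (ev (a ∷ b ∷ rest))) (Listₚ.map-applyUpTo (λ k → suc (suc k)) _ (length rest)))
  (trans (Listₚ.map-applyUpTo _ (ev (a ∷ b ∷ rest)) (length rest)) (applyUpTo-atℕ rest)))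

++-split : {X : Set} (A A' : List X) {B B' : List X} → length A ≡ length A' → A ++ B ≡ A' ++ B' → A ≡ A' × B ≡ B'
++-split [] [] _ e = refl , e
++-split (a ∷ A) (a' ∷ A') l e with ++-split A A' (ℕₚ.suc-injective l) (Listₚ.∷-injectiveʳ e)
... | refl , refl = cong (_∷ A) (Listₚ.∷-injectiveˡ e) , refl

map-ev-split : ∀ (u : Window) A d B PA {i PB} → u ≡ A ++ d ∷ B → map (ev u) (PA ++ i ∷ PB) ≡ u → length A ≡ length PA →
  map (ev u) PA ≡ A × ev u i ≡ d × map (ev u) PB ≡ B
map-ev-split u A d B PA {i} {PB} refl e l
  with ++-split (map (ev u) PA) A (trans (Listₚ.length-map (ev u) PA) (sym l)) (trans (sym (Listₚ.map-++ (ev u) PA (i ∷ PB))) e)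
... | e₁ , e₂ = e₁ , Listₚ.∷-injectiveˡ e₂ , Listₚ.∷-injectiveʳ e₂

-- The two positions in the window to be reflected come first, so that gen n 1 can serve as the simple reflection.
record TwoPositions (A B C : List ℤ) : Set where
  field
    i j : ℤ
    rest : List ℤ
    ↭pos : map ∣_∣ (i ∷ j ∷ rest) ↭ map ∣_∣ (positions (2 + length rest))
    len : ∀ d p → length (A ++ d ∷ B ++ p ∷ C) ≡ 2 + length rest
    at : ∀ d p → let u = A ++ d ∷ B ++ p ∷ C in ev u i ≡ d × ev u j ≡ p × map (ev u) rest ≡ A ++ B ++ C

twoPositions : ∀ A B C → TwoPositions A B C
twoPositions A B C with splitLike A {+ 0} {B ++ + 0 ∷ C} (positions n) (sym (Listₚ.length-applyUpTo _ n))
  where n = length (A ++ + 0 ∷ B ++ + 0 ∷ C)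
... | PA , i , P' , e , lA , l' with splitLike B P' l'
... | PB , j , PC , refl , lB , lC = record { i = i ; j = j ; rest = PA ++ PB ++ PC
  ; ↭pos = subst (λ k → map ∣_∣ (i ∷ j ∷ PA ++ PB ++ PC) ↭ map ∣_∣ (positions k)) (len (+ 0) (+ 0))
      (↭ₚ.map⁺ ∣_∣ (↭-trans (↭-sym (↭-trans (↭ₚ.shift i PA (PB ++ j ∷ PC))
        (prep i (↭-trans (↭-reflexive (sym (Listₚ.++-assoc PA PB (j ∷ PC)))) (↭-trans (↭ₚ.shift j (PA ++ PB) PC)
          (prep j (↭-reflexive (Listₚ.++-assoc PA PB PC)))))))) (↭-reflexive (sym e))))
  ; len = len ; at = at }
  where
  plus : ∀ a b c → a + (1 + (b + (1 + c))) ≡ 2 + (a + (b + c))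
  plus = solve-∀
  len : ∀ d p → length (A ++ d ∷ B ++ p ∷ C) ≡ 2 + length (PA ++ PB ++ PC)
  len d p = trans (Listₚ.length-++ A) (trans (+-congʳ (length A) (cong suc (Listₚ.length-++ B)))
    (trans (plus (length A) (length B) (length C)) (cong (λ t → 2 + t)
      (trans (cong₂ _+_ lA (cong₂ _+_ lB lC)) (sym (trans (Listₚ.length-++ PA) (+-congʳ (length PA) (Listₚ.length-++ PB))))))))
  at : ∀ d p → let u = A ++ d ∷ B ++ p ∷ C in ev u i ≡ d × ev u j ≡ p × map (ev u) (PA ++ PB ++ PC) ≡ A ++ B ++ C
  at d p with map-ev-split u A d (B ++ p ∷ C) PA refl all lA
    where
    u = A ++ d ∷ B ++ p ∷ C
    all : map (ev u) (PA ++ i ∷ PB ++ j ∷ PC) ≡ u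
    all = trans (cong (map (ev u)) (trans (sym e) (cong positions (trans (len (+ 0) (+ 0)) (sym (len d p)))))) (map-ev-positions u)
  ... | eA , ei , eB' with ++-split (map (ev u) PB) B (trans (Listₚ.length-map (ev u) PB) (sym lB)) (trans (sym (Listₚ.map-++ (ev u) PB (j ∷ PC))) eB')
    where u = A ++ d ∷ B ++ p ∷ C
  ... | eB , eC = ei , Listₚ.∷-injectiveˡ eC , trans (Listₚ.map-++ (ev u) PA (PB ++ PC))
    (cong₂ _++_ eA (trans (Listₚ.map-++ (ev u) PB PC) (cong₂ _++_ eB (Listₚ.∷-injectiveʳ eC))))
    where u = A ++ d ∷ B ++ p ∷ C

ev-neg : ∀ w z → ev w (- z) ≡ - ev w z
ev-neg w (+ zero) = refl
ev-neg w (+ suc k) = refl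
ev-neg w -[1+ k ] = sym (neg-involutive (atℕ w k))

IsReflection : ℕ → Window → Window → Set
IsReflection n u w = Σ Window (λ x → Σ Window (λ s → IsB n x × IsGen n s × compose w x ≡ compose u (compose x s)))

-- The conjugator lists the positions `i` and `j` first, so conjugating the transposition of 1 and 2
-- by it exchanges `i` and `j`.
reflect-exchange : ∀ {n} A d B p C → length (A ++ d ∷ B ++ p ∷ C) ≡ n →
  IsReflection n (A ++ d ∷ B ++ p ∷ C) (A ++ p ∷ B ++ d ∷ C)
reflect-exchange A d B p C refl = subst (λ n → IsReflection n u w) (sym (len d p))
  (i ∷ j ∷ rest , gen (2 + length rest) 1 ,
   IsB-resp-↭ (↭-sym ↭pos) (IsB-positions (2 + length rest)) , (1 , s≤s (s≤s z≤n) , refl) ,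
   trans (cong₂ _∷_ (trans (proj₁ (at p d)) (sym (proj₁ (proj₂ (at d p)))))
         (cong₂ _∷_ (trans (proj₁ (proj₂ (at p d))) (sym (proj₁ (at d p))))
           (trans (proj₂ (proj₂ (at p d))) (sym (proj₂ (proj₂ (at d p)))))))
     (cong (compose u) (sym (compose-gen₁ i j rest))))
  where
  open TwoPositions (twoPositions A B C)
  u = A ++ d ∷ B ++ p ∷ C
  w = A ++ p ∷ B ++ d ∷ C

-- With `- j` in second place the conjugate exchanges the positions `i` and `- j`, which brings in
-- the two signs.
reflect-negswap : ∀ {n} A d B p C → length (A ++ d ∷ B ++ p ∷ C) ≡ n →
  IsReflection n (A ++ d ∷ B ++ p ∷ C) (A ++ - p ∷ B ++ - d ∷ C)
reflect-negswap A d B p C refl = subst (λ n → IsReflection n u w) (sym (len d p))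
  (i ∷ - j ∷ rest , gen (2 + length rest) 1 ,
   IsB-resp-↭ (↭-sym (↭-trans (↭-reflexive (cong (λ t → ∣ i ∣ ∷ t ∷ map ∣_∣ rest) (ℤₚ.∣-i∣≡∣i∣ j))) ↭pos)) (IsB-positions (2 + length rest)) ,
   (1 , s≤s (s≤s z≤n) , refl) ,
   trans (cong₂ _∷_ (trans (proj₁ (at (- p) (- d))) (sym (trans (ev-neg u j) (cong -_ (proj₁ (proj₂ (at d p)))))))
         (cong₂ _∷_ (trans (ev-neg w j) (trans (cong -_ (proj₁ (proj₂ (at (- p) (- d))))) (trans (neg-involutive d) (sym (proj₁ (at d p))))))
           (trans (proj₂ (proj₂ (at (- p) (- d)))) (sym (proj₂ (proj₂ (at d p)))))))
     (cong (compose u) (sym (compose-gen₁ i (- j) rest))))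
  where
  open TwoPositions (twoPositions A B C)
  u = A ++ d ∷ B ++ p ∷ C
  w = A ++ - p ∷ B ++ - d ∷ C

reflect-flip : ∀ {n} A p C → length (A ++ p ∷ C) ≡ n → IsReflection n (A ++ p ∷ C) (A ++ - p ∷ C)
reflect-flip A p C refl with splitLike A {p} {C} (positions (length (A ++ p ∷ C))) (sym (Listₚ.length-applyUpTo _ _))
... | PA , i , PC , e , lA , lC = subst (λ n → IsReflection n u w) (sym (len p))
  (i ∷ PA ++ PC , gen (suc (length (PA ++ PC))) 0 ,
   IsB-resp-↭ (↭-trans (↭-reflexive (cong (map ∣_∣) (trans (cong positions (sym (len p))) e))) (↭ₚ.map⁺ ∣_∣ (↭ₚ.shift i PA PC)))
     (IsB-positions (suc (length (PA ++ PC)))) ,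
   (0 , s≤s z≤n , refl) ,
   trans (cong₂ _∷_ (trans (proj₁ (at (- p))) (sym (trans (ev-neg u i) (cong -_ (proj₁ (at p))))))
       (trans (proj₂ (at (- p))) (sym (proj₂ (at p)))))
     (cong (compose u) (sym (compose-gen₀ i (PA ++ PC)))))
  where
  u = A ++ p ∷ C
  w = A ++ - p ∷ C
  len : ∀ r → length (A ++ r ∷ C) ≡ suc (length (PA ++ PC))
  len r = trans (Listₚ.length-++ A) (trans (+-suc (length A) (length C)) (cong suc (trans (cong₂ _+_ lA lC) (sym (Listₚ.length-++ PA)))))
  at : ∀ r → ev (A ++ r ∷ C) i ≡ r × map (ev (A ++ r ∷ C)) (PA ++ PC) ≡ A ++ C
  at r with map-ev-split (A ++ r ∷ C) A r C PA refl (trans (cong (map (ev (A ++ r ∷ C)))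
      (trans (sym e) (cong positions (trans (len p) (sym (len r)))))) (map-ev-positions (A ++ r ∷ C))) lA
  ... | eA , ei , eC = ei , trans (Listₚ.map-++ (ev (A ++ r ∷ C)) PA PC) (cong₂ _++_ eA eC)

exchange-↭ : ∀ (A : List ℤ) d B p C → A ++ d ∷ B ++ p ∷ C ↭ A ++ p ∷ B ++ d ∷ C
exchange-↭ A d B p C = ↭ₚ.++⁺ˡ A (↭-trans (prep d (↭ₚ.shift p B C))
  (↭-trans (swap d p ↭-refl) (prep p (↭-sym (↭ₚ.shift d B C)))))

map-∣∣-mid : ∀ A {e f X Y} → ∣ e ∣ ≡ ∣ f ∣ → map ∣_∣ X ≡ map ∣_∣ Y → map ∣_∣ (A ++ e ∷ X) ≡ map ∣_∣ (A ++ f ∷ Y)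
map-∣∣-mid [] p q = cong₂ _∷_ p q
map-∣∣-mid (a ∷ A) p q = cong (∣ a ∣ ∷_) (map-∣∣-mid A p q)

IsB-Move : ∀ {n x x'} → Move x x' → IsB n x → IsB n x'
IsB-Move (exchange A d B p C _ _) = IsB-resp-↭ (↭ₚ.map⁺ ∣_∣ (exchange-↭ A d B p C))
IsB-Move (flip A p C _ _) = IsB-resp-↭ (↭-reflexive (map-∣∣-mid A (sym (ℤₚ.∣-i∣≡∣i∣ p)) refl))
IsB-Move (negswap A d B p C _ _ _ _ _) = IsB-resp-↭ (↭-trans (↭ₚ.map⁺ ∣_∣ (exchange-↭ A d B p C))
  (↭-reflexive (map-∣∣-mid A (sym (ℤₚ.∣-i∣≡∣i∣ p)) (map-∣∣-mid B (sym (ℤₚ.∣-i∣≡∣i∣ d)) refl))))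

Move⇒IsReflection : ∀ {n x x'} → Move x x' → length x ≡ n → IsReflection n x x'
Move⇒IsReflection (exchange A d B p C _ _) = reflect-exchange A d B p C
Move⇒IsReflection (flip A p C _ _) = reflect-flip A p C
Move⇒IsReflection (negswap A d B p C _ _ _ _ _) = reflect-negswap A d B p C

-- The criterion implies Bruhat order

Move⇒BruhatStep : ∀ {n x x'} → IsB n x → Move x x' → BruhatStep n x x'
Move⇒BruhatStep bx m = bx , IsB-Move m bx , Move⇒IsReflection m (proj₁ bx) , ≤-reflexive (sym (ℓB-Move m))

-- Every move raises the length by one, and the crude bound `ℓB≤` depends on `n` alone; the fuel
-- covers the distance to that bound.
≼⇒Bruhat′ : ∀ {n} fuel {x y} → 2 * (n * n) + n < fuel + ℓB x → IsB n x → IsB n y → x ≼ y → Bruhat n x y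
≼⇒Bruhat′ {n} fuel {x} {y} f bx by h with Listₚ.≡-dec _≟ℤ_ x y
... | yes refl = ε
≼⇒Bruhat′ {n} zero {x} {y} f bx by h | no _ = ⊥-elim (ℕₚ.<⇒≱ f (subst (λ k → ℓB x ≤ 2 * (k * k) + k) (proj₁ bx) (ℓB≤ x)))
≼⇒Bruhat′ {n} (suc fuel) {x} {y} f bx by h | no x≢y with ≼⇒Move bx by h x≢y
... | x' , m , x'≼y = Move⇒BruhatStep bx m ◅ ≼⇒Bruhat′ fuel
  (subst (2 * (n * n) + n <_) (trans (sym (+-suc fuel (ℓB x))) (+-congʳ fuel (sym (ℓB-Move m)))) f) (IsB-Move m bx) by x'≼y

≼⇒Bruhat : ∀ {n x y} → IsB n x → IsB n y → x ≼ y → Bruhat n x y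
≼⇒Bruhat {n} {x} = ≼⇒Bruhat′ (suc (2 * (n * n) + n)) (m≤m+n _ (ℓB x))

-- Bruhat order implies the criterion

Bruhat⇒ℓB≤ : ∀ {n x y} → Bruhat n x y → ℓB x ≤ ℓB y
Bruhat⇒ℓB≤ ε = ≤-refl
Bruhat⇒ℓB≤ ((_ , _ , _ , l) ◅ s) = ≤-trans (ℕₚ.<⇒≤ l) (Bruhat⇒ℓB≤ s)

≼-pointwise : ∀ u w → length u ≡ length w → (∀ l → l < length u → atℕ w l ≤ᶻ atℕ u l) → u ≼ w
≼-pointwise [] [] _ _ = []
≼-pointwise (x ∷ u) (y ∷ w) e h = (λ j → +-mono-≤ (lt-monoˡ j (h 0 (s≤s z≤n))) (≼⇒cnt≤ tail j)) ∷ tail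
  where tail = ≼-pointwise u w (ℕₚ.suc-injective e) (λ l l< → h (suc l) (s≤s l<))

≼-lower₁ : ∀ B {p d} C → d ≤ᶻ p → B ++ p ∷ C ≼ B ++ d ∷ C
≼-lower₁ [] C d≤p = (λ j → +-monoˡ-≤ (cnt j C) (lt-monoˡ j d≤p)) ∷ ≼-refl
≼-lower₁ (b ∷ B) C d≤p = (λ j → cnt-++-monoʳ j (b ∷ B) (+-monoˡ-≤ (cnt j C) (lt-monoˡ j d≤p))) ∷ ≼-lower₁ B C d≤p

≼-exchange₁ : ∀ A d B p C → d ≤ᶻ p → A ++ d ∷ B ++ p ∷ C ≼ A ++ p ∷ B ++ d ∷ C
≼-exchange₁ [] d B p C d≤p = (λ j → ≤-reflexive (sym (cnt-exchange d B p C j))) ∷ ≼-lower₁ B C d≤p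
≼-exchange₁ (a ∷ A) d B p C d≤p = (λ j → ≤-reflexive (cnt-++-congʳ j (a ∷ A) (sym (cnt-exchange d B p C j)))) ∷ ≼-exchange₁ A d B p C d≤p

atℕ-ext : ∀ u w → length u ≡ length w → (∀ l → l < length u → atℕ w l ≡ atℕ u l) → u ≡ w
atℕ-ext [] [] _ _ = refl
atℕ-ext (x ∷ u) (y ∷ w) e h = cong₂ _∷_ (sym (h 0 (s≤s z≤n))) (atℕ-ext u w (ℕₚ.suc-injective e) (λ l l< → h (suc l) (s≤s l<)))

splitAt₁ : ∀ j u w → j < length u → length u ≡ length w → (∀ l → l < length u → l ≢ j → atℕ w l ≡ atℕ u l) →
  ∃ λ B → ∃ λ C → u ≡ B ++ atℕ u j ∷ C × w ≡ B ++ atℕ w j ∷ C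
splitAt₁ zero (x ∷ u) (y ∷ w) _ e h with atℕ-ext u w (ℕₚ.suc-injective e) (λ l l< → h (suc l) (s≤s l<) (λ ()))
... | refl = [] , u , refl , refl
splitAt₁ (suc j) (x ∷ u) (y ∷ w) (s≤s j<) e h
  with splitAt₁ j u w j< (ℕₚ.suc-injective e) (λ l l< ne → h (suc l) (s≤s l<) (ne ∘ ℕₚ.suc-injective)) | h 0 (s≤s z≤n) (λ ())
... | B , C , e₁ , e₂ | refl = x ∷ B , C , cong (x ∷_) e₁ , cong (x ∷_) e₂

splitAt₂ : ∀ i j u w → i < j → j < length u → length u ≡ length w → atℕ w i ≡ atℕ u j → atℕ w j ≡ atℕ u i →
  (∀ l → l < length u → l ≢ i → l ≢ j → atℕ w l ≡ atℕ u l) →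
  ∃ λ A → ∃ λ d → ∃ λ B → ∃ λ p → ∃ λ C → u ≡ A ++ d ∷ B ++ p ∷ C × w ≡ A ++ p ∷ B ++ d ∷ C
splitAt₂ zero (suc j) (d ∷ u) (p ∷ w) _ (s≤s j<) e ei ej h
  with splitAt₁ j u w j< (ℕₚ.suc-injective e) (λ l l< ne → h (suc l) (s≤s l<) (λ ()) (ne ∘ ℕₚ.suc-injective))
... | B , C , e₁ , e₂ = [] , d , B , p , C , cong (d ∷_) (trans e₁ (cong (λ t → B ++ t ∷ C) (sym ei))) ,
  cong (p ∷_) (trans e₂ (cong (λ t → B ++ t ∷ C) ej))
splitAt₂ (suc i) (suc j) (x ∷ u) (y ∷ w) (s≤s i<j) (s≤s j<) e ei ej h
  with splitAt₂ i j u w i<j j< (ℕₚ.suc-injective e) ei ej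
         (λ l l< ne ne' → h (suc l) (s≤s l<) (ne ∘ ℕₚ.suc-injective) (ne' ∘ ℕₚ.suc-injective))
     | h 0 (s≤s z≤n) (λ ()) (λ ())
... | A , d , B , p , C , refl , refl | refl = x ∷ A , d , B , p , C , refl , refl

≼-comparable-exchange-< : ∀ i j u w → i < j → j < length u → length u ≡ length w →
  atℕ w i ≡ atℕ u j → atℕ w j ≡ atℕ u i →
  (∀ l → l < length u → l ≢ i → l ≢ j → atℕ w l ≡ atℕ u l) → u ≼ w ⊎ w ≼ u
≼-comparable-exchange-< i j u w i<j j< e ei ej h with splitAt₂ i j u w i<j j< e ei ej h
... | A , d , B , p , C , refl , refl with ℤₚ.≤-total d p
... | inj₁ d≤p = inj₁ (≼-exchange₁ A d B p C d≤p)
... | inj₂ p≤d = inj₂ (≼-exchange₁ A p B d C p≤d)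

≼-comparable-exchange : ∀ i j u w → i ≢ j → i < length u → j < length u → length u ≡ length w →
  atℕ w i ≡ atℕ u j → atℕ w j ≡ atℕ u i →
  (∀ l → l < length u → l ≢ i → l ≢ j → atℕ w l ≡ atℕ u l) → u ≼ w ⊎ w ≼ u
≼-comparable-exchange i j u w i≢j i< j< e ei ej h with ℕₚ.<-cmp i j
... | tri≈ _ i≡j _ = ⊥-elim (i≢j i≡j)
... | tri> _ _ j<i = ≼-comparable-exchange-< j i u w j<i i< e ej ei (λ l l< ne ne' → h l l< ne' ne)
... | tri< i<j _ _ = ≼-comparable-exchange-< i j u w i<j j< e ei ej h

-- Since - b ≤ a is equivalent to - a ≤ b, both changed entries move in the same direction and a
-- pointwise comparison suffices. The case i = j is the change of a single sign.
≼-comparable-negswap : ∀ i j u w → length u ≡ length w →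
  atℕ w i ≡ - atℕ u j → atℕ w j ≡ - atℕ u i →
  (∀ l → l < length u → l ≢ i → l ≢ j → atℕ w l ≡ atℕ u l) → u ≼ w ⊎ w ≼ u
≼-comparable-negswap i j u w e ei ej h with ℤₚ.≤-total (- atℕ u j) (atℕ u i)
... | inj₁ le = inj₁ (≼-pointwise u w e below)
  where
  below : ∀ l → l < length u → atℕ w l ≤ᶻ atℕ u l
  below l l< with l ℕ.≟ i | l ℕ.≟ j
  ... | yes refl | _ = subst (_≤ᶻ atℕ u l) (sym ei) le
  ... | no _ | yes refl = subst (_≤ᶻ atℕ u l) (sym ej) (-≤⇒ {atℕ u l} le)
  ... | no ne | no ne' = ℤₚ.≤-reflexive (h l l< ne ne')
... | inj₂ ge = inj₂ (≼-pointwise w u (sym e) above)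
  where
  above : ∀ l → l < length w → atℕ u l ≤ᶻ atℕ w l
  above l l< with l ℕ.≟ i | l ℕ.≟ j
  ... | yes refl | _ = subst (atℕ u l ≤ᶻ_) (sym ei) ge
  ... | no _ | yes refl = subst (atℕ u l ≤ᶻ_) (sym ej) (≤-⇒ ge)
  ... | no ne | no ne' = ℤₚ.≤-reflexive (sym (h l (subst (l <_) (sym e) l<) ne ne'))

atℕ-map : ∀ (f : ℤ → ℤ) x k → k < length x → atℕ (map f x) k ≡ f (atℕ x k)
atℕ-map f (y ∷ x) zero _ = refl
atℕ-map f (y ∷ x) (suc k) (s≤s k<) = atℕ-map f x k k<

atℕ-applyUpTo : ∀ (f : ℕ → ℤ) n k → k < n → atℕ (applyUpTo f n) k ≡ f k
atℕ-applyUpTo f (suc n) zero _ = refl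
atℕ-applyUpTo f (suc n) (suc k) (s≤s k<) = atℕ-applyUpTo (f ∘ suc) n k k<

atℕ-map-upTo : ∀ (f : ℕ → ℤ) n k → k < n → atℕ (map f (upTo n)) k ≡ f k
atℕ-map-upTo f n k k<n = trans (cong (λ t → atℕ t k) (Listₚ.map-applyUpTo id f n)) (atℕ-applyUpTo f n k k<n)

∈⇒atℕ : ∀ x {v} → v ∈ map ∣_∣ x → ∃ λ k → k < length x × ∣ atℕ x k ∣ ≡ v
∈⇒atℕ (y ∷ x) (here refl) = 0 , s≤s z≤n , refl
∈⇒atℕ (y ∷ x) (there i) with ∈⇒atℕ x i
... | k , k< , e = suc k , s≤s k< , e

atℕ-All : ∀ {P : ℤ → Set} x k → All P x → k < length x → P (atℕ x k)
atℕ-All (y ∷ x) zero (p ∷ _) _ = p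
atℕ-All (y ∷ x) (suc k) (_ ∷ ps) (s≤s k<) = atℕ-All x k ps k<

unique-atℕ : ∀ x i j → Unique (map ∣_∣ x) → i < length x → j < length x → ∣ atℕ x i ∣ ≡ ∣ atℕ x j ∣ → i ≡ j
unique-atℕ (y ∷ x) zero zero _ _ _ _ = refl
unique-atℕ (y ∷ x) zero (suc j) (h ∷ _) _ (s≤s j<) e = ⊥-elim (atℕ-All x j (Allₚ.map⁻ h) j< e)
unique-atℕ (y ∷ x) (suc i) zero (h ∷ _) (s≤s i<) _ e = ⊥-elim (atℕ-All x i (Allₚ.map⁻ h) i< (sym e))
unique-atℕ (y ∷ x) (suc i) (suc j) (_ ∷ u) (s≤s i<) (s≤s j<) e = cong suc (unique-atℕ x i j u i< j< e)

nonzero-index : ∀ n z → z ≢ + 0 × ∣ z ∣ ≤ n → ∃ λ l → l < n × (z ≡ + suc l ⊎ z ≡ -[1+ l ])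
nonzero-index n (+ zero) (z≢0 , _) = ⊥-elim (z≢0 refl)
nonzero-index n (+ suc l) (_ , l<n) = l , l<n , inj₁ refl
nonzero-index n -[1+ l ] (_ , l<n) = l , l<n , inj₂ refl

IsB-surjective : ∀ {n x} → IsB n x → ∀ l → l < n → ∃ λ k → k < length x × ∣ atℕ x k ∣ ≡ suc l
IsB-surjective {n} {x} bx l l<n = ∈⇒atℕ x (↭ₚ.∈-resp-↭ (↭-sym (IsB⇒↭range bx)) (∈-range n (s≤s z≤n) l<n))

ev-agree : ∀ u w z l → ∣ z ∣ ≡ suc l → ev w z ≡ ev u z → atℕ w l ≡ atℕ u l
ev-agree u w (+ suc l) l refl e = e
ev-agree u w -[1+ l ] l refl e = ℤₚ.neg-injective e

≡ᵇ-refl : ∀ b → (b ℕ.≡ᵇ b) ≡ true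
≡ᵇ-refl zero = refl
≡ᵇ-refl (suc b) = ≡ᵇ-refl b

≡ᵇ-≢ : ∀ a b → a ≢ b → (a ℕ.≡ᵇ b) ≡ false
≡ᵇ-≢ zero zero ne = ⊥-elim (ne refl)
≡ᵇ-≢ zero (suc b) ne = refl
≡ᵇ-≢ (suc a) zero ne = refl
≡ᵇ-≢ (suc a) (suc b) ne = ≡ᵇ-≢ a b (ne ∘ cong suc)

-- The windows differ only at the positions named by the entries of `x` that the generator moves.
-- For a transposition, equal signs of these two entries give an exchange and opposite signs an
-- exchange with negation.
IsReflection⇒comparable : ∀ {n u w} → IsB n u → IsB n w → IsReflection n u w → u ≼ w ⊎ w ≼ u
IsReflection⇒comparable {n} {u} {w} bu bw (x , s , bx , (a , a<n , refl) , eq) = go a a<n eq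
  where
  |u|≡|w| : length u ≡ length w
  |u|≡|w| = trans (proj₁ bu) (sym (proj₁ bw))
  <x : ∀ {k} → k < n → k < length x
  <x {k} = subst (k <_) (sym (proj₁ bx))
  <u : ∀ {k} → k < n → k < length u
  <u {k} = subst (k <_) (sym (proj₁ bu))
  at-gen : ∀ (f : ℕ → ℤ) → compose w x ≡ compose u (compose x (map f (upTo n))) → ∀ k → k < n →
    ev w (atℕ x k) ≡ ev u (ev x (f k))
  at-gen f eq k k<n = begin
    ev w (atℕ x k)                               ≡⟨ atℕ-map (ev w) x k (<x k<n) ⟨
    atℕ (compose w x) k                          ≡⟨ cong (λ t → atℕ t k) eq ⟩
    atℕ (compose u (compose x (map f (upTo n)))) k ≡⟨ atℕ-map (ev u) (compose x (map f (upTo n))) k (subst (k <_) (sym len₂) k<n) ⟩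
    ev u (atℕ (compose x (map f (upTo n))) k)    ≡⟨ cong (ev u) (atℕ-map (ev x) (map f (upTo n)) k (subst (k <_) (sym len₁) k<n)) ⟩
    ev u (ev x (atℕ (map f (upTo n)) k))         ≡⟨ cong (λ t → ev u (ev x t)) (atℕ-map-upTo f n k k<n) ⟩
    ev u (ev x (f k))                            ∎
    where
    open ≡-Reasoning
    len₁ : length (map f (upTo n)) ≡ n
    len₁ = trans (Listₚ.length-map f (upTo n)) (Listₚ.length-upTo n)
    len₂ : length (compose x (map f (upTo n))) ≡ n
    len₂ = trans (Listₚ.length-map (ev x) (map f (upTo n))) len₁
  index : ∀ k → k < n → ∃ λ l → l < n × (atℕ x k ≡ + suc l ⊎ atℕ x k ≡ -[1+ l ])
  index k k<n = nonzero-index n (atℕ x k) (atℕ-All x k (proj₁ (proj₂ bx)) (<x k<n))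
  -- Every position is the absolute value of some entry of `x`, and `ev` is odd, so agreement at
  -- that entry is agreement at the position whatever its sign.
  elsewhere : (moved : ℕ → Set) → (∀ k → k < n → moved k ⊎ ev w (atℕ x k) ≡ ev u (atℕ x k)) →
    ∀ l → l < length u → (∀ k → k < n → moved k → ∣ atℕ x k ∣ ≢ suc l) → atℕ w l ≡ atℕ u l
  elsewhere moved fixed l l< ne with IsB-surjective bx l (subst (l <_) (proj₁ bu) l<)
  ... | k , k<x , ek with fixed k (subst (k <_) (proj₁ bx) k<x)
  ... | inj₁ m = ⊥-elim (ne k (subst (k <_) (proj₁ bx) k<x) m ek)
  ... | inj₂ e = ev-agree u w (atℕ x k) l ek e
  ∣±suc∣ : ∀ {z l} → z ≡ + suc l ⊎ z ≡ -[1+ l ] → ∣ z ∣ ≡ suc l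
  ∣±suc∣ (inj₁ refl) = refl
  ∣±suc∣ (inj₂ refl) = refl
  go : ∀ a → a < n → compose w x ≡ compose u (compose x (gen n a)) → u ≼ w ⊎ w ≼ u
  go zero a<n eq with index 0 a<n
  ... | i , i<n , xi = ≼-comparable-negswap i i u w |u|≡|w| (negated xi) (negated xi)
      (λ l l< ne _ → elsewhere (_≡ 0) fixed l l< (λ { _ _ refl e → ne (ℕₚ.suc-injective (trans (sym e) (∣±suc∣ xi))) }))
    where
    at-0 : ev w (atℕ x 0) ≡ - ev u (atℕ x 0)
    at-0 = trans (at-gen _ eq 0 a<n) (ev-neg u (atℕ x 0))
    negated : atℕ x 0 ≡ + suc i ⊎ atℕ x 0 ≡ -[1+ i ] → atℕ w i ≡ - atℕ u i
    negated (inj₁ e) = subst (λ z → ev w z ≡ - ev u z) e at-0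
    negated (inj₂ e) = ℤₚ.neg-injective (subst (λ z → ev w z ≡ - ev u z) e at-0)
    fixed : ∀ k → k < n → k ≡ 0 ⊎ ev w (atℕ x k) ≡ ev u (atℕ x k)
    fixed zero _ = inj₁ refl
    fixed (suc k) k<n = inj₂ (at-gen _ eq (suc k) k<n)
  go (suc b) b+1<n eq with index b (ℕₚ.<⇒≤ b+1<n) | index (suc b) b+1<n
  ... | i , i<n , xi | j , j<n , xj = compare xi xj
    where
    f : ℕ → ℤ
    f k = if k ℕ.≡ᵇ b then + suc (suc b) else if k ℕ.≡ᵇ suc b then + suc b else + suc k
    f-b : f b ≡ + suc (suc b)
    f-b rewrite ≡ᵇ-refl b = refl
    f-b+1 : f (suc b) ≡ + suc b
    f-b+1 rewrite ≡ᵇ-≢ (suc b) b ℕₚ.1+n≢n | ≡ᵇ-refl b = refl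
    f-else : ∀ k → k ≢ b → k ≢ suc b → f k ≡ + suc k
    f-else k n₁ n₂ rewrite ≡ᵇ-≢ k b n₁ | ≡ᵇ-≢ k (suc b) n₂ = refl
    at-b : ev w (atℕ x b) ≡ ev u (atℕ x (suc b))
    at-b = trans (at-gen f eq b (ℕₚ.<⇒≤ b+1<n)) (cong (λ t → ev u (ev x t)) f-b)
    at-b+1 : ev w (atℕ x (suc b)) ≡ ev u (atℕ x b)
    at-b+1 = trans (at-gen f eq (suc b) b+1<n) (cong (λ t → ev u (ev x t)) f-b+1)
    fixed : ∀ k → k < n → (k ≡ b ⊎ k ≡ suc b) ⊎ ev w (atℕ x k) ≡ ev u (atℕ x k)
    fixed k k<n with k ℕ.≟ b | k ℕ.≟ suc b
    ... | yes e | _ = inj₁ (inj₁ e)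
    ... | no _ | yes e = inj₁ (inj₂ e)
    ... | no n₁ | no n₂ = inj₂ (trans (at-gen f eq k k<n) (cong (λ t → ev u (ev x t)) (f-else k n₁ n₂)))
    others : ∀ l → l < length u → l ≢ i → l ≢ j → atℕ w l ≡ atℕ u l
    others l l< ne ne' = elsewhere (λ k → k ≡ b ⊎ k ≡ suc b) fixed l l<
      (λ { _ _ (inj₁ refl) e → ne (ℕₚ.suc-injective (trans (sym e) (∣±suc∣ xi)))
         ; _ _ (inj₂ refl) e → ne' (ℕₚ.suc-injective (trans (sym e) (∣±suc∣ xj))) })
    i≢j : i ≢ j
    i≢j refl = ℕₚ.1+n≢n (unique-atℕ x (suc b) b (proj₂ (proj₂ bx)) (<x b+1<n) (<x (ℕₚ.<⇒≤ b+1<n)) (trans (∣±suc∣ xj) (sym (∣±suc∣ xi))))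
    E : (z z' : ℤ) → Set
    E z z' = ev w z ≡ ev u z'
    compare : atℕ x b ≡ + suc i ⊎ atℕ x b ≡ -[1+ i ] → atℕ x (suc b) ≡ + suc j ⊎ atℕ x (suc b) ≡ -[1+ j ] → u ≼ w ⊎ w ≼ u
    compare (inj₁ e) (inj₁ e') = ≼-comparable-exchange i j u w i≢j (<u i<n) (<u j<n) |u|≡|w|
      (subst₂ E e e' at-b) (subst₂ E e' e at-b+1) others
    compare (inj₂ e) (inj₂ e') = ≼-comparable-exchange i j u w i≢j (<u i<n) (<u j<n) |u|≡|w|
      (ℤₚ.neg-injective (subst₂ E e e' at-b)) (ℤₚ.neg-injective (subst₂ E e' e at-b+1)) others
    compare (inj₁ e) (inj₂ e') = ≼-comparable-negswap i j u w |u|≡|w|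
      (subst₂ E e e' at-b) (ℤₚ.neg-injective (trans (subst₂ E e' e at-b+1) (sym (neg-involutive _)))) others
    compare (inj₂ e) (inj₁ e') = ≼-comparable-negswap i j u w |u|≡|w|
      (ℤₚ.neg-injective (trans (subst₂ E e e' at-b) (sym (neg-involutive _)))) (subst₂ E e' e at-b+1) others

-- If the comparison went the other way, `≼⇒Bruhat` would make the length of `w` at most that of
-- `u`.
BruhatStep⇒≼ : ∀ {n u w} → BruhatStep n u w → u ≼ w
BruhatStep⇒≼ (bu , bw , r , l) with IsReflection⇒comparable bu bw r
... | inj₁ u≼w = u≼w
... | inj₂ w≼u = ⊥-elim (ℕₚ.<⇒≱ l (Bruhat⇒ℓB≤ (≼⇒Bruhat bw bu w≼u)))

Bruhat⇒≼ : ∀ {n u w} → Bruhat n u w → u ≼ w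
Bruhat⇒≼ ε = ≼-refl
Bruhat⇒≼ (s ◅ ss) = ≼-trans (BruhatStep⇒≼ s) (Bruhat⇒≼ ss)

-- Blocks of two consecutive values

-- The two values of the block of z in increasing order: 2z-1 , 2z for z > 0 and 2z , 2z+1 for z < 0.
lo hi : ℤ → ℤ
lo (+ zero) = + 0
lo (+ suc k) = + suc (k + k)
lo -[1+ k ] = -[1+ suc (k + k) ]
hi (+ zero) = + 0
hi (+ suc k) = + suc (suc (k + k))
hi -[1+ k ] = -[1+ k + k ]

neg-lo : ∀ z → - lo z ≡ hi (- z)
neg-lo (+ zero) = refl
neg-lo (+ suc k) = refl
neg-lo -[1+ k ] = refl

neg-hi : ∀ z → - hi z ≡ lo (- z)
neg-hi (+ zero) = refl
neg-hi (+ suc k) = refl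
neg-hi -[1+ k ] = refl

lo<hi : ∀ {z} → z ≢ + 0 → lo z <ᶻ hi z
lo<hi {+ zero} n = ⊥-elim (n refl)
lo<hi {+ suc k} _ = ℤ.+<+ ≤-refl
lo<hi { -[1+ k ]} _ = ℤ.-<- ≤-refl

lo≤hi : ∀ z → lo z ≤ᶻ hi z
lo≤hi (+ zero) = ℤₚ.≤-refl
lo≤hi (+ suc k) = ℤₚ.<⇒≤ (lo<hi {+ suc k} (λ ()))
lo≤hi -[1+ k ] = ℤₚ.<⇒≤ (lo<hi { -[1+ k ]} (λ ()))

k<l⇒2k+1<2l : ∀ {k l} → k < l → suc (k + k) < l + l
k<l⇒2k+1<2l {k} {suc l} (s≤s k≤l) = s≤s (≤-trans (s≤s (+-mono-≤ k≤l k≤l)) (≤-reflexive (sym (+-suc l l))))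

hi<lo : ∀ {z s} → z <ᶻ s → hi z <ᶻ lo s
hi<lo {+ zero} {+ suc l} _ = ℤ.+<+ (s≤s z≤n)
hi<lo {+ suc k} {+ suc l} (ℤ.+<+ (s≤s k<l)) = ℤ.+<+ (s≤s (k<l⇒2k+1<2l k<l))
hi<lo {+ zero} {+ zero} (ℤ.+<+ ())
hi<lo {+ suc k} {+ zero} (ℤ.+<+ ())
hi<lo { -[1+ k ]} {+ zero} _ = ℤ.-<+
hi<lo { -[1+ k ]} {+ suc l} _ = ℤ.-<+
hi<lo { -[1+ k ]} { -[1+ l ]} (ℤ.-<- l<k) = ℤ.-<- (k<l⇒2k+1<2l l<k)

lt-block : ∀ {f g : ℤ → ℤ} → (∀ z → f z ≤ᶻ hi z) → (∀ z → lo z ≤ᶻ g z) → (∀ z → g z ≤ᶻ f z) → ∀ z s → lt (f z) (g s) ≡ lt z s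
lt-block {f} {g} f≤hi lo≤g g≤f z s with ℤₚ.<-cmp z s
... | tri< z<s _ _ = trans (lt-yes (ℤₚ.≤-<-trans (f≤hi z) (ℤₚ.<-≤-trans (hi<lo z<s) (lo≤g s)))) (sym (lt-yes z<s))
... | tri≈ _ refl _ = trans (lt-no (g≤f z)) (sym (lt-no (ℤₚ.≤-refl {z})))
... | tri> _ _ s<z = trans (lt-no (ℤₚ.≤-trans (ℤₚ.≤-trans (g≤f s) (f≤hi s))
    (ℤₚ.≤-trans (ℤₚ.<⇒≤ (hi<lo s<z)) (ℤₚ.≤-trans (lo≤g z) (g≤f z))))) (sym (lt-no (ℤₚ.<⇒≤ s<z)))

lt-lo-lo : ∀ z s → lt (lo z) (lo s) ≡ lt z s
lt-lo-lo = lt-block lo≤hi (λ _ → ℤₚ.≤-refl) (λ _ → ℤₚ.≤-refl)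

lt-hi-lo : ∀ z s → lt (hi z) (lo s) ≡ lt z s
lt-hi-lo = lt-block (λ _ → ℤₚ.≤-refl) (λ _ → ℤₚ.≤-refl) lo≤hi

lt-hi-hi : ∀ z s → lt (hi z) (hi s) ≡ lt z s
lt-hi-hi = lt-block (λ _ → ℤₚ.≤-refl) lo≤hi (λ _ → ℤₚ.≤-refl)

-- The one comparison that sees inside a block: it holds for z ≤ s rather than for z < s. At 0 it
-- would fail, as `lo` and `hi` coincide there.
lt-lo-hi : ∀ z s → s ≢ + 0 → lt (lo z) (hi s) ≡ lt z (ℤ.suc s)
lt-lo-hi z s s≢0 with ℤₚ.<-cmp z s
... | tri< z<s _ _ = trans (lt-yes (ℤₚ.≤-<-trans (lo≤hi z) (ℤₚ.<-≤-trans (hi<lo z<s) (lo≤hi s)))) (sym (lt-yes (≤⇒<suc (ℤₚ.<⇒≤ z<s))))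
... | tri≈ _ refl _ = trans (lt-yes (lo<hi s≢0)) (sym (lt-yes (i<suc[i] z)))
... | tri> _ _ s<z = trans (lt-no (ℤₚ.<⇒≤ (hi<lo s<z))) (sym (lt-no (ℤₚ.i<j⇒suc[i]≤j s<z)))

halve : ∀ n → ∃ λ k → n ≡ k + k ⊎ n ≡ suc (k + k)
halve zero = 0 , inj₁ refl
halve (suc n) with halve n
... | k , inj₁ refl = k , inj₂ refl
... | k , inj₂ refl = suc k , inj₁ (cong suc (sym (+-suc k k)))

-- Reduces thresholds for encoded windows to thresholds for the underlying permutation; 0 is filed
-- under `lo`.
lo-or-hi : ∀ t → ∃ λ s → t ≡ lo s ⊎ (s ≢ + 0 × t ≡ hi s)
lo-or-hi (+ zero) = + 0 , inj₁ refl
lo-or-hi (+ suc n) with halve n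
... | k , inj₁ refl = + suc k , inj₁ refl
... | k , inj₂ refl = + suc k , inj₂ ((λ ()) , refl)
lo-or-hi -[1+ n ] with halve n
... | k , inj₁ refl = -[1+ k ] , inj₂ ((λ ()) , refl)
... | k , inj₂ refl = -[1+ k ] , inj₁ refl

-- Marked permutations and the criterion for their encodings

Marked : Set
Marked = List (ℤ × Bool)

perm : Marked → List ℤ
perm = map proj₁

marks : Marked → List Bool
marks = map proj₂

fst snd : Bool → ℤ → ℤ
fst t z = if t then hi z else lo z
snd t z = if t then lo z else hi z

encode : Marked → List ℤ
encode [] = []
encode ((z , t) ∷ L) = fst t z ∷ snd t z ∷ encode L

2*-suc : ∀ k → 2 * suc k ≡ suc (suc (k + k))
2*-suc = solve-∀

lo-formula : ∀ s → (+ 2) ℤ.* s ℤ.- χ ⌊ + 0 <ℤ? s ⌋ ≡ lo s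
lo-formula (+ zero) = refl
lo-formula (+ suc k) = cong (λ t → + t ℤ.- + 1) (2*-suc k)
lo-formula -[1+ k ] rewrite +-identityʳ k | +-suc k k = refl

hi-formula : ∀ s → (+ 2) ℤ.* s ℤ.+ χ ⌊ s <ℤ? + 0 ⌋ ≡ hi s
hi-formula (+ zero) = refl
hi-formula (+ suc k) = trans (ℤₚ.+-identityʳ _) (cong +_ (2*-suc k))
hi-formula -[1+ k ] rewrite +-identityʳ k | +-suc k k = refl

enc≡encode : ∀ L → enc (perm L) (marks L) ≡ encode L
enc≡encode [] = refl
enc≡encode ((z , false) ∷ L) = cong₂ _∷_ (lo-formula z) (cong₂ _∷_ (hi-formula z) (enc≡encode L))
enc≡encode ((z , true) ∷ L) = cong₂ _∷_ (hi-formula z) (cong₂ _∷_ (lo-formula z) (enc≡encode L))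

mark : ∀ (σ : Window) (T : List Bool) → length σ ≡ length T → ∃ λ L → σ ≡ perm L × T ≡ marks L
mark [] [] _ = [] , refl , refl
mark (s ∷ σ) (t ∷ T) e with mark σ T (ℕₚ.suc-injective e)
... | L , refl , refl = (s , t) ∷ L , refl , refl

cnt-lo : ∀ s L → cnt (lo s) (encode L) ≡ cnt s (perm L) + cnt s (perm L)
cnt-lo s [] = refl
cnt-lo s ((z , t) ∷ L) = trans (cong₂ _+_ (first t) (cong₂ _+_ (second t) (cnt-lo s L))) (regroup (lt z s) (cnt s (perm L)))
  where
  regroup : ∀ a b → a + (a + (b + b)) ≡ (a + b) + (a + b)
  regroup = solve-∀
  first : ∀ t → lt (fst t z) (lo s) ≡ lt z s
  first true = lt-hi-lo z s
  first false = lt-lo-lo z s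
  second : ∀ t → lt (snd t z) (lo s) ≡ lt z s
  second true = lt-lo-lo z s
  second false = lt-hi-lo z s

-- Contribution of the second entry of the block of z to the count below hi s.
half : Bool → ℤ → ℤ → ℕ
half true z s = lt z (ℤ.suc s)
half false z s = lt z s

lt-snd-hi : ∀ t z s → s ≢ + 0 → lt (snd t z) (hi s) ≡ half t z s
lt-snd-hi true z s s≢0 = lt-lo-hi z s s≢0
lt-snd-hi false z s s≢0 = lt-hi-hi z s

cnt-hi : ∀ s → s ≢ + 0 → ∀ L → cnt (hi s) (encode L) ≡ cnt s (perm L) + cnt (ℤ.suc s) (perm L)
cnt-hi s s≢0 [] = refl
cnt-hi s s≢0 ((z , true) ∷ L) = trans (cong₂ _+_ (lt-hi-hi z s) (cong₂ _+_ (lt-lo-hi z s s≢0) (cnt-hi s s≢0 L)))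
  (regroup (lt z s) (lt z (ℤ.suc s)) (cnt s (perm L)) (cnt (ℤ.suc s) (perm L)))
  where
  regroup : ∀ a b c d → a + (b + (c + d)) ≡ (a + c) + (b + d)
  regroup = solve-∀
cnt-hi s s≢0 ((z , false) ∷ L) = trans (cong₂ _+_ (lt-lo-hi z s s≢0) (cong₂ _+_ (lt-hi-hi z s) (cnt-hi s s≢0 L)))
  (regroup (lt z (ℤ.suc s)) (lt z s) (cnt s (perm L)) (cnt (ℤ.suc s) (perm L)))
  where
  regroup : ∀ a b c d → a + (b + (c + d)) ≡ (b + c) + (a + d)
  regroup = solve-∀

-- For s ≠ 0 this is, by `cnt-hi`, the count below `hi s` over complete blocks: two for each entry
-- below `s` and one for an entry equal to `s`.
cnt₂ : ℤ → List ℤ → ℕ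
cnt₂ s σ = cnt s σ + cnt (ℤ.suc s) σ

infix 4 _⊴_
-- The conditions kept are those for suffixes of complete blocks at thresholds `lo s`, and for
-- suffixes that start inside a block at thresholds `hi s`. The two remaining combinations follow
-- from the comparison of the permutations, so marks enter only through `half`.
data _⊴_ : Marked → Marked → Set where
  [] : [] ⊴ []
  cons : ∀ {z t L z' t' L'} → (∀ s → cnt s (z ∷ perm L) ≤ cnt s (z' ∷ perm L')) →
         (∀ s → s ≢ + 0 → half t z s + cnt₂ s (perm L) ≤ half t' z' s + cnt₂ s (perm L')) →
         L ⊴ L' → (z , t) ∷ L ⊴ (z' , t') ∷ L'

⊴⇒perm≼ : ∀ {L L'} → L ⊴ L' → perm L ≼ perm L'
⊴⇒perm≼ [] = []
⊴⇒perm≼ (cons h _ t) = h ∷ ⊴⇒perm≼ t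

cnt₂-mono : ∀ {σ τ} → σ ≼ τ → ∀ s → cnt₂ s σ ≤ cnt₂ s τ
cnt₂-mono h s = +-mono-≤ (≼⇒cnt≤ h s) (≼⇒cnt≤ h (ℤ.suc s))

double-cancel-≤ : ∀ a b → a + a ≤ b + b → a ≤ b
double-cancel-≤ a b h = ℕₚ.≮⇒≥ (λ b<a → ℕₚ.<⇒≱ (ℕₚ.+-mono-< b<a b<a) h)

encode-≼⇒⊴ : ∀ L L' → encode L ≼ encode L' → L ⊴ L'
encode-≼⇒⊴ [] [] [] = []
encode-≼⇒⊴ ((z , t) ∷ L) ((z' , t') ∷ L') (h₁ ∷ (h₂ ∷ h)) = cons
  (λ s → double-cancel-≤ _ _ (subst₂ _≤_ (cnt-lo s ((z , t) ∷ L)) (cnt-lo s ((z' , t') ∷ L')) (h₁ (lo s))))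
  (λ s s≢0 → subst₂ _≤_ (cong₂ _+_ (lt-snd-hi t z s s≢0) (cnt-hi s s≢0 L)) (cong₂ _+_ (lt-snd-hi t' z' s s≢0) (cnt-hi s s≢0 L')) (h₂ (hi s)))
  (encode-≼⇒⊴ L L' h)

⊴⇒encode-≼ : ∀ {L L'} → L ⊴ L' → encode L ≼ encode L'
⊴⇒encode-≼ [] = []
⊴⇒encode-≼ L⊴L'@(cons {z} {t} {L} {z'} {t'} {L'} h₁ h₂ h) = outer ∷ (inner ∷ ⊴⇒encode-≼ h)
  where
  outer : ∀ j → cnt j (encode ((z , t) ∷ L)) ≤ cnt j (encode ((z' , t') ∷ L'))
  outer j with lo-or-hi j
  ... | s , inj₁ refl = subst₂ _≤_ (sym (cnt-lo s ((z , t) ∷ L))) (sym (cnt-lo s ((z' , t') ∷ L'))) (+-mono-≤ (h₁ s) (h₁ s))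
  ... | s , inj₂ (s≢0 , refl) = subst₂ _≤_ (sym (cnt-hi s s≢0 ((z , t) ∷ L))) (sym (cnt-hi s s≢0 ((z' , t') ∷ L')))
          (cnt₂-mono (⊴⇒perm≼ L⊴L') s)
  lo-inner : ∀ s z t L → cnt (lo s) (snd t z ∷ encode L) ≡ cnt s (z ∷ perm L) + cnt s (perm L)
  lo-inner s z t L = trans (cong₂ _+_ (second t) (cnt-lo s L)) (sym (+-assoc (lt z s) (cnt s (perm L)) (cnt s (perm L))))
    where
    second : ∀ t → lt (snd t z) (lo s) ≡ lt z s
    second true = lt-lo-lo z s
    second false = lt-hi-lo z s
  inner : ∀ j → cnt j (snd t z ∷ encode L) ≤ cnt j (snd t' z' ∷ encode L')
  inner j with lo-or-hi j
  ... | s , inj₁ refl = subst₂ _≤_ (sym (lo-inner s z t L)) (sym (lo-inner s z' t' L')) (+-mono-≤ (h₁ s) (≼⇒cnt≤ (⊴⇒perm≼ h) s))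
  ... | s , inj₂ (s≢0 , refl) = subst₂ _≤_ (sym (cong₂ _+_ (lt-snd-hi t z s s≢0) (cnt-hi s s≢0 L)))
          (sym (cong₂ _+_ (lt-snd-hi t' z' s s≢0) (cnt-hi s s≢0 L'))) (h₂ s s≢0)

-- Rank and length

ones : Marked → ℕ
ones [] = 0
ones ((_ , t) ∷ L) = (if t then 1 else 0) + ones L

rank : Marked → ℕ
rank L = 3 * pairs (perm L) + 2 * negB (perm L) + ones L

lt-suc-≢ : ∀ {z s} → z ≢ s → lt z (ℤ.suc s) ≡ lt z s
lt-suc-≢ z≢s = lt-cong (λ p → ℤₚ.≤∧≢⇒< (<suc⇒≤ p) z≢s) (λ p → ≤⇒<suc (ℤₚ.<⇒≤ p))

cnt-suc-∉ : ∀ s σ → All (_≢ s) σ → cnt (ℤ.suc s) σ ≡ cnt s σ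
cnt-suc-∉ s [] [] = refl
cnt-suc-∉ s (z ∷ σ) (n ∷ ns) = cong₂ _+_ (lt-suc-≢ n) (cnt-suc-∉ s σ ns)

-- Two blocks compare, in order and in sign of sums, as their entries of σ do, in all four pairs;
-- distinct absolute values ensure this also at thresholds `hi`. Inside a block there is an
-- inversion if it is marked and a negative sum if its entry is negative.
pairs-encode : ∀ L → All (_≢ + 0) (perm L) → Unique (map ∣_∣ (perm L)) →
  pairs (encode L) ≡ 4 * pairs (perm L) + negB (perm L) + ones L
pairs-encode [] _ _ = refl
pairs-encode ((z , t) ∷ L) (z≢0 ∷ nz) (z∉ ∷ u) = begin
  pairs (fst t z ∷ snd t z ∷ encode L)
    ≡⟨ pairs-∷∷ (fst t z) (snd t z) (encode L) ⟩
  lt (snd t z) (fst t z) + (lt (snd t z) (- fst t z) + (cnt± (fst t z) (encode L) + cnt± (snd t z) (encode L) + pairs (encode L)))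
    ≡⟨ cong₂ _+_ (within t) (cong₂ _+_ (below t) (cong₂ _+_ (cong₂ _+_ (outer t) (inner t)) (pairs-encode L nz u))) ⟩
  b + (lt z (+ 0) + (2 * cnt± z σ + 2 * cnt± z σ + (4 * pairs σ + negB σ + ones L)))
    ≡⟨ regroup b (lt z (+ 0)) (cnt± z σ) (pairs σ) (negB σ) (ones L) ⟩
  4 * (cnt± z σ + pairs σ) + (lt z (+ 0) + negB σ) + (b + ones L) ∎
  where
  open ≡-Reasoning
  σ = perm L
  b = if t then 1 else 0
  regroup : ∀ b l c p n o → b + (l + (2 * c + 2 * c + (4 * p + n + o))) ≡ 4 * (c + p) + (l + n) + (b + o)
  regroup = solve-∀
  -z≢0 : - z ≢ + 0
  -z≢0 e = z≢0 (ℤₚ.neg-injective e)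
  z∉σ : All (_≢ z) σ
  z∉σ = All.map (λ ne → ∣≢∣⇒≢ (ne ∘ sym)) (Allₚ.map⁻ z∉)
  -z∉σ : All (_≢ - z) σ
  -z∉σ = All.map (λ ne e → ∣≢∣⇒-≢ {z} ne (sym e)) (Allₚ.map⁻ z∉)
  cnt±-lo : cnt± (lo z) (encode L) ≡ 2 * cnt± z σ
  cnt±-lo = trans (cong₂ _+_ (cnt-lo z L) (trans (cong (λ k → cnt k (encode L)) (neg-lo z)) (trans (cnt-hi (- z) -z≢0 L)
    (+-congʳ (cnt (- z) σ) (cnt-suc-∉ (- z) σ -z∉σ))))) (twice (cnt z σ) (cnt (- z) σ))
    where twice : ∀ a b → (a + a) + (b + b) ≡ 2 * (a + b)
          twice = solve-∀
  cnt±-hi : cnt± (hi z) (encode L) ≡ 2 * cnt± z σ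
  cnt±-hi = trans (cong₂ _+_ (trans (cnt-hi z z≢0 L) (+-congʳ (cnt z σ) (cnt-suc-∉ z σ z∉σ)))
    (trans (cong (λ k → cnt k (encode L)) (neg-hi z)) (cnt-lo (- z) L))) (twice (cnt z σ) (cnt (- z) σ))
    where twice : ∀ a b → (a + a) + (b + b) ≡ 2 * (a + b)
          twice = solve-∀
  outer : ∀ t → cnt± (fst t z) (encode L) ≡ 2 * cnt± z σ
  outer true = cnt±-hi
  outer false = cnt±-lo
  inner : ∀ t → cnt± (snd t z) (encode L) ≡ 2 * cnt± z σ
  inner true = cnt±-lo
  inner false = cnt±-hi
  within : ∀ t → lt (snd t z) (fst t z) ≡ (if t then 1 else 0)
  within true = lt-yes (lo<hi z≢0)
  within false = lt-no (lo≤hi z)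
  z<-z : lt z (- z) ≡ lt z (+ 0)
  z<-z with ℤₚ.<-cmp z (+ 0)
  ... | tri< z<0 _ _ = trans (lt-yes (ℤₚ.<-trans z<0 (neg-mono-< z<0))) (sym (lt-yes z<0))
  ... | tri≈ _ e _ = ⊥-elim (z≢0 e)
  ... | tri> _ _ 0<z = trans (lt-no (ℤₚ.<⇒≤ (0<i⇒-i<i 0<z))) (sym (lt-no (ℤₚ.<⇒≤ 0<z)))
  below : ∀ t → lt (snd t z) (- fst t z) ≡ lt z (+ 0)
  below true = trans (cong (lt (lo z)) (neg-hi z)) (trans (lt-lo-lo z (- z)) z<-z)
  below false = trans (cong (lt (hi z)) (neg-lo z)) (trans (lt-hi-hi z (- z)) z<-z)

ℓB-encode : ∀ L → All (_≢ + 0) (perm L) → Unique (map ∣_∣ (perm L)) → ℓB (encode L) ≡ rank L + ℓB (perm L)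
-- `cnt-lo` at 0 applies because `lo (+ 0)` is 0: the encoding has twice as many negative entries.
ℓB-encode L nz u = trans (ℓB≡ (encode L)) (trans (cong₂ _+_ (pairs-encode L nz u) (cnt-lo (+ 0) L))
  (trans (regroup (pairs (perm L)) (negB (perm L)) (ones L)) (+-congʳ (rank L) (sym (ℓB≡ (perm L))))))
  where regroup : ∀ p n o → (4 * p + n + o) + (n + n) ≡ (3 * p + 2 * n + o) + (p + n)
        regroup = solve-∀

ℓW≡rank : ∀ {m} L → IsB m (perm L) → ℓW (perm L) (marks L) ≡ + rank L
ℓW≡rank L (_ , bd , u) = begin
  + ℓB (enc (perm L) (marks L)) ℤ.- + ℓB (perm L)   ≡⟨ cong (λ k → + k ℤ.- + ℓB (perm L)) (trans (cong ℓB (enc≡encode L)) (ℓB-encode L (All.map proj₁ bd) u)) ⟩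
  (+ rank L ℤ.+ + ℓB (perm L)) ℤ.- + ℓB (perm L)     ≡⟨ ℤₚ.+-assoc (+ rank L) (+ ℓB (perm L)) (- + ℓB (perm L)) ⟩
  + rank L ℤ.+ (+ ℓB (perm L) ℤ.- + ℓB (perm L))     ≡⟨ cong (λ k → + rank L ℤ.+ k) (ℤₚ.+-inverseʳ (+ ℓB (perm L))) ⟩
  + rank L ℤ.+ + 0                                   ≡⟨ ℤₚ.+-identityʳ (+ rank L) ⟩
  + rank L                                           ∎
  where open ≡-Reasoning

-- Adding marks below an upper bound

half-false≤ : ∀ t z s → lt z s ≤ half t z s
half-false≤ true z s = lt-mono (λ p → ≤⇒<suc (ℤₚ.<⇒≤ p))
half-false≤ false z s = ≤-refl

half-true-≢ : ∀ t {z s} → z ≢ s → half t z s ≡ lt z s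
half-true-≢ true z≢s = lt-suc-≢ z≢s
half-true-≢ false _ = refl

⊴-refl : ∀ L → L ⊴ L
⊴-refl [] = []
⊴-refl (_ ∷ L) = cons (λ _ → ≤-refl) (λ _ _ → ≤-refl) (⊴-refl L)

-- Unmarked entries impose nothing beyond `≼`: their inequality is the sum of the comparison at `s`
-- with the entry included and the one at `ℤ.suc s` without it.
half-bound : ∀ {z σ z' τ} t' → z ∷ σ ≼ z' ∷ τ → ∀ s → lt z s + cnt₂ s σ ≤ half t' z' s + cnt₂ s τ
half-bound {z} {σ} {z'} {τ} t' (h ∷ hs) s = begin
  lt z s + (cnt s σ + cnt (ℤ.suc s) σ)      ≡⟨ +-assoc (lt z s) (cnt s σ) (cnt (ℤ.suc s) σ) ⟨
  cnt s (z ∷ σ) + cnt (ℤ.suc s) σ           ≤⟨ +-mono-≤ (h s) (≼⇒cnt≤ hs (ℤ.suc s)) ⟩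
  cnt s (z' ∷ τ) + cnt (ℤ.suc s) τ          ≡⟨ +-assoc (lt z' s) (cnt s τ) (cnt (ℤ.suc s) τ) ⟩
  lt z' s + (cnt s τ + cnt (ℤ.suc s) τ)     ≤⟨ +-monoˡ-≤ (cnt₂ s τ) (half-false≤ t' z' s) ⟩
  half t' z' s + (cnt s τ + cnt (ℤ.suc s) τ) ∎
  where open ℕₚ.≤-Reasoning

-- The inequality at the centre of the box. Only at the threshold `z` do `half true z` and
-- `half false z` differ, so no other threshold needs testing.
Markable : ℤ → List ℤ → Bool → ℤ → List ℤ → Set
Markable z σ t' z' τ = half true z z + cnt₂ z σ ≤ half t' z' z + cnt₂ z τ

-- The inequality at one position does not involve the marks at the others, so if `L ⊴ V`, excluding
-- single additions makes the mark set the largest one below `V` for this permutation.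
data Stuck : Marked → Marked → Set where
  [] : Stuck [] []
  cons : ∀ {z t L z' t' L'} → (t ≡ false → ¬ Markable z (perm L) t' z' (perm L')) →
         Stuck L L' → Stuck ((z , t) ∷ L) ((z' , t') ∷ L')

data MarkOne : Marked → Marked → Set where
  here : ∀ {z L} → MarkOne ((z , false) ∷ L) ((z , true) ∷ L)
  there : ∀ {e L L'} → MarkOne L L' → MarkOne (e ∷ L) (e ∷ L')

MarkOne-perm : ∀ {L L'} → MarkOne L L' → perm L' ≡ perm L
MarkOne-perm here = refl
MarkOne-perm (there {z , _} m) = cong (z ∷_) (MarkOne-perm m)

MarkOne-ones : ∀ {L L'} → MarkOne L L' → ones L' ≡ suc (ones L)
MarkOne-ones here = refl
MarkOne-ones (there {_ , true} m) = cong suc (MarkOne-ones m)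
MarkOne-ones (there {_ , false} m) = MarkOne-ones m

MarkOne-⊴ : ∀ {L L'} → MarkOne L L' → L ⊴ L'
MarkOne-⊴ (here {z} {L}) = cons (λ _ → ≤-refl) (λ s _ → +-monoˡ-≤ (cnt₂ s (perm L)) (half-false≤ true z s)) (⊴-refl L)
MarkOne-⊴ (there {z , t} m) = cons (λ s → ≤-reflexive (cong (λ σ → cnt s (z ∷ σ)) (sym (MarkOne-perm m))))
  (λ s _ → ≤-reflexive (cong (λ σ → half t z s + cnt₂ s σ) (sym (MarkOne-perm m)))) (MarkOne-⊴ m)

stuck-or-mark : ∀ {L V} → L ⊴ V → Stuck L V ⊎ (∃ λ L' → MarkOne L L' × L' ⊴ V)
stuck-or-mark [] = inj₁ []
stuck-or-mark {(z , t) ∷ L} {(z' , t') ∷ V} L⊴V@(cons h₁ h₂ h) with stuck-or-mark h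
... | inj₂ (L' , m , L'⊴V) = inj₂ ((z , t) ∷ L' , there m , cons
  (λ s → subst (λ σ → cnt s (z ∷ σ) ≤ cnt s (z' ∷ perm V)) (sym (MarkOne-perm m)) (h₁ s))
  (λ s s≢0 → subst (λ σ → half t z s + cnt₂ s σ ≤ half t' z' s + cnt₂ s (perm V)) (sym (MarkOne-perm m)) (h₂ s s≢0)) L'⊴V)
stuck-or-mark {(z , true) ∷ L} L⊴V | inj₁ st = inj₁ (cons (λ ()) st)
stuck-or-mark {(z , false) ∷ L} {(z' , t') ∷ V} L⊴V@(cons h₁ h₂ h) | inj₁ st
  with half true z z + cnt₂ z (perm L) ℕ.≤? half t' z' z + cnt₂ z (perm V)
... | no ¬m = inj₁ (cons (λ _ → ¬m) st)
... | yes m = inj₂ ((z , true) ∷ L , here , cons h₁ h₂' h)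
  where
  h₂' : ∀ s → s ≢ + 0 → half true z s + cnt₂ s (perm L) ≤ half t' z' s + cnt₂ s (perm V)
  h₂' s s≢0 with z ≟ℤ s
  ... | yes refl = m
  ... | no z≢s = ≤-trans (≤-reflexive (+-congˡ (cnt₂ s (perm L)) (half-true-≢ true z≢s))) (h₂ s s≢0)

-- Ensures that a stuck `L` different from `V` has a different permutation, so that a cover of that
-- permutation can be sought.
stuck-≡ : ∀ {L V} → L ⊴ V → All (_≢ + 0) (perm L) → Stuck L V → perm L ≡ perm V → L ≡ V
stuck-≡ [] _ [] _ = refl
stuck-≡ {(z , t) ∷ L} {(z' , t') ∷ V} (cons h₁ h₂ h) (z≢0 ∷ nz) (cons s st) e
  with Listₚ.∷-injectiveˡ e | stuck-≡ h nz st (Listₚ.∷-injectiveʳ e)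
... | refl | refl = cong (λ b → (z , b) ∷ L) (same t t' s (h₂ z z≢0))
  where
  same : ∀ t t' → (t ≡ false → ¬ Markable z (perm L) t' z (perm L)) →
    half t z z + cnt₂ z (perm L) ≤ half t' z z + cnt₂ z (perm L) → t ≡ t'
  same true true _ _ = refl
  same false false _ _ = refl
  same false true ¬m _ = ⊥-elim (¬m refl ≤-refl)
  same true false _ le = ⊥-elim (ℕₚ.<⇒≱ {0} {1} (s≤s z≤n) (subst₂ _≤_ (lt-yes (i<suc[i] z)) (lt-no (ℤₚ.≤-refl {z}))
    (+-cancelʳ-≤ (cnt₂ z (perm L)) _ _ le)))

-- The strict hypothesis provides a slack of one, exactly what a mark on `z` adds at threshold `z`.
-- An unmarked `z` would thus be `Markable`.
stuck⇒marked : ∀ A A' {z t X V e Y} → length A ≡ length A' → Stuck (A ++ (z , t) ∷ X) V → A' ++ e ∷ Y ≼ perm V →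
  cnt z (z ∷ perm X) + cnt (ℤ.suc z) (perm X) < cnt z (e ∷ Y) + cnt (ℤ.suc z) Y → t ≡ true
stuck⇒marked [] [] {t = true} _ _ _ _ = refl
stuck⇒marked [] [] {z} {false} {X} {(z' , t') ∷ V} {e} {Y} _ (cons ¬m _) h@(_ ∷ _) l = ⊥-elim (¬m refl (begin
  half true z z + cnt₂ z (perm X)                       ≡⟨ +-congˡ (cnt₂ z (perm X)) (lt-yes (i<suc[i] z)) ⟩
  1 + cnt₂ z (perm X)                                   ≤⟨ s≤s (m≤n+m (cnt₂ z (perm X)) (lt z z)) ⟩
  1 + (lt z z + cnt₂ z (perm X))                        ≡⟨ cong suc (+-assoc (lt z z) (cnt z (perm X)) (cnt (ℤ.suc z) (perm X))) ⟨
  1 + (cnt z (z ∷ perm X) + cnt (ℤ.suc z) (perm X))     ≤⟨ l ⟩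
  cnt z (e ∷ Y) + cnt (ℤ.suc z) Y                       ≡⟨ +-assoc (lt e z) (cnt z Y) (cnt (ℤ.suc z) Y) ⟩
  lt e z + cnt₂ z Y                                     ≤⟨ half-bound t' h z ⟩
  half t' z' z + cnt₂ z (perm V)                        ∎))
  where open ℕₚ.≤-Reasoning
stuck⇒marked (_ ∷ A) (_ ∷ A') {V = _ ∷ V} e (cons _ st) (_ ∷ h) l = stuck⇒marked A A' (ℕₚ.suc-injective e) st h l

-- Marks that survive a cover

-- L' arises from L by unmarking entries, the still marked ones being positions whose
-- contribution to the criterion is unaffected.
data Keep : Marked → Marked → Set where
  [] : Keep [] []
  unmark : ∀ {e z L L'} → Keep L L' → Keep (e ∷ L) ((z , false) ∷ L')
  same : ∀ {z t L L'} → cnt₂ z (perm L') ≡ cnt₂ z (perm L) → Keep L L' → Keep ((z , t) ∷ L) ((z , t) ∷ L')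

Keep-refl : ∀ L → Keep L L
Keep-refl [] = []
Keep-refl (_ ∷ L) = same refl (Keep-refl L)

-- A surviving mark is visible only at the threshold equal to its own entry, where the old
-- inequality is reused; everywhere else `half-bound` is enough.
Keep-⊴ : ∀ {L L' V} → Keep L L' → L ⊴ V → perm L' ≼ perm V → L' ⊴ V
Keep-⊴ [] [] [] = []
Keep-⊴ (unmark k) (cons {t' = t'} h₁ h₂ h) p@(p₁ ∷ ps) = cons p₁ (λ s _ → half-bound t' p s) (Keep-⊴ k h ps)
Keep-⊴ (same {z} {t} {L} {L'} e k) (cons {z' = z'} {t' = t'} {L' = V} h₁ h₂ h) p@(p₁ ∷ ps) = cons p₁ mid (Keep-⊴ k h ps)
  where
  mid : ∀ s → s ≢ + 0 → half t z s + cnt₂ s (perm L') ≤ half t' z' s + cnt₂ s (perm V)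
  mid s s≢0 with z ≟ℤ s
  ... | yes refl = ≤-trans (≤-reflexive (+-congʳ (half t z z) e)) (h₂ z s≢0)
  ... | no z≢s = ≤-trans (≤-reflexive (+-congˡ (cnt₂ s (perm L')) (half-true-≢ t z≢s))) (half-bound t' p s)

perm-++ : ∀ A X → perm (A ++ X) ≡ perm A ++ perm X
perm-++ = Listₚ.map-++ proj₁

cnt₂-++ : ∀ s A X → cnt₂ s (perm (A ++ X)) ≡ cnt₂ s (perm A) + cnt₂ s (perm X)
cnt₂-++ s A X = trans (cong (cnt₂ s) (perm-++ A X)) (trans (cong₂ _+_ (cnt-++ s (perm A) (perm X)) (cnt-++ (ℤ.suc s) (perm A) (perm X)))
  (interchange (cnt s (perm A)) (cnt s (perm X)) (cnt (ℤ.suc s) (perm A)) (cnt (ℤ.suc s) (perm X))))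

Keep-++ : ∀ A {X X'} → All (λ a → cnt₂ a (perm X') ≡ cnt₂ a (perm X)) (perm A) → Keep X X' → Keep (A ++ X) (A ++ X')
Keep-++ [] _ k = k
Keep-++ ((z , t) ∷ A) {X} {X'} (e ∷ es) k = same (trans (cnt₂-++ z A X') (trans (+-congʳ (cnt₂ z (perm A)) e) (sym (cnt₂-++ z A X)))) (Keep-++ A es k)

⊴-++ : ∀ A {X X'} → (∀ s → cnt s (perm X) ≤ cnt s (perm X')) → X ⊴ X' → A ++ X ⊴ A ++ X'
⊴-++ [] _ h = h
⊴-++ ((z , t) ∷ A) {X} {X'} le h = cons (λ s → +-monoʳ-≤ (lt z s) (mono s))
  (λ s _ → +-monoʳ-≤ (half t z s) (+-mono-≤ (mono s) (mono (ℤ.suc s)))) (⊴-++ A le h)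
  where
  mono : ∀ s → cnt s (perm (A ++ X)) ≤ cnt s (perm (A ++ X'))
  mono s = subst₂ (λ a b → cnt s a ≤ cnt s b) (sym (perm-++ A X)) (sym (perm-++ A X')) (cnt-++-monoʳ s (perm A) (le s))

ones-mid : ∀ A {z t X} → ones (A ++ (z , t) ∷ X) ≡ (if t then 1 else 0) + ones (A ++ X)
ones-mid [] = refl
ones-mid ((_ , b) ∷ A) {z} {t} {X} = trans (+-congʳ (if b then 1 else 0) (ones-mid A {z} {t} {X}))
  (x∙yz≈y∙xz (if b then 1 else 0) (if t then 1 else 0) (ones (A ++ X)))

perm-split : ∀ A {d X} L → A ++ d ∷ X ≡ perm L → ∃ λ LA → ∃ λ t → ∃ λ LX → L ≡ LA ++ (d , t) ∷ LX × perm LA ≡ A × perm LX ≡ X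
perm-split [] ((z , t) ∷ L) e = [] , t , L , cong (λ d → (d , t) ∷ L) (sym (Listₚ.∷-injectiveˡ e)) , refl , sym (Listₚ.∷-injectiveʳ e)
perm-split (a ∷ A) ((z , t) ∷ L) e with perm-split A L (Listₚ.∷-injectiveʳ e)
... | LA , t' , LX , refl , eA , eX = (z , t) ∷ LA , t' , LX , refl , cong₂ _∷_ (sym (Listₚ.∷-injectiveˡ e)) eA , eX

outside-lt-suc : ∀ {lo hi a} → lo <ᶻ hi → Outside lo hi a → lt lo (ℤ.suc a) ≡ lt hi (ℤ.suc a)
outside-lt-suc lo<hi (inj₁ a<lo) = trans (lt-no (ℤₚ.i<j⇒suc[i]≤j a<lo)) (sym (lt-no (ℤₚ.i<j⇒suc[i]≤j (ℤₚ.<-trans a<lo lo<hi))))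
outside-lt-suc lo<hi (inj₂ hi<a) = trans (lt-yes (≤⇒<suc (ℤₚ.<⇒≤ (ℤₚ.<-trans lo<hi hi<a)))) (sym (lt-yes (≤⇒<suc (ℤₚ.<⇒≤ hi<a))))

-- Elements of an interval one rank above its lower end

Between : ℕ → Marked → Marked → Set
Between m L V = ∃ λ L' → IsB m (perm L') × L ⊴ L' × L' ⊴ V × rank L' ≡ suc (rank L)

perm-two : ∀ A d t B p t' C → perm (A ++ (d , t) ∷ B ++ (p , t') ∷ C) ≡ perm A ++ d ∷ perm B ++ p ∷ perm C
perm-two A d t B p t' C = trans (perm-++ A _) (cong (λ X → perm A ++ d ∷ X) (perm-++ B _))

cnt-perm-mid : ∀ s B p t C → cnt s (perm (B ++ (p , t) ∷ C)) ≡ lt p s + cnt s (perm (B ++ C))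
cnt-perm-mid s B p t C = trans (cong (cnt s) (perm-++ B _)) (trans (cnt-∷-mid s (perm B) p (perm C)) (+-congʳ (lt p s) (cong (cnt s) (sym (perm-++ B C)))))

cnt₂-mid : ∀ s B p t C → cnt₂ s (perm (B ++ (p , t) ∷ C)) ≡ (lt p s + lt p (ℤ.suc s)) + cnt₂ s (perm (B ++ C))
cnt₂-mid s B p t C = trans (cong₂ _+_ (cnt-perm-mid s B p t C) (cnt-perm-mid (ℤ.suc s) B p t C))
  (interchange (lt p s) (cnt s (perm (B ++ C))) (lt p (ℤ.suc s)) (cnt (ℤ.suc s) (perm (B ++ C))))

-- A drop by at least one outweighs a mark. This is why lowering an entry while removing its mark
-- still leads upwards in `⊴`.
lt-suc-< : ∀ {p p'} s → p' <ᶻ p → lt p (ℤ.suc s) ≤ lt p' s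
lt-suc-< s p'<p = lt-mono (λ l → ℤₚ.<-≤-trans p'<p (<suc⇒≤ l))

rank-suc₂ : ∀ L L' → pairs (perm L') ≡ suc (pairs (perm L)) → negB (perm L') ≡ negB (perm L) → ones L ≡ 2 + ones L' → rank L' ≡ suc (rank L)
rank-suc₂ L L' e₁ e₂ e₃ = trans (cong₂ (λ a b → 3 * a + 2 * b + ones L') e₁ e₂)
  (trans (regroup (pairs (perm L)) (negB (perm L)) (ones L')) (cong (λ o → suc (3 * pairs (perm L) + 2 * negB (perm L) + o)) (sym e₃)))
  where regroup : ∀ a b c → 3 * (1 + a) + 2 * b + c ≡ 1 + (3 * a + 2 * b + (2 + c))
        regroup = solve-∀

rank-suc₁ : ∀ L L' → pairs (perm L') ≡ pairs (perm L) → negB (perm L') ≡ suc (negB (perm L)) → ones L ≡ 1 + ones L' → rank L' ≡ suc (rank L)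
rank-suc₁ L L' e₁ e₂ e₃ = trans (cong₂ (λ a b → 3 * a + 2 * b + ones L') e₁ e₂)
  (trans (regroup (pairs (perm L)) (negB (perm L)) (ones L')) (cong (λ o → suc (3 * pairs (perm L) + 2 * negB (perm L) + o)) (sym e₃)))
  where regroup : ∀ a b c → 3 * a + 2 * (1 + b) + c ≡ 1 + (3 * a + 2 * b + (1 + c))
        regroup = solve-∀

ones-two : ∀ A d B p C d' p' → ones (A ++ (d , true) ∷ B ++ (p , true) ∷ C) ≡ 2 + ones (A ++ (d' , false) ∷ B ++ (p' , false) ∷ C)
ones-two A d B p C d' p' = trans (two d true p) (cong (λ o → 2 + o) (sym (two d' false p')))
  where
  two : ∀ d t p → ones (A ++ (d , t) ∷ B ++ (p , t) ∷ C) ≡ (if t then 1 else 0) + ((if t then 1 else 0) + ones (A ++ B ++ C))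
  two d t p = trans (ones-mid A {d} {t}) (+-congʳ (if t then 1 else 0) (trans (cong ones (sym (Listₚ.++-assoc A B _)))
    (trans (ones-mid (A ++ B) {p} {t}) (+-congʳ (if t then 1 else 0) (cong ones (Listₚ.++-assoc A B C))))))

-- The reflection strictly raises the count at an edge of the box of a moved entry, so if that entry were
-- unmarked it could be marked.
moved-marked₁ : ∀ A d t X {V d' Y} → Stuck (A ++ (d , t) ∷ X) V → perm A ++ d' ∷ Y ≼ perm V →
  cnt d (d ∷ perm X) + cnt (ℤ.suc d) (perm X) < cnt d (d' ∷ Y) + cnt (ℤ.suc d) Y → t ≡ true
moved-marked₁ A d t X st h l = stuck⇒marked A (perm A) (sym (Listₚ.length-map proj₁ A)) st h l

moved-marked₂ : ∀ A d t B p t' C {V d' p'} → Stuck (A ++ (d , t) ∷ B ++ (p , t') ∷ C) V →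
  perm A ++ d' ∷ perm B ++ p' ∷ perm C ≼ perm V → p' <ᶻ p → t' ≡ true
moved-marked₂ A d t B p t' C {V} {d'} {p'} st h p'<p = stuck⇒marked (A ++ (d , t) ∷ B) (perm A ++ d' ∷ perm B)
  (trans (Listₚ.length-++ A) (trans (cong₂ _+_ (sym (Listₚ.length-map proj₁ A)) (cong suc (sym (Listₚ.length-map proj₁ B)))) (sym (Listₚ.length-++ (perm A)))))
  (subst (λ L → Stuck L V) (sym (Listₚ.++-assoc A ((d , t) ∷ B) _)) st)
  (subst (_≼ perm V) (sym (Listₚ.++-assoc (perm A) (d' ∷ perm B) _)) h)
  (ℕₚ.+-monoˡ-< (cnt (ℤ.suc p) (perm C)) (ℕₚ.+-monoˡ-< (cnt p (perm C))
    (≤-reflexive (trans (cong suc (lt-no (ℤₚ.≤-refl {p}))) (sym (lt-yes p'<p))))))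

between-exchange : ∀ {m V} A d t B p t' C → d <ᶻ p → All (Outside d p) (perm B) →
  IsB m (perm (A ++ (d , t) ∷ B ++ (p , t') ∷ C)) → Stuck (A ++ (d , t) ∷ B ++ (p , t') ∷ C) V →
  A ++ (d , t) ∷ B ++ (p , t') ∷ C ⊴ V → perm A ++ p ∷ perm B ++ d ∷ perm C ≼ perm V →
  Between m (A ++ (d , t) ∷ B ++ (p , t') ∷ C) V
between-exchange {m} {V} A d t B p t' C d<p out b st L⊴V h
  with moved-marked₁ A d t (B ++ (p , t') ∷ C) st h first | moved-marked₂ A d t B p t' C st h d<p
  where
  -- The suffix from the moved position is only rearranged and gains nothing. The gain is in the
  -- suffix after it, at `ℤ.suc d`, where `d` has replaced `p`.
  first : cnt d (d ∷ perm (B ++ (p , t') ∷ C)) + cnt (ℤ.suc d) (perm (B ++ (p , t') ∷ C))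
        < cnt d (p ∷ perm B ++ d ∷ perm C) + cnt (ℤ.suc d) (perm B ++ d ∷ perm C)
  first rewrite perm-++ B ((p , t') ∷ C) = ℕₚ.+-mono-≤-< (≤-reflexive (sym (cnt-exchange d (perm B) p (perm C) d)))
    (subst₂ _<_ (sym (trans (cnt-∷-mid (ℤ.suc d) (perm B) p (perm C)) (+-congˡ _ (lt-no (ℤₚ.i<j⇒suc[i]≤j d<p)))))
                (sym (trans (cnt-∷-mid (ℤ.suc d) (perm B) d (perm C)) (+-congˡ _ (lt-yes (i<suc[i] d))))) ≤-refl)
... | refl | refl = L' , b' , L⊴L' , Keep-⊴ keep L⊴V (subst (_≼ perm V) (sym σ'≡) h) ,
    rank-suc₂ L L' (trans (cong pairs σ'≡) (trans (pairs-exchange (perm A) d (perm B) p (perm C) d<p out) (cong (suc ∘ pairs) (sym σ≡))))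
      (trans (cong negB σ'≡) (trans (negB-exchange (perm A) d (perm B) p (perm C)) (cong negB (sym σ≡)))) (ones-two A d B p C p d)
  where
  L = A ++ (d , true) ∷ B ++ (p , true) ∷ C
  L' = A ++ (p , false) ∷ B ++ (d , false) ∷ C
  σ≡ = perm-two A d true B p true C
  σ'≡ = perm-two A p false B d false C
  b' : IsB m (perm L')
  b' = subst (IsB m) (sym σ'≡) (IsB-Move (exchange (perm A) d (perm B) p (perm C) d<p out) (subst (IsB m) σ≡ b))
  swapped : ∀ s → cnt s (p ∷ perm (B ++ (d , false) ∷ C)) ≡ cnt s (d ∷ perm (B ++ (p , true) ∷ C))
  swapped s rewrite perm-++ B ((d , false) ∷ C) | perm-++ B ((p , true) ∷ C) = cnt-exchange d (perm B) p (perm C) s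
  -- Entries of `A` see the same multiset to their right, and entries of `B` do not separate `d`
  -- from `p`. The two moved positions are the ones unmarked.
  keep : Keep L L'
  keep = Keep-++ A (All.universal (λ a → cong₂ _+_ (swapped a) (swapped (ℤ.suc a))) (perm A))
    (unmark (Keep-++ B (All.map (λ {b} o → cong₂ _+_ (+-congˡ (cnt b (perm C)) (outside-ltʳ d<p o))
      (+-congˡ (cnt (ℤ.suc b) (perm C)) (outside-lt-suc d<p o))) out) (unmark (Keep-refl C))))
  regroup : ∀ x y z r → x + ((y + z) + r) ≡ (x + y + r) + z
  regroup = solve-∀
  regroup' : ∀ x y z r → x + ((y + z) + r) ≡ (z + x + r) + y
  regroup' = solve-∀
  -- After cancellation this says that `lt p (ℤ.suc s)` is at most `lt d s`: the mark lost on the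
  -- left is paid for by the drop on the right.
  middle : ∀ s → half true d s + cnt₂ s (perm (B ++ (p , true) ∷ C)) ≤ half false p s + cnt₂ s (perm (B ++ (d , false) ∷ C))
  middle s = subst₂ _≤_
    (sym (trans (+-congʳ (lt d (ℤ.suc s)) (cnt₂-mid s B p true C)) (regroup (lt d (ℤ.suc s)) (lt p s) (lt p (ℤ.suc s)) (cnt₂ s (perm (B ++ C))))))
    (sym (trans (+-congʳ (lt p s) (cnt₂-mid s B d false C)) (regroup' (lt p s) (lt d s) (lt d (ℤ.suc s)) (cnt₂ s (perm (B ++ C))))))
    (+-monoʳ-≤ _ (lt-suc-< s d<p))
  L⊴L' : L ⊴ L'
  L⊴L' = ⊴-++ A (λ s → ≤-reflexive (sym (swapped s))) (cons (λ s → ≤-reflexive (sym (swapped s))) (λ s _ → middle s)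
    (⊴-++ B (λ s → +-monoˡ-≤ (cnt s (perm C)) (lt-monoˡ s (ℤₚ.<⇒≤ d<p)))
      (cons (λ s → +-monoˡ-≤ (cnt s (perm C)) (lt-monoˡ s (ℤₚ.<⇒≤ d<p))) (λ s _ → +-monoˡ-≤ (cnt₂ s (perm C)) (lt-suc-< s d<p)) (⊴-refl C))))

between-flip : ∀ {m V} A p t C → + 0 <ᶻ p → All (Outside (- p) p) (perm A) →
  IsB m (perm (A ++ (p , t) ∷ C)) → Stuck (A ++ (p , t) ∷ C) V →
  A ++ (p , t) ∷ C ⊴ V → perm A ++ - p ∷ perm C ≼ perm V → Between m (A ++ (p , t) ∷ C) V
between-flip {m} {V} A p t C 0<p out b st L⊴V h
  with moved-marked₁ A p t C st h (ℕₚ.+-monoˡ-< (cnt (ℤ.suc p) (perm C)) (ℕₚ.+-monoˡ-< (cnt p (perm C))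
    (≤-reflexive (trans (cong suc (lt-no (ℤₚ.≤-refl {p}))) (sym (lt-yes (0<i⇒-i<i 0<p)))))))
... | refl = L' , subst (IsB m) (sym σ'≡) (IsB-Move (flip (perm A) p (perm C) 0<p out) (subst (IsB m) σ≡ b)) , L⊴L' ,
    Keep-⊴ keep L⊴V (subst (_≼ perm V) (sym σ'≡) h) ,
    rank-suc₁ L L' (trans (cong pairs σ'≡) (trans (pairs-flip (perm A) p (perm C) 0<p out) (cong pairs (sym σ≡))))
      (trans (cong negB σ'≡) (trans (negB-flip (perm A) p (perm C) 0<p) (cong (suc ∘ negB) (sym σ≡))))
      (trans (ones-mid A {p} {true} {C}) (cong suc (sym (ones-mid A { - p} {false} {C}))))
  where
  L = A ++ (p , true) ∷ C
  L' = A ++ (- p , false) ∷ C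
  σ≡ = perm-++ A ((p , true) ∷ C)
  σ'≡ = perm-++ A ((- p , false) ∷ C)
  -p<p = 0<i⇒-i<i 0<p
  keep : Keep L L'
  keep = Keep-++ A (All.map (λ {a} o → cong₂ _+_ (+-congˡ (cnt a (perm C)) (outside-ltʳ -p<p o))
      (+-congˡ (cnt (ℤ.suc a) (perm C)) (outside-lt-suc -p<p o))) out) (unmark (Keep-refl C))
  L⊴L' : L ⊴ L'
  L⊴L' = ⊴-++ A (λ s → +-monoˡ-≤ (cnt s (perm C)) (lt-monoˡ s (ℤₚ.<⇒≤ -p<p)))
    (cons (λ s → +-monoˡ-≤ (cnt s (perm C)) (lt-monoˡ s (ℤₚ.<⇒≤ -p<p))) (λ s _ → +-monoˡ-≤ (cnt₂ s (perm C)) (lt-suc-< s -p<p)) (⊴-refl C))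

between-negswap : ∀ {m V} A d t B p t' C → - d <ᶻ p → (d <ᶻ + 0 × + 0 <ᶻ p) ⊎ (+ 0 <ᶻ d × p <ᶻ + 0) →
  All (Outside (- d) p) (perm A) → All (Outside (- p) d) (perm A) → All (Outside (- d) p) (perm B) →
  IsB m (perm (A ++ (d , t) ∷ B ++ (p , t') ∷ C)) → Stuck (A ++ (d , t) ∷ B ++ (p , t') ∷ C) V →
  A ++ (d , t) ∷ B ++ (p , t') ∷ C ⊴ V → perm A ++ - p ∷ perm B ++ - d ∷ perm C ≼ perm V →
  Between m (A ++ (d , t) ∷ B ++ (p , t') ∷ C) V
between-negswap {m} {V} A d t B p t' C -d<p sg oA oA' oB b st L⊴V h
  with moved-marked₁ A d t (B ++ (p , t') ∷ C) st h first | moved-marked₂ A d t B p t' C st h -d<p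
  where
  lower : ∀ s → cnt s (perm (B ++ (p , t') ∷ C)) ≤ cnt s (perm B ++ - d ∷ perm C)
  lower s rewrite perm-++ B ((p , t') ∷ C) = cnt-++-monoʳ s (perm B) (+-monoˡ-≤ (cnt s (perm C)) (lt-monoˡ s (ℤₚ.<⇒≤ -d<p)))
  -- Here the gain is at the moved position itself: `- p` is below `d`, while `d` is not below
  -- itself. The remaining counts can only grow.
  first : cnt d (d ∷ perm (B ++ (p , t') ∷ C)) + cnt (ℤ.suc d) (perm (B ++ (p , t') ∷ C))
        < cnt d (- p ∷ perm B ++ - d ∷ perm C) + cnt (ℤ.suc d) (perm B ++ - d ∷ perm C)
  first = ℕₚ.+-mono-<-≤ (ℕₚ.+-mono-<-≤ (≤-reflexive (trans (cong suc (lt-no (ℤₚ.≤-refl {d}))) (sym (lt-yes (-<⇒ {d} -d<p))))) (lower d))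
    (lower (ℤ.suc d))
... | refl | refl = L' , b' , L⊴L' , Keep-⊴ keep L⊴V (subst (_≼ perm V) (sym σ'≡) h) ,
    rank-suc₂ L L' (trans (cong pairs σ'≡) (trans (pairs-negswap (perm A) d (perm B) p (perm C) -d<p oA oA' oB) (cong (suc ∘ pairs) (sym σ≡))))
      (trans (cong negB σ'≡) (trans (negB-negswap (perm A) d (perm B) p (perm C) sg) (cong negB (sym σ≡)))) (ones-two A d B p C (- p) (- d))
  where
  L = A ++ (d , true) ∷ B ++ (p , true) ∷ C
  L' = A ++ (- p , false) ∷ B ++ (- d , false) ∷ C
  σ≡ = perm-two A d true B p true C
  σ'≡ = perm-two A (- p) false B (- d) false C
  -p<d = -<⇒ {d} -d<p
  b' : IsB m (perm L')
  b' = subst (IsB m) (sym σ'≡) (IsB-Move (negswap (perm A) d (perm B) p (perm C) -d<p sg oA oA' oB) (subst (IsB m) σ≡ b))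
  tail-≡ : ∀ s → lt (- d) s ≡ lt p s → cnt s (perm (B ++ (- d , false) ∷ C)) ≡ cnt s (perm (B ++ (p , true) ∷ C))
  tail-≡ s e = trans (cnt-perm-mid s B (- d) false C) (trans (+-congˡ _ e) (sym (cnt-perm-mid s B p true C)))
  keep : Keep L L'
  keep = Keep-++ A (All.zipWith (λ {a} (o , o') → cong₂ _+_ (cong₂ _+_ (outside-ltʳ -p<d o') (tail-≡ a (outside-ltʳ -d<p o)))
      (cong₂ _+_ (outside-lt-suc -p<d o') (tail-≡ (ℤ.suc a) (outside-lt-suc -d<p o)))) (oA , oA'))
    (unmark (Keep-++ B (All.map (λ {b} o → cong₂ _+_ (+-congˡ (cnt b (perm C)) (outside-ltʳ -d<p o))
      (+-congˡ (cnt (ℤ.suc b) (perm C)) (outside-lt-suc -d<p o))) oB) (unmark (Keep-refl C))))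
  lower : ∀ s → cnt s (perm (B ++ (p , true) ∷ C)) ≤ cnt s (perm (B ++ (- d , false) ∷ C))
  lower s = subst₂ _≤_ (sym (cnt-perm-mid s B p true C)) (sym (cnt-perm-mid s B (- d) false C))
    (+-monoˡ-≤ (cnt s (perm (B ++ C))) (lt-monoˡ s (ℤₚ.<⇒≤ -d<p)))
  lower' : ∀ s → cnt s (d ∷ perm (B ++ (p , true) ∷ C)) ≤ cnt s (- p ∷ perm (B ++ (- d , false) ∷ C))
  lower' s = +-mono-≤ (lt-monoˡ s (ℤₚ.<⇒≤ -p<d)) (lower s)
  L⊴L' : L ⊴ L'
  L⊴L' = ⊴-++ A lower' (cons lower' (λ s _ → +-mono-≤ (lt-suc-< s -p<d) (+-mono-≤ (lower s) (lower (ℤ.suc s))))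
    (⊴-++ B (λ s → +-monoˡ-≤ (cnt s (perm C)) (lt-monoˡ s (ℤₚ.<⇒≤ -d<p)))
      (cons (λ s → +-monoˡ-≤ (cnt s (perm C)) (lt-monoˡ s (ℤₚ.<⇒≤ -d<p))) (λ s _ → +-monoˡ-≤ (cnt₂ s (perm C)) (lt-suc-< s -d<p)) (⊴-refl C))))

between-Move : ∀ {m V x x'} L → Move x x' → x ≡ perm L → IsB m (perm L) → Stuck L V → L ⊴ V → x' ≼ perm V → Between m L V
between-Move L (exchange A d B p C d<p o) e b st L⊴V h with perm-split A L e
... | LA , t , LX , refl , refl , eX with perm-split B LX (sym eX)
... | LB , t' , LC , refl , refl , refl = between-exchange LA d t LB p t' LC d<p o b st L⊴V h
between-Move L (flip A p C 0<p o) e b st L⊴V h with perm-split A L e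
... | LA , t , LC , refl , refl , refl = between-flip LA p t LC 0<p o b st L⊴V h
between-Move L (negswap A d B p C -d<p sg o o' o'') e b st L⊴V h with perm-split A L e
... | LA , t , LX , refl , refl , eX with perm-split B LX (sym eX)
... | LB , t' , LC , refl , refl , refl = between-negswap LA d t LB p t' LC -d<p sg o o' o'' b st L⊴V h

between : ∀ {m L V} → IsB m (perm L) → IsB m (perm V) → L ⊴ V → L ≢ V → Between m L V
between {m} {L} {V} bL bV L⊴V L≢V with stuck-or-mark L⊴V
... | inj₂ (L' , mk , L'⊴V) = L' , subst (IsB m) (sym (MarkOne-perm mk)) bL , MarkOne-⊴ mk , L'⊴V ,
  trans (cong₂ (λ σ o → 3 * pairs σ + 2 * negB σ + o) (MarkOne-perm mk) (MarkOne-ones mk)) (+-suc _ (ones L))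
... | inj₁ st with ≼⇒Move bL bV (⊴⇒perm≼ L⊴V) (λ e → L≢V (stuck-≡ L⊴V (All.map proj₁ (proj₁ (proj₂ bL))) st e))
... | σ' , mv , h = between-Move L mv refl bL st L⊴V h

-- Encodings belong to 𝒲

InBlock : ℤ → ℤ → Set
InBlock e z = lo z ≤ᶻ e × e ≤ᶻ hi z

lo-InBlock : ∀ z → InBlock (lo z) z
lo-InBlock z = ℤₚ.≤-refl , lo≤hi z

hi-InBlock : ∀ z → InBlock (hi z) z
hi-InBlock z = lo≤hi z , ℤₚ.≤-refl

fst-InBlock : ∀ t z → InBlock (fst t z) z
fst-InBlock true = hi-InBlock
fst-InBlock false = lo-InBlock

snd-InBlock : ∀ t z → InBlock (snd t z) z
snd-InBlock true = lo-InBlock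
snd-InBlock false = hi-InBlock

InBlock-unique : ∀ {e z z'} → InBlock e z → InBlock e z' → z ≡ z'
InBlock-unique {e} {z} {z'} (l , u) (l' , u') with ℤₚ.<-cmp z z'
... | tri< z<z' _ _ = ⊥-elim (ℤₚ.<⇒≱ (hi<lo z<z') (ℤₚ.≤-trans l' u))
... | tri≈ _ e _ = e
... | tri> _ _ z'<z = ⊥-elim (ℤₚ.<⇒≱ (hi<lo z'<z) (ℤₚ.≤-trans l u'))

InBlock-neg : ∀ {e z} → InBlock e z → InBlock (- e) (- z)
InBlock-neg {e} {z} (l , u) = subst (_≤ᶻ - e) (neg-hi z) (neg-mono-≤ u) , subst (- e ≤ᶻ_) (neg-lo z) (neg-mono-≤ l)

InBlock-∣∣ : ∀ {e f z z'} → InBlock e z → InBlock f z' → ∣ e ∣ ≡ ∣ f ∣ → ∣ z ∣ ≡ ∣ z' ∣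
InBlock-∣∣ {e} {f} {z} {z'} be bf eq with ∣≡∣⇒≡± e f eq
... | inj₁ refl = cong ∣_∣ (InBlock-unique be bf)
... | inj₂ refl = trans (cong ∣_∣ (InBlock-unique be (InBlock-neg bf))) (ℤₚ.∣-i∣≡∣i∣ z')

encode-injective : ∀ L L' → All (_≢ + 0) (perm L) → encode L ≡ encode L' → L ≡ L'
encode-injective [] [] _ _ = refl
encode-injective [] (_ ∷ _) _ ()
encode-injective ((z , t) ∷ L) ((z' , t') ∷ L') (z≢0 ∷ nz) e
  with InBlock-unique (fst-InBlock t z) (subst (λ x → InBlock x z') (sym (Listₚ.∷-injectiveˡ e)) (fst-InBlock t' z'))
     | encode-injective L L' nz (Listₚ.∷-injectiveʳ (Listₚ.∷-injectiveʳ e))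
... | refl | refl = cong (λ b → (z , b) ∷ L) (agree t t' (Listₚ.∷-injectiveˡ e))
  where
  agree : ∀ t t' → fst t z ≡ fst t' z → t ≡ t'
  agree true true _ = refl
  agree false false _ = refl
  agree true false e = ⊥-elim (ℤₚ.<-irrefl (sym e) (lo<hi z≢0))
  agree false true e = ⊥-elim (ℤₚ.<-irrefl e (lo<hi z≢0))

length-encode : ∀ L → length (encode L) ≡ length L + length L
length-encode [] = refl
length-encode (_ ∷ L) = cong suc (trans (cong suc (length-encode L)) (sym (+-suc (length L) (length L))))

m+m≡2*m : ∀ m → m + m ≡ 2 * m
m+m≡2*m m = +-congʳ m (sym (+-identityʳ m))

lo-bound : ∀ m z → z ≢ + 0 × ∣ z ∣ ≤ m → lo z ≢ + 0 × ∣ lo z ∣ ≤ m + m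
hi-bound : ∀ m z → z ≢ + 0 × ∣ z ∣ ≤ m → hi z ≢ + 0 × ∣ hi z ∣ ≤ m + m
lo-bound m (+ zero) (n , _) = ⊥-elim (n refl)
lo-bound m (+ suc k) (_ , k<m) = (λ ()) , ℕₚ.<⇒≤ (k<l⇒2k+1<2l k<m)
lo-bound m -[1+ k ] (_ , k<m) = (λ ()) , k<l⇒2k+1<2l k<m
hi-bound m (+ zero) (n , _) = ⊥-elim (n refl)
hi-bound m (+ suc k) (_ , k<m) = (λ ()) , k<l⇒2k+1<2l k<m
hi-bound m -[1+ k ] (_ , k<m) = (λ ()) , ℕₚ.<⇒≤ (k<l⇒2k+1<2l k<m)

encode-bound : ∀ m L → All (λ z → z ≢ + 0 × ∣ z ∣ ≤ m) (perm L) → All (λ z → z ≢ + 0 × ∣ z ∣ ≤ m + m) (encode L)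
encode-bound m [] [] = []
encode-bound m ((z , true) ∷ L) (b ∷ bs) = hi-bound m z b ∷ lo-bound m z b ∷ encode-bound m L bs
encode-bound m ((z , false) ∷ L) (b ∷ bs) = lo-bound m z b ∷ hi-bound m z b ∷ encode-bound m L bs

∣lo∣≢∣hi∣ : ∀ z → z ≢ + 0 → ∣ lo z ∣ ≢ ∣ hi z ∣
∣lo∣≢∣hi∣ (+ zero) n = ⊥-elim (n refl)
∣lo∣≢∣hi∣ (+ suc k) _ e = ℕₚ.1+n≢n (sym e)
∣lo∣≢∣hi∣ -[1+ k ] _ e = ℕₚ.1+n≢n e

encode-apart : ∀ {e z} L → InBlock e z → All (λ z' → ∣ z ∣ ≢ ∣ z' ∣) (perm L) → All (λ f → ∣ e ∣ ≢ ∣ f ∣) (encode L)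
encode-apart [] _ [] = []
encode-apart ((z' , t) ∷ L) be (n ∷ ns) = n ∘ InBlock-∣∣ be (fst-InBlock t z') ∷ n ∘ InBlock-∣∣ be (snd-InBlock t z') ∷ encode-apart L be ns

encode-unique : ∀ L → All (_≢ + 0) (perm L) → Unique (map ∣_∣ (perm L)) → Unique (map ∣_∣ (encode L))
encode-unique [] _ _ = []
encode-unique ((z , t) ∷ L) (z≢0 ∷ nz) (z∉ ∷ u) =
  (apart t ∷ Allₚ.map⁺ (encode-apart L (fst-InBlock t z) (Allₚ.map⁻ z∉))) ∷
  Allₚ.map⁺ (encode-apart L (snd-InBlock t z) (Allₚ.map⁻ z∉)) ∷ encode-unique L nz u
  where
  apart : ∀ t → ∣ fst t z ∣ ≢ ∣ snd t z ∣
  apart true e = ∣lo∣≢∣hi∣ z z≢0 (sym e)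
  apart false = ∣lo∣≢∣hi∣ z z≢0

IsB-encode : ∀ {m} L → IsB m (perm L) → IsB (2 * m) (encode L)
IsB-encode {m} L (len , bd , u) = subst (λ n → IsB n (encode L)) (m+m≡2*m m)
  ( trans (length-encode L) (cong₂ _+_ |L|≡m |L|≡m) , encode-bound m L bd , encode-unique L (All.map proj₁ bd) u )
  where |L|≡m = trans (sym (Listₚ.length-map proj₁ L)) len

atℕ-encode-lo : ∀ L i → i < length L → InBlock (atℕ (encode L) (i + i)) (atℕ (perm L) i)
atℕ-encode-lo ((z , t) ∷ L) zero _ = fst-InBlock t z
atℕ-encode-lo ((z , t) ∷ L) (suc i) (s≤s i<) rewrite +-suc i i = atℕ-encode-lo L i i<

atℕ-encode-hi : ∀ L i → i < length L → InBlock (atℕ (encode L) (suc (i + i))) (atℕ (perm L) i)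
atℕ-encode-hi ((z , t) ∷ L) zero _ = snd-InBlock t z
atℕ-encode-hi ((z , t) ∷ L) (suc i) (s≤s i<) rewrite +-suc i i = atℕ-encode-hi L i i<

-- Positions are grouped into the same blocks as values: an encoding sends the two positions of
-- block `s` to the two values of the block of σ(s).
data LoHi (b s : ℤ) : Set where
  is-lo : b ≡ lo s → LoHi b s
  is-hi : b ≡ hi s → LoHi b s

2i<2m⇒i<m : ∀ {i m} → i + i < m + m → i < m
2i<2m⇒i<m {i} {m} h = ℕₚ.≰⇒> (λ m≤i → ℕₚ.<⇒≱ h (+-mono-≤ m≤i m≤i))

block-of : ∀ m b → InPM (m + m) b → ∃ λ s → LoHi b s × (s ≢ + 0 × ∣ s ∣ ≤ m)
block-of m (+ zero) (n , _) = ⊥-elim (n refl)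
block-of m (+ suc k) (_ , k<) with halve k
... | i , inj₁ refl = + suc i , is-lo refl , (λ ()) , 2i<2m⇒i<m k<
... | i , inj₂ refl = + suc i , is-hi refl , (λ ()) , 2i<2m⇒i<m (ℕₚ.<⇒≤ k<)
block-of m -[1+ k ] (_ , k<) with halve k
... | i , inj₁ refl = -[1+ i ] , is-hi refl , (λ ()) , 2i<2m⇒i<m k<
... | i , inj₂ refl = -[1+ i ] , is-lo refl , (λ ()) , 2i<2m⇒i<m (ℕₚ.<⇒≤ k<)

ev-encode : ∀ L b s → LoHi b s → s ≢ + 0 → ∣ s ∣ ≤ length L → InBlock (ev (encode L) b) (ev (perm L) s)
ev-encode L b (+ zero) _ n _ = ⊥-elim (n refl)
ev-encode L _ (+ suc i) (is-lo refl) _ i< = atℕ-encode-lo L i i<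
ev-encode L _ (+ suc i) (is-hi refl) _ i< = atℕ-encode-hi L i i<
ev-encode L _ -[1+ i ] (is-lo refl) _ i< = InBlock-neg (atℕ-encode-hi L i i<)
ev-encode L _ -[1+ i ] (is-hi refl) _ i< = InBlock-neg (atℕ-encode-lo L i i<)

i≢-i : ∀ {i} → i ≢ + 0 → i ≢ - i
i≢-i {+ zero} n _ = n refl
i≢-i {+ suc _} _ ()
i≢-i { -[1+ _ ]} _ ()

ev-injective : ∀ {m σ} → IsB m σ → ∀ s s' → s ≢ + 0 × ∣ s ∣ ≤ m → s' ≢ + 0 × ∣ s' ∣ ≤ m → ev σ s ≡ ev σ s' → s ≡ s'
ev-injective {m} {σ} (len , bd , u) s s' (s≢0 , s≤) (s'≢0 , s'≤) e = go s s' s≢0 s'≢0 s≤ s'≤ e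
  where
  index : ∀ i j → i < m → j < m → ∣ atℕ σ i ∣ ≡ ∣ atℕ σ j ∣ → i ≡ j
  index i j i< j< = unique-atℕ σ i j u (subst (i <_) (sym len) i<) (subst (j <_) (sym len) j<)
  nz : ∀ i → i < m → atℕ σ i ≢ + 0
  nz i i< = proj₁ (atℕ-All σ i bd (subst (i <_) (sym len) i<))
  go : ∀ s s' → s ≢ + 0 → s' ≢ + 0 → ∣ s ∣ ≤ m → ∣ s' ∣ ≤ m → ev σ s ≡ ev σ s' → s ≡ s'
  go (+ zero) _ n _ _ _ _ = ⊥-elim (n refl)
  go _ (+ zero) _ n _ _ _ = ⊥-elim (n refl)
  go (+ suc i) (+ suc j) _ _ i< j< e = cong (λ k → + suc k) (index i j i< j< (cong ∣_∣ e))
  go -[1+ i ] -[1+ j ] _ _ i< j< e = cong -[1+_] (index i j i< j< (cong ∣_∣ (ℤₚ.neg-injective e)))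
  go (+ suc i) -[1+ j ] _ _ i< j< e with index i j i< j< (trans (cong ∣_∣ e) (ℤₚ.∣-i∣≡∣i∣ (atℕ σ j)))
  ... | refl = ⊥-elim (i≢-i (nz i i<) e)
  go -[1+ i ] (+ suc j) _ _ i< j< e with index i j i< j< (trans (sym (ℤₚ.∣-i∣≡∣i∣ (atℕ σ i))) (cong ∣_∣ e))
  ... | refl = ⊥-elim (i≢-i (nz i i<) (sym e))

isEven-double : ∀ k → isEven (k + k) ≡ true
isEven-double zero = refl
isEven-double (suc k) rewrite +-suc k k = isEven-double k

isEven-suc-double : ∀ k → isEven (suc (k + k)) ≡ false
isEven-suc-double zero = refl
isEven-suc-double (suc k) rewrite +-suc k k = isEven-suc-double k

-- An odd number is the lower value of its block and the following even number the upper one; a < n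
-- rules out the last case of `star`.
star-block : ∀ n a → 1 ≤ a → a < n → ∃ λ s → InBlock (+ a) s × InBlock (+ star n a) s
star-block n (suc a) _ a<n with halve a
... | k , inj₂ refl rewrite isEven-double k = + suc k , hi-InBlock (+ suc k) , lo-InBlock (+ suc k)
... | k , inj₁ refl rewrite isEven-suc-double k with suc (suc (k + k)) ℕ.≤? n
... | yes _ = + suc k , lo-InBlock (+ suc k) , hi-InBlock (+ suc k)
... | no n≰ = ⊥-elim (n≰ a<n)

hi≡suc-lo : ∀ s → s ≢ + 0 → hi s ≡ ℤ.suc (lo s)
hi≡suc-lo (+ zero) n = ⊥-elim (n refl)
hi≡suc-lo (+ suc k) _ = refl
hi≡suc-lo -[1+ k ] _ = refl

∣i-i∣≤1 : ∀ i → ∣ i ℤ.- i ∣ ≤ 1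
∣i-i∣≤1 i = subst (λ t → ∣ t ∣ ≤ 1) (sym (ℤₚ.+-inverseʳ i)) z≤n

∣suc-i∣≤1 : ∀ i → ∣ ℤ.suc i ℤ.- i ∣ ≤ 1
∣suc-i∣≤1 i = ≤-reflexive (cong ∣_∣ (trans (ℤₚ.+-assoc (+ 1) i (- i)) (cong (λ t → + 1 ℤ.+ t) (ℤₚ.+-inverseʳ i))))

LoHi-near : ∀ {b c s} → s ≢ + 0 → LoHi b s → LoHi c s → ∣ b ℤ.- c ∣ ≤ 1
LoHi-near {s = s} n (is-lo refl) (is-lo refl) = ∣i-i∣≤1 (lo s)
LoHi-near {s = s} n (is-hi refl) (is-hi refl) = ∣i-i∣≤1 (hi s)
LoHi-near {s = s} n (is-hi refl) (is-lo refl) rewrite hi≡suc-lo s n = ∣suc-i∣≤1 (lo s)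
LoHi-near {s = s} n (is-lo refl) (is-hi refl) rewrite hi≡suc-lo s n | ℤₚ.∣i-j∣≡∣j-i∣ (lo s) (ℤ.suc (lo s)) = ∣suc-i∣≤1 (lo s)

-- The values `a` and `star (2 * m) a` share a block. Since σ is injective, so do their positions,
-- and positions in one block differ by at most one.
IsW-encode : ∀ {m} L → IsB m (perm L) → IsW (2 * m) (encode L)
IsW-encode {m} L bL = IsB-encode L bL , adjacent
  where
  |L|≡m = trans (sym (Listₚ.length-map proj₁ L)) (proj₁ bL)
  adjacent : ∀ a b c → 1 ≤ a → a < 2 * m → InPM (2 * m) b → InPM (2 * m) c →
    ev (encode L) b ≡ + a → ev (encode L) c ≡ + star (2 * m) a → ∣ b ℤ.- c ∣ ≤ 1
  adjacent a b c 1≤a a< pb pc eb ec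
    with block-of m b (subst (λ n → InPM n b) (sym (m+m≡2*m m)) pb) | block-of m c (subst (λ n → InPM n c) (sym (m+m≡2*m m)) pc)
       | star-block (2 * m) a 1≤a a<
  ... | s , lb , s≢0 , s≤ | s' , lc , s'≢0 , s'≤ | r , ra , r* with ev-injective bL s s' (s≢0 , s≤) (s'≢0 , s'≤)
    (trans (InBlock-unique (subst (λ x → InBlock x (ev (perm L) s)) eb (ev-encode L b s lb s≢0 (subst (∣ s ∣ ≤_) (sym |L|≡m) s≤))) ra)
      (sym (InBlock-unique (subst (λ x → InBlock x (ev (perm L) s')) ec (ev-encode L c s' lc s'≢0 (subst (∣ s' ∣ ≤_) (sym |L|≡m) s'≤))) r*)))
  ... | refl = LoHi-near s≢0 lb lc

-- Bottom and top

negFrom : ℕ → ℕ → List ℤ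
negFrom c zero = []
negFrom c (suc r) = -[1+ c ] ∷ negFrom (suc c) r

-- For c = 0 the marks are chosen so that the encodings are the longest element of B_2m and the
-- identity. The offset `c` makes tails have the same form.
topFrom botFrom : ℕ → ℕ → Marked
topFrom c zero = []
topFrom c (suc r) = (-[1+ c ] , true) ∷ topFrom (suc c) r
botFrom c zero = []
botFrom c (suc r) = (+ suc c , false) ∷ botFrom (suc c) r

perm-topFrom : ∀ c r → perm (topFrom c r) ≡ negFrom c r
perm-topFrom c zero = refl
perm-topFrom c (suc r) = cong (-[1+ c ] ∷_) (perm-topFrom (suc c) r)

perm-botFrom : ∀ c r → perm (botFrom c r) ≡ neg (negFrom c r)
perm-botFrom c zero = refl
perm-botFrom c (suc r) = cong (+ suc c ∷_) (perm-botFrom (suc c) r)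

encode-topFrom : ∀ c r → encode (topFrom c r) ≡ negFrom (c + c) (r + r)
encode-topFrom c zero = refl
encode-topFrom c (suc r) rewrite +-suc r r = cong (λ X → -[1+ c + c ] ∷ -[1+ suc (c + c) ] ∷ X)
  (trans (encode-topFrom (suc c) r) (cong (λ k → negFrom (suc k) (r + r)) (+-suc c c)))

encode-botFrom : ∀ c r → encode (botFrom c r) ≡ neg (negFrom (c + c) (r + r))
encode-botFrom c zero = refl
encode-botFrom c (suc r) rewrite +-suc r r = cong (λ X → + suc (c + c) ∷ + suc (suc (c + c)) ∷ X)
  (trans (encode-botFrom (suc c) r) (cong (λ k → neg (negFrom (suc k) (r + r))) (+-suc c c)))

length-negFrom : ∀ c r → length (negFrom c r) ≡ r
length-negFrom c zero = refl
length-negFrom c (suc r) = cong suc (length-negFrom (suc c) r)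

negFrom-bounds : ∀ c r → All (λ z → z ≢ + 0 × (c < ∣ z ∣ × ∣ z ∣ ≤ c + r)) (negFrom c r)
negFrom-bounds c zero = []
negFrom-bounds c (suc r) = ((λ ()) , ≤-refl , subst (suc c ≤_) (sym (+-suc c r)) (s≤s (m≤m+n c r))) ∷
  All.map (λ {z} (n , l , u) → n , ℕₚ.<⇒≤ l , subst (∣ z ∣ ≤_) (sym (+-suc c r)) u) (negFrom-bounds (suc c) r)

negFrom-unique : ∀ c r → Unique (map ∣_∣ (negFrom c r))
negFrom-unique c zero = []
negFrom-unique c (suc r) = Allₚ.map⁺ (All.map (λ (_ , l , _) → ℕₚ.<⇒≢ l) (negFrom-bounds (suc c) r)) ∷ negFrom-unique (suc c) r

IsB-negFrom : ∀ n → IsB n (negFrom 0 n)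
IsB-negFrom n = length-negFrom 0 n , All.map (λ (nz , _ , u) → nz , u) (negFrom-bounds 0 n) , negFrom-unique 0 n

IsB-neg : ∀ {n x} → IsB n x → IsB n (neg x)
IsB-neg {n} {x} = IsB-resp-↭ (↭-reflexive (∣neg∣ x))
  where
  ∣neg∣ : ∀ x → map ∣_∣ x ≡ map ∣_∣ (neg x)
  ∣neg∣ [] = refl
  ∣neg∣ (z ∷ x) = cong₂ _∷_ (sym (ℤₚ.∣-i∣≡∣i∣ z)) (∣neg∣ x)

neg-neg : ∀ x → neg (neg x) ≡ x
neg-neg [] = refl
neg-neg (z ∷ x) = cong₂ _∷_ (neg-involutive z) (neg-neg x)

≼-neg : ∀ {x y} → x ≼ y → neg y ≼ neg x
≼-neg [] = []
≼-neg {x} {y} h@(_ ∷ t) = (λ j → subst (λ k → cnt k (neg y) ≤ cnt k (neg x)) (suc-neg-suc-neg j)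
  (cnt-neg-≤ (ℤ.suc (- j)) x y (≼-length h) (≼⇒cnt≤ h _))) ∷ ≼-neg t

cnt-negFrom-all : ∀ c r {j} → -[1+ c ] <ᶻ j → cnt j (negFrom c r) ≡ r
cnt-negFrom-all c zero _ = refl
cnt-negFrom-all c (suc r) l = cong₂ _+_ (lt-yes l) (cnt-negFrom-all (suc c) r (ℤₚ.<-trans (ℤ.-<- ≤-refl) l))

-- Above `-[1+ c ]` every entry of `negFrom c r` is counted, so only lower thresholds matter. At
-- these the first entry is not counted, and the bound passes to the tail.
≼-negFrom′ : ∀ c r Q → length Q ≡ r → (∀ j → j ≤ᶻ -[1+ c ] → cnt j Q ≤ cnt j (negFrom c r)) → Q ≼ negFrom c r
≼-negFrom′ c zero [] _ _ = []
≼-negFrom′ c (suc r) (q ∷ Q) e h = head ∷ ≼-negFrom′ (suc c) r Q (ℕₚ.suc-injective e) tail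
  where
  head : ∀ j → cnt j (q ∷ Q) ≤ cnt j (negFrom c (suc r))
  head j with -[1+ c ] <ℤ? j
  ... | yes l = ≤-trans (cnt≤length j (q ∷ Q)) (≤-reflexive (trans e (sym (cong suc (cnt-negFrom-all (suc c) r (ℤₚ.<-trans (ℤ.-<- ≤-refl) l))))))
  ... | no ¬l = ≤-trans (h j (ℤₚ.≮⇒≥ ¬l)) (≤-reflexive (+-congˡ _ (lt-no (ℤₚ.≮⇒≥ ¬l))))
  tail : ∀ j → j ≤ᶻ -[1+ suc c ] → cnt j Q ≤ cnt j (negFrom (suc c) r)
  tail j le = ≤-trans (m≤n+m (cnt j Q) (lt q j)) (≤-trans (h j le') (≤-reflexive (+-congˡ _ (lt-no le'))))
    where le' = ℤₚ.≤-trans le (ℤₚ.<⇒≤ (ℤ.-<- ≤-refl))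

cnt≤cnt-∣∣ : ∀ {j} → j ≤ᶻ + 0 → ∀ x → cnt j x ≤ cnt j (neg (map +_ (map ∣_∣ x)))
cnt≤cnt-∣∣ _ [] = z≤n
cnt≤cnt-∣∣ {j} j≤0 (z ∷ x) = +-mono-≤ (one z) (cnt≤cnt-∣∣ j≤0 x)
  where
  one : ∀ z → lt z j ≤ lt (- + ∣ z ∣) j
  one (+ n) = lt-mono (ℤₚ.≤-<-trans ℤₚ.neg-≤-pos)
  one -[1+ n ] = ≤-refl

neg-∣negFrom∣ : ∀ c r → neg (map +_ (map ∣_∣ (negFrom c r))) ≡ negFrom c r
neg-∣negFrom∣ c zero = refl
neg-∣negFrom∣ c (suc r) = cong (-[1+ c ] ∷_) (neg-∣negFrom∣ (suc c) r)

-- At thresholds up to 0, replacing each entry by minus its absolute value can only raise the count,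
-- and the outcome is a rearrangement of `negFrom 0 n`.
≼-negFrom : ∀ {n x} → IsB n x → x ≼ negFrom 0 n
≼-negFrom {n} {x} bx = ≼-negFrom′ 0 n x (proj₁ bx) (λ j j≤ → ≤-trans (cnt≤cnt-∣∣ (ℤₚ.≤-trans j≤ ℤ.-≤+) x)
  (≤-reflexive (trans (cnt-↭ j (↭ₚ.map⁺ -_ (↭ₚ.map⁺ +_ (IsB-↭ bx (IsB-negFrom n))))) (cong (cnt j) (neg-∣negFrom∣ 0 n)))))

neg-negFrom-≼ : ∀ {n x} → IsB n x → neg (negFrom 0 n) ≼ x
neg-negFrom-≼ {n} {x} bx = subst (neg (negFrom 0 n) ≼_) (neg-neg x) (≼-neg (≼-negFrom (IsB-neg bx)))

-- All inversions and all negative sums occur, r (r - 1) in total; the added `r` avoids a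
-- subtraction.
pairs-negFrom : ∀ c r → pairs (negFrom c r) + r ≡ r * r
pairs-negFrom c zero = refl
pairs-negFrom c (suc r) = trans (cong₂ (λ a b → a + b + pairs (negFrom (suc c) r) + suc r)
    (cnt-negFrom-all (suc c) r (ℤ.-<- ≤-refl)) (cnt-negFrom-all (suc c) r ℤ.-<+))
  (trans (regroup r (pairs (negFrom (suc c) r))) (trans (+-congˡ (r + r + 1) (pairs-negFrom (suc c) r)) (square r)))
  where
  regroup : ∀ r p → r + r + p + suc r ≡ (p + r) + (r + r + 1)
  regroup = solve-∀
  square : ∀ r → r * r + (r + r + 1) ≡ suc r * suc r
  square = solve-∀

ones-topFrom : ∀ c r → ones (topFrom c r) ≡ r
ones-topFrom c zero = refl
ones-topFrom c (suc r) = cong suc (ones-topFrom (suc c) r)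

rank-top : ∀ m → rank (topFrom 0 m) ≡ 3 * m * m
rank-top m = trans (cong₂ (λ σ o → 3 * pairs σ + 2 * negB σ + o) (perm-topFrom 0 m) (ones-topFrom 0 m))
  (trans (cong (λ n → 3 * pairs (negFrom 0 m) + 2 * n + m) (cnt-negFrom-all 0 m ℤ.-<+))
  -- The `m` marks complete the term 2 m to 3 m, so that the factor 3 comes out and `pairs + m` is
  -- the square of `m`.
  (trans (regroup (pairs (negFrom 0 m)) m) (trans (cong (3 *_) (pairs-negFrom 0 m)) (sym (ℕₚ.*-assoc 3 m m)))))
  where regroup : ∀ p m → 3 * p + 2 * m + m ≡ 3 * (p + m)
        regroup = solve-∀

cnt-posFrom : ∀ c r {j} → j ≤ᶻ + suc c → cnt j (neg (negFrom c r)) ≡ 0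
cnt-posFrom c zero _ = refl
cnt-posFrom c (suc r) le = cong₂ _+_ (lt-no le) (cnt-posFrom (suc c) r (ℤₚ.≤-trans le (ℤ.+≤+ (ℕₚ.n≤1+n _))))

pairs-posFrom : ∀ c r → pairs (neg (negFrom c r)) ≡ 0
pairs-posFrom c zero = refl
pairs-posFrom c (suc r) = cong₂ _+_ (cong₂ _+_ (cnt-posFrom (suc c) r (ℤ.+≤+ (ℕₚ.n≤1+n _))) (cnt-posFrom (suc c) r ℤ.-≤+)) (pairs-posFrom (suc c) r)

ones-botFrom : ∀ c r → ones (botFrom c r) ≡ 0
ones-botFrom c zero = refl
ones-botFrom c (suc r) = ones-botFrom (suc c) r

rank-bot : ∀ m → rank (botFrom 0 m) ≡ 0
rank-bot m = cong₂ _+_ (cong₂ (λ p n → 3 * p + 2 * n) (trans (cong pairs (perm-botFrom 0 m)) (pairs-posFrom 0 m))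
  (trans (cong negB (perm-botFrom 0 m)) (cnt-posFrom 0 m (ℤ.+≤+ z≤n)))) (ones-botFrom 0 m)

IsB-top : ∀ m → IsB m (perm (topFrom 0 m))
IsB-top m = subst (IsB m) (sym (perm-topFrom 0 m)) (IsB-negFrom m)

IsB-bot : ∀ m → IsB m (perm (botFrom 0 m))
IsB-bot m = subst (IsB m) (sym (perm-botFrom 0 m)) (IsB-neg (IsB-negFrom m))

≼-top : ∀ {m x} → IsB (2 * m) x → x ≼ encode (topFrom 0 m)
≼-top {m} {x} bx = subst (x ≼_) (trans (cong (negFrom 0) (sym (m+m≡2*m m))) (sym (encode-topFrom 0 m))) (≼-negFrom bx)

bot-≼ : ∀ {m x} → IsB (2 * m) x → encode (botFrom 0 m) ≼ x
bot-≼ {m} {x} bx = subst (_≼ x) (trans (cong (λ k → neg (negFrom 0 k)) (sym (m+m≡2*m m))) (sym (encode-botFrom 0 m))) (neg-negFrom-≼ bx)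

-- Covers, minimal and maximal elements

nonzero : ∀ {m σ} → IsB m σ → All (_≢ + 0) σ
nonzero (_ , bd , _) = All.map proj₁ bd

-- `between` yields an element of the interval whose rank is one above that of `L`. It cannot be
-- `L`, so the covering relation makes it `V`.
cover-rank : ∀ {m} L V → IsB m (perm L) → IsB m (perm V) → CoverW (2 * m) (encode L) (encode V) → rank V ≡ suc (rank L)
cover-rank {m} L V bL bV (_ , _ , L≤V , L≢V , cover)
  with between bL bV (encode-≼⇒⊴ L V (Bruhat⇒≼ L≤V)) (λ e → L≢V (cong encode e))
... | L' , bL' , L⊴L' , L'⊴V , e with cover (encode L') (IsW-encode L' bL')
      (≼⇒Bruhat (IsB-encode L bL) (IsB-encode L' bL') (⊴⇒encode-≼ L⊴L'))
      (≼⇒Bruhat (IsB-encode L' bL') (IsB-encode V bV) (⊴⇒encode-≼ L'⊴V))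
... | inj₁ L'≡L with encode-injective L' L (nonzero bL') L'≡L
... | refl = ⊥-elim (ℕₚ.1+n≢n (sym e))
cover-rank {m} L V bL bV _ | L' , bL' , _ , _ , e | inj₂ L'≡V with encode-injective L' V (nonzero bL') L'≡V
... | refl = e

minimal-rank : ∀ {m} L → IsB m (perm L) → MinimalW (2 * m) (encode L) → rank L ≡ 0
minimal-rank {m} L bL (_ , min) = trans (cong rank (sym (encode-injective (botFrom 0 m) L (nonzero (IsB-bot m))
  (min _ (IsW-encode (botFrom 0 m) (IsB-bot m)) (≼⇒Bruhat (IsB-encode (botFrom 0 m) (IsB-bot m)) bE (bot-≼ {m} bE)))))) (rank-bot m)
  where bE = IsB-encode L bL

maximal-rank : ∀ {m} L → IsB m (perm L) → MaximalW (2 * m) (encode L) → rank L ≡ 3 * m * m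
maximal-rank {m} L bL (_ , max) = trans (cong rank (sym (encode-injective (topFrom 0 m) L (nonzero (IsB-top m))
  (max _ (IsW-encode (topFrom 0 m) (IsB-top m)) (≼⇒Bruhat bE (IsB-encode (topFrom 0 m) (IsB-top m)) (≼-top {m} bE)))))) (rank-top m)
  where bE = IsB-encode L bL

marked : ∀ {m σ} T → IsB m σ → length T ≡ m → ∃ λ L → σ ≡ perm L × T ≡ marks L
marked {σ = σ} T (len , _) e = mark σ T (trans len (sym e))

theorem4p7 : (m : ℕ) → 1 ≤ m →
    ((σ τ : Window) (T S : List Bool) → IsB m σ → length T ≡ m → IsB m τ → length S ≡ m →
        CoverW (2 * m) (enc σ T) (enc τ S) → ℓW τ S ≡ ℓW σ T ℤ.+ + 1)
    × ((σ : Window) (T : List Bool) → IsB m σ → length T ≡ m →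
        MinimalW (2 * m) (enc σ T) → ℓW σ T ≡ + 0)
    × ((σ : Window) (T : List Bool) → IsB m σ → length T ≡ m →
        MaximalW (2 * m) (enc σ T) → ℓW σ T ≡ + (3 * m * m))
theorem4p7 m _ = covers , minimal , maximal
  where
  covers : (σ τ : Window) (T S : List Bool) → IsB m σ → length T ≡ m → IsB m τ → length S ≡ m →
    CoverW (2 * m) (enc σ T) (enc τ S) → ℓW τ S ≡ ℓW σ T ℤ.+ + 1
  covers σ τ T S bσ eT bτ eS c with marked T bσ eT | marked S bτ eS
  ... | L , refl , refl | V , refl , refl = begin
    ℓW (perm V) (marks V)         ≡⟨ ℓW≡rank V bτ ⟩
    + rank V                      ≡⟨ cong +_ (trans (cover-rank L V bσ bτ (subst₂ (CoverW (2 * m)) (enc≡encode L) (enc≡encode V) c)) (+-comm 1 (rank L))) ⟩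
    + rank L ℤ.+ + 1              ≡⟨ cong (ℤ._+ + 1) (ℓW≡rank L bσ) ⟨
    ℓW (perm L) (marks L) ℤ.+ + 1 ∎
    where open ≡-Reasoning
  minimal : (σ : Window) (T : List Bool) → IsB m σ → length T ≡ m → MinimalW (2 * m) (enc σ T) → ℓW σ T ≡ + 0
  minimal σ T bσ eT mn with marked T bσ eT
  ... | L , refl , refl = trans (ℓW≡rank L bσ) (cong +_ (minimal-rank L bσ (subst (MinimalW (2 * m)) (enc≡encode L) mn)))
  maximal : (σ : Window) (T : List Bool) → IsB m σ → length T ≡ m → MaximalW (2 * m) (enc σ T) → ℓW σ T ≡ + (3 * m * m)
  maximal σ T bσ eT mx with marked T bσ eT
  ... | L , refl , refl = trans (ℓW≡rank L bσ) (cong +_ (maximal-rank L bσ (subst (MaximalW (2 * m)) (enc≡encode L) mx)))
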